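{- Let $G=\langle V,E\rangle$ be a weighted directed graph with $n$ vertices, $m$ edges and real (possibly negative) arc weights, whose underlying undirected graph is chordal. Then the algorithms Snowball and Chleq–APSP, run with a perfect (simplicial) vertex ordering of $G$, compute all-pairs shortest paths on $G$ in $\mathcal{O}(nm)$ time. Chordal graphs can be recognised in $\mathcal{O}(m)$ time, and a perfect ordering of a chordal graph exists and can be found in $\mathcal{O}(m)$ time, so that the total run time, including finding the ordering, is $\mathcal{O}(nm)$.
   Context: Graphs are finite, without self-loops, with at most one arc $i\to j$ for each ordered pair. A vertex ordering is a bijection $d:V\to\{1,\dots,n\}$; vertices are identified with their positions, so $V=\{1,\dots,n\}$. $w_{i\to j}\in\mathbb{R}$ is the weight of the arc $i\to j$ (read as $+\infty$ if that arc is absent). We write $\{i,j\}\in E$ if there is an arc between $i$ and $j$ in either direction; "edges" and "neighbours" refer to this underlying undirected graph. A graph is chordal if every cycle of length greater than 3 has a chord (an edge between two vertices that are not adjacent in the cycle). An ordering is perfect (simplicial) if every vertex $k$ together with its lower-numbered neighbours induces a clique, so that triangulating along it adds no edges. A negative cycle is a closed path with negative total weight. The specified output of both algorithms is the matrix $D$ of shortest-path distances ($D[i][j]$ being the length of a shortest directed path from $i$ to $j$ in $G$), or INCONSISTENT if $G$ contains a negative cycle. Algorithm DPC (input $G$, $d$): For $k=n$ down to $1$, for all $i<j<k$ with $\{i,k\},\{j,k\}\in E$: set $w_{i\to j}\leftarrow\min\{w_{i\to j},w_{i\to k}+w_{k\to j}\}$, $w_{j\to i}\leftarrow\min\{w_{j\to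 i},w_{j\to k}+w_{k\to i}\}$, $E\leftarrow E\cup\{\{i,j\}\}$; if $w_{i\to j}+w_{j\to i}<0$, return INCONSISTENT. Return the modified graph $G$. Algorithm Snowball (input $G$, $d$): Replace $G$ by DPC$(G,d)$; return INCONSISTENT if DPC did. Set $D[i][j]\leftarrow\infty$ for all $i,j\in V$, then $D[i][i]\leftarrow 0$ for all $i\in V$. For $k=1$ to $n$: for all $j<k$ with $\{j,k\}\in E$: for all $i\in\{1,\dots,k-1\}$: $D[i][k]\leftarrow\min\{D[i][k],D[i][j]+w_{j\to k}\}$ and $D[k][i]\leftarrow\min\{D[k][i],w_{k\to j}+D[j][i]\}$. Return $D$. Procedure Min-paths($G,s$): Set $D'[i]\leftarrow\infty$ for all $i\in V$, then $D'[s]\leftarrow 0$. For $k=s$ down to $1$, for all $j<k$ with $\{j,k\}\in E$: $D'[j]\leftarrow\min\{D'[j],D'[k]+w_{k\to j}\}$. Then for $k=1$ to $n$, for all $j>k$ with $\{j,k\}\in E$: $D'[j]\leftarrow\min\{D'[j],D'[k]+w_{k\to j}\}$. Return the array $D'$. Algorithm Chleq–APSP (input $G$, $d$): Replace $G$ by DPC$(G,d)$; return INCONSISTENT if DPC did. For $i=1$ to $n$ set the row $D[i][\ast]\leftarrow$ Min-paths($G,i$). Return $D$.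
   Formalization: DPC as printed misses a negative antiparallel pair with no common later neighbour: both algorithms are proved correct if no such pair is negative, and for all weights after an added test of every edge; m in the time bounds is read as max(m, n−1), with 1 added inside the O. -}

module Defs where

open import Level using (Level; _⊔_; suc)
open import Algebra.Structures using (IsAbelianGroup)
open import Data.Bool.Base using (Bool; true; false; T; not; _∨_; if_then_else_)
open import Data.Bool.Properties using (T?; ∨-comm)
open import Data.Fin.Base as Fin using (Fin; toℕ)
open import Data.Fin.Permutation using (Permutation′; _⟨$⟩ʳ_; _⟨$⟩ˡ_)
import Data.Fin.Properties as Fin
open import Data.List.Base using (List; []; _∷_; length; map; filter; allFin; cartesianProduct)
open import Data.List.Membership.Propositional using (_∈_)
open import Data.List.Relation.Unary.Unique.Propositional using (Unique)
open import Data.Maybe.Base using (Maybe; just; nothing; is-just)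
open import Data.Nat.Base as ℕ using (ℕ; zero; _<_; _≤_; _+_; _∸_; _*_; _<ᵇ_; _≡ᵇ_)
open import Data.Product.Base using (Σ-syntax; _×_; _,_; proj₁; proj₂; map₂)
open import Data.Sum.Base using (_⊎_)
open import Function.Bundles using (_⇔_)
open import Function.Definitions using (Injective)
open import Relation.Binary.Core using (Rel)
open import Relation.Binary.Structures using (IsDecTotalOrder)
open import Relation.Binary.PropositionalEquality.Core using (_≡_; _≢_; cong₂)
open import Relation.Nullary.Decidable.Core using (does; _×-dec_)
open import Relation.Nullary.Negation.Core using (¬_)

------------------------------------------------------------------------
-- Weights

-- The algorithms only add and compare weights, so ℝ enters through its
-- structure of a totally ordered abelian group. Decidability of the order
-- is the unit-cost comparison of two reals.

record OrderedAbelianGroup (c ℓ₁ ℓ₂ : Level) : Set (suc (c ⊔ ℓ₁ ⊔ ℓ₂)) where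
  infix  4 _≈_ _≤ᴳ_
  infixl 6 _+ᴳ_
  field
    Carrier         : Set c
    _≈_             : Rel Carrier ℓ₁
    _≤ᴳ_            : Rel Carrier ℓ₂
    _+ᴳ_            : Carrier → Carrier → Carrier
    0ᴳ              : Carrier
    -ᴳ_             : Carrier → Carrier
    isAbelianGroup  : IsAbelianGroup _≈_ _+ᴳ_ 0ᴳ -ᴳ_
    isDecTotalOrder : IsDecTotalOrder _≈_ _≤ᴳ_
    +ᴳ-monoʳ-≤ᴳ     : ∀ z {x y} → x ≤ᴳ y → z +ᴳ x ≤ᴳ z +ᴳ y

  open IsDecTotalOrder isDecTotalOrder public using (_≤?_)

  _<ᴳ_ : Rel Carrier ℓ₂
  x <ᴳ y = ¬ (y ≤ᴳ x)

module _ {c ℓ₁ ℓ₂ : Level} (W : OrderedAbelianGroup c ℓ₁ ℓ₂) where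
  open OrderedAbelianGroup W

  -- Weights extended by +∞, which is `nothing`.
  Weight∞ : Set c
  Weight∞ = Maybe Carrier

  _+∞_ : Weight∞ → Weight∞ → Weight∞
  just x +∞ just y = just (x +ᴳ y)
  _      +∞ _      = nothing

  _≤∞ᵇ_ : Weight∞ → Weight∞ → Bool
  _       ≤∞ᵇ nothing = true
  nothing ≤∞ᵇ just _  = false
  just x  ≤∞ᵇ just y  = does (x ≤? y)

  min∞ : Weight∞ → Weight∞ → Weight∞
  min∞ x y = if x ≤∞ᵇ y then x else y

------------------------------------------------------------------------
-- Undirected graphs, chordality, orderings

record Graph (n : ℕ) : Set where
  field
    adj     : Fin n → Fin n → Bool
    adj-sym : ∀ i j → adj i j ≡ adj j i
    no-loop : ∀ i → adj i i ≡ false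

  Adj : Fin n → Fin n → Set
  Adj i j = T (adj i j)

  edges : List (Fin n × Fin n)
  edges = filter (λ (i , j) → (i Fin.<? j) ×-dec T? (adj i j))
                 (cartesianProduct (allFin n) (allFin n))

  #edges : ℕ
  #edges = length edges

open Graph public using (Adj; #edges)

CyclicSuc : ∀ {ℓ} → Fin ℓ → Fin ℓ → Set
CyclicSuc {ℓ} a b = (toℕ b ≡ ℕ.suc (toℕ a)) ⊎ (ℕ.suc (toℕ a) ≡ ℓ × toℕ b ≡ 0)

record Cycle {n : ℕ} (U : Graph n) (ℓ : ℕ) : Set where
  field
    vertex    : Fin ℓ → Fin n
    injective : Injective _≡_ _≡_ vertex
    edge      : ∀ {a b} → CyclicSuc a b → Adj U (vertex a) (vertex b)

HasChord : ∀ {n} {U : Graph n} {ℓ} → Cycle U ℓ → Set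
HasChord {U = U} {ℓ} C =
  Σ[ a ∈ Fin ℓ ] Σ[ b ∈ Fin ℓ ]
    a ≢ b × ¬ CyclicSuc a b × ¬ CyclicSuc b a × Adj U (vertex a) (vertex b)
  where open Cycle C

Chordal : ∀ {n} → Graph n → Set
Chordal U = ∀ {ℓ} → 3 < ℓ → (C : Cycle U ℓ) → HasChord C

IsClique : ∀ {n} → Graph n → (Fin n → Set) → Set
IsClique U P = ∀ {u v} → P u → P v → u ≢ v → Adj U u v

-- An ordering d sends a vertex to its position (counted from 0).
Perfect : ∀ {n} → Graph n → Permutation′ n → Set
Perfect U d = ∀ k → IsClique U λ u →
  u ≡ k ⊎ (Adj U u k × (d ⟨$⟩ʳ u) Fin.< (d ⟨$⟩ʳ k))

-- Each neighbour is listed exactly once, in an arbitrary order.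
record AdjacencyLists {n : ℕ} (U : Graph n) : Set where
  field
    neighbours : Fin n → List (Fin n)
    unique     : ∀ i → Unique (neighbours i)
    complete   : ∀ i j → j ∈ neighbours i ⇔ Adj U i j

------------------------------------------------------------------------
-- Weighted directed graphs and shortest paths

module _ {c ℓ₁ ℓ₂ : Level} (W : OrderedAbelianGroup c ℓ₁ ℓ₂) where
  open OrderedAbelianGroup W

  -- `weight i j` is `nothing` when there is no arc i → j.
  record WeightedDigraph (n : ℕ) : Set c where
    field
      weight       : Fin n → Fin n → Weight∞ W
      no-self-loop : ∀ i → weight i i ≡ nothing

module _ {c ℓ₁ ℓ₂ : Level} {W : OrderedAbelianGroup c ℓ₁ ℓ₂} {n : ℕ}
         (G : WeightedDigraph W n) where
  open OrderedAbelianGroup W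
  open WeightedDigraph G

  skeleton : Graph n
  skeleton = record
    { adj     = λ i j → is-just (weight i j) ∨ is-just (weight j i)
    ; adj-sym = λ i j → ∨-comm (is-just (weight i j)) (is-just (weight j i))
    ; no-loop = λ i → cong₂ (λ x y → is-just x ∨ is-just y) (no-self-loop i) (no-self-loop i)
    }

  data Path : Fin n → Fin n → Set c where
    []    : ∀ {i} → Path i i
    _▹_   : ∀ {i j k} → (Σ[ a ∈ Carrier ] weight i j ≡ just a) → Path j k → Path i k

  pathWeight : ∀ {i j} → Path i j → Carrier
  pathWeight []            = 0ᴳ
  pathWeight ((a , _) ▹ p) = a +ᴳ pathWeight p

  NegativeCycle : Set (c ⊔ ℓ₂)
  NegativeCycle = Σ[ i ∈ Fin n ] Σ[ p ∈ Path i i ] pathWeight p <ᴳ 0ᴳ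

  data IsDistance (i j : Fin n) : Weight∞ W → Set (c ⊔ ℓ₁ ⊔ ℓ₂) where
    unreachable : ¬ Path i j → IsDistance i j nothing
    shortest    : ∀ {a} (p : Path i j) → pathWeight p ≈ a →
                  (∀ (q : Path i j) → a ≤ᴳ pathWeight q) → IsDistance i j (just a)

  -- No pair of antiparallel arcs i → j, j → i is already a negative cycle.
  NoNegativePair : Set (c ⊔ ℓ₂)
  NoNegativePair = ∀ {i j a b} → weight i j ≡ just a → weight j i ≡ just b → 0ᴳ ≤ᴳ a +ᴳ b

------------------------------------------------------------------------
-- A random access machine
--
-- Memory consists of two-dimensional arrays of naturals and of extended
-- weights. A program mentions finitely many arrays and constants and is
-- independent of the input, so charging 1 for each executed assignment,
-- test and loop iteration is the uniform cost measure up to a constant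
-- factor. There is no multiplication, as is usual with uniform cost.
-- Loops are bounded, the bound being evaluated on entry; hence every
-- program terminates. `reject` stops the run; it stands for "return
-- INCONSISTENT", and for the answer "no" of a decision procedure.

Name : Set
Name = ℕ

infixl 6 _∔_ _∸ᵉ_ _⊞_
infixl 5 _⊓ᵉ_
infix  4 _<ᵉ_ _≡ᵉ_ _<ʷ_
infix  8 _[_][_] _⟦_⟧⟦_⟧ _[_] _⟦_⟧
infix  9 !_

data NExp : Set where
  num       : ℕ → NExp
  _[_][_]   : Name → NExp → NExp → NExp
  _∔_ _∸ᵉ_  : NExp → NExp → NExp

data WExp : Set where
  ∞ʷ 0ʷ     : WExp
  _⟦_⟧⟦_⟧   : Name → NExp → NExp → WExp
  _⊞_ _⊓ᵉ_  : WExp → WExp → WExp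

data BExp : Set where
  _<ᵉ_ _≡ᵉ_ : NExp → NExp → BExp
  _<ʷ_      : WExp → WExp → BExp

infix  3 _[_][_]≔_ _⟦_⟧⟦_⟧≔_ _[_]≔_ _⟦_⟧≔_ _≔_
infixr 2 for_<_run_ cond_then_else_ when_then_
infixr 1 _⨾_

data Cmd : Set where
  skip            : Cmd
  reject          : Cmd
  _[_][_]≔_       : Name → NExp → NExp → NExp → Cmd
  _⟦_⟧⟦_⟧≔_       : Name → NExp → NExp → WExp → Cmd
  _⨾_             : Cmd → Cmd → Cmd
  cond_then_else_ : BExp → Cmd → Cmd → Cmd
  for_<_run_      : Name → NExp → Cmd → Cmd

-- Scalars are stored at index (0 , 0), vectors in column 0.

!_ : Name → NExp
! x = x [ num 0 ][ num 0 ]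

_[_] : Name → NExp → NExp
a [ i ] = a [ i ][ num 0 ]

_⟦_⟧ : Name → NExp → WExp
a ⟦ i ⟧ = a ⟦ i ⟧⟦ num 0 ⟧

_≔_ : Name → NExp → Cmd
x ≔ e = x [ num 0 ][ num 0 ]≔ e

_[_]≔_ : Name → NExp → NExp → Cmd
a [ i ]≔ e = a [ i ][ num 0 ]≔ e

_⟦_⟧≔_ : Name → NExp → WExp → Cmd
a ⟦ i ⟧≔ e = a ⟦ i ⟧⟦ num 0 ⟧≔ e

when_then_ : BExp → Cmd → Cmd
when b then p = cond b then p else skip

Memory : ∀ {a} → Set a → Set a
Memory A = Name → ℕ → ℕ → A

write : ∀ {a} {A : Set a} → Name → ℕ → ℕ → A → Memory A → Memory A
write a i j x m a′ i′ j′ =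
  if a ≡ᵇ a′ then (if i ≡ᵇ i′ then (if j ≡ᵇ j′ then x else old) else old) else old
  where old = m a′ i′ j′

record Store {c ℓ₁ ℓ₂ : Level} (W : OrderedAbelianGroup c ℓ₁ ℓ₂) : Set c where
  constructor store
  field
    nat : Memory ℕ
    wt  : Memory (Weight∞ W)

module _ {c ℓ₁ ℓ₂ : Level} {W : OrderedAbelianGroup c ℓ₁ ℓ₂} where
  open OrderedAbelianGroup W
  open Store

  evalN : NExp → Store W → ℕ
  evalN (num k)        s = k
  evalN (a [ e ][ f ]) s = nat s a (evalN e s) (evalN f s)
  evalN (e ∔ f)        s = evalN e s + evalN f s
  evalN (e ∸ᵉ f)       s = evalN e s ∸ evalN f s

  evalW : WExp → Store W → Weight∞ W
  evalW ∞ʷ             s = nothing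
  evalW 0ʷ             s = just 0ᴳ
  evalW (a ⟦ e ⟧⟦ f ⟧) s = wt s a (evalN e s) (evalN f s)
  evalW (e ⊞ f)        s = _+∞_ W (evalW e s) (evalW f s)
  evalW (e ⊓ᵉ f)       s = min∞ W (evalW e s) (evalW f s)

  evalB : BExp → Store W → Bool
  evalB (e <ᵉ f) s = evalN e s <ᵇ evalN f s
  evalB (e ≡ᵉ f) s = evalN e s ≡ᵇ evalN f s
  evalB (e <ʷ f) s = not (_≤∞ᵇ_ W (evalW f s) (evalW e s))

  writeN : Name → ℕ → ℕ → ℕ → Store W → Store W
  writeN a i j x (store ν ω) = store (write a i j x ν) ω

  writeW : Name → ℕ → ℕ → Weight∞ W → Store W → Store W
  writeW a i j x (store ν ω) = store ν (write a i j x ω)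

  -- The final store, or `nothing` if the run was stopped by `reject`;
  -- and the number of steps.
  Outcome : Set c
  Outcome = Maybe (Store W) × ℕ

  result : Outcome → Maybe (Store W)
  result = proj₁

  steps : Outcome → ℕ
  steps = proj₂

  tick : Outcome → Outcome
  tick = map₂ ℕ.suc

  continue : Outcome → (Store W → Outcome) → Outcome
  continue (nothing , t) f = nothing , t
  continue (just s  , t) f = map₂ (t +_) (f s)

  -- `iterate f k i s` runs f i, f (1 + i), …, f (k - 1 + i).
  iterate : (ℕ → Store W → Outcome) → ℕ → ℕ → Store W → Outcome
  iterate f zero      i s = just s , 0
  iterate f (ℕ.suc k) i s = continue (f i s) (iterate f k (ℕ.suc i))

  exec : Cmd → Store W → Outcome
  exec skip                   s = just s , 1
  exec reject                 s = nothing , 1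
  exec (a [ e ][ f ]≔ g)      s = just (writeN a (evalN e s) (evalN f s) (evalN g s) s) , 1
  exec (a ⟦ e ⟧⟦ f ⟧≔ g)      s = just (writeW a (evalN e s) (evalN f s) (evalW g s) s) , 1
  exec (p ⨾ q)                s = continue (exec p s) (exec q)
  exec (cond b then p else q) s = tick (if evalB b s then exec p s else exec q s)
  exec (for x < e run p)      s =
    tick (iterate (λ i s′ → tick (exec p (writeN x 0 0 i s′))) (evalN e s) 0 s)

------------------------------------------------------------------------
-- Input and output conventions
--
-- Vertices are numbered from 0. order = n; nbr [ v ][ p ] is the p-th of the
-- deg [ v ] neighbours of v; pos [ v ] is the position of v in the vertex
-- ordering and vert [ k ] the vertex at position k; w ⟦ i ⟧⟦ j ⟧ is the weight
-- of the arc i → j. The distance matrix, indexed by vertices, is returned in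
-- D. All memory not holding input is initially zero.

pattern order = 0
pattern deg   = 1
pattern nbr   = 2
pattern pos   = 3
pattern vert  = 4

pattern w = 0
pattern D = 1

nth : List ℕ → ℕ → ℕ
nth []       _         = 0
nth (x ∷ _)  zero      = x
nth (_ ∷ xs) (ℕ.suc k) = nth xs k

-- f extended to ℕ by a default value.
extend : ∀ {a} {A : Set a} {n} → A → (Fin n → A) → ℕ → A
extend {n = zero}    z f _         = z
extend {n = ℕ.suc n} z f zero      = f Fin.zero
extend {n = ℕ.suc n} z f (ℕ.suc i) = extend z (λ j → f (Fin.suc j)) i

graphMemory : ∀ {n} {U : Graph n} → AdjacencyLists U → Memory ℕ
graphMemory {n} L = mem
  where
  open AdjacencyLists L
  mem : Memory ℕ
  mem order 0 0 = n
  mem deg   i 0 = extend 0 (λ v → length (neighbours v)) i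
  mem nbr   i p = extend 0 (λ v → nth (map toℕ (neighbours v)) p) i
  mem _     _ _ = 0

orderedGraphMemory : ∀ {n} {U : Graph n} → AdjacencyLists U → Permutation′ n → Memory ℕ
orderedGraphMemory L d pos  i 0 = extend 0 (λ v → toℕ (d ⟨$⟩ʳ v)) i
orderedGraphMemory L d vert k 0 = extend 0 (λ v → toℕ (d ⟨$⟩ˡ v)) k
orderedGraphMemory L d a    i j = graphMemory L a i j

module _ {c ℓ₁ ℓ₂ : Level} {W : OrderedAbelianGroup c ℓ₁ ℓ₂} where
  open OrderedAbelianGroup W
  open Store

  weightMemory : ∀ {n} → WeightedDigraph W n → Memory (Weight∞ W)
  weightMemory G w i j = extend nothing (λ u → extend nothing (λ v → weight u v) j) i
    where open WeightedDigraph G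
  weightMemory G _ i j = just 0ᴳ

  HoldsOrdering : ∀ {n} → Permutation′ n → Store W → Set
  HoldsOrdering d s =
    (∀ v → nat s pos (toℕ v) 0 ≡ toℕ (d ⟨$⟩ʳ v)) ×
    (∀ k → nat s vert (toℕ k) 0 ≡ toℕ (d ⟨$⟩ˡ k))

  data FoundPerfectOrdering {n} (U : Graph n) : Maybe (Store W) → Set c where
    found : ∀ {s} (d : Permutation′ n) → Perfect U d → HoldsOrdering d s →
            FoundPerfectOrdering U (just s)

  data SolvesAPSP {n} (G : WeightedDigraph W n) : Maybe (Store W) → Set (c ⊔ ℓ₁ ⊔ ℓ₂) where
    inconsistent : NegativeCycle G → SolvesAPSP G nothing
    distances    : ∀ {s} → ¬ NegativeCycle G →
                   (∀ i j → IsDistance G i j (wt s D (toℕ i) (toℕ j))) →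
                   SolvesAPSP G (just s)

------------------------------------------------------------------------
-- The algorithms

private
  pattern edge = 5
  pattern t = 6
  pattern k = 7
  pattern p = 8
  pattern q = 9
  pattern r = 10
  pattern src = 11
  -- x, y and z hold vertices; k and r hold positions.
  pattern x = 12
  pattern y = 13
  pattern z = 14

  pattern D′ = 2

-- E is kept both as adjacency lists and as a 0/1 matrix.
loadEdges : Cmd
loadEdges =
  (for x < ! order run for y < ! order run edge [ ! x ][ ! y ]≔ num 0) ⨾
  (for x < ! order run for p < deg [ ! x ] run edge [ ! x ][ nbr [ ! x ][ ! p ] ]≔ num 1)

-- E ← E ∪ {{x , y}}
addEdge : Cmd
addEdge =
  when edge [ ! x ][ ! y ] ≡ᵉ num 0 then
    ( (edge [ ! x ][ ! y ]≔ num 1) ⨾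
      (edge [ ! y ][ ! x ]≔ num 1) ⨾
      (nbr [ ! x ][ deg [ ! x ] ]≔ ! y) ⨾
      (nbr [ ! y ][ deg [ ! y ] ]≔ ! x) ⨾
      (deg [ ! x ]≔ deg [ ! x ] ∔ num 1) ⨾
      (deg [ ! y ]≔ deg [ ! y ] ∔ num 1) )

-- z is the vertex at position k; x and y are at positions i < j < k.
dpc : Cmd
dpc =
  loadEdges ⨾
  (for t < ! order run
    ( (k ≔ ! order ∸ᵉ (num 1 ∔ ! t)) ⨾
      (z ≔ vert [ ! k ]) ⨾
      (for p < deg [ ! z ] run
        ( (x ≔ nbr [ ! z ][ ! p ]) ⨾
          (when pos [ ! x ] <ᵉ ! k then
            for q < deg [ ! z ] run
              ( (y ≔ nbr [ ! z ][ ! q ]) ⨾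
                (when pos [ ! y ] <ᵉ ! k then
                  when pos [ ! x ] <ᵉ pos [ ! y ] then
                    ( (w ⟦ ! x ⟧⟦ ! y ⟧≔ w ⟦ ! x ⟧⟦ ! y ⟧ ⊓ᵉ w ⟦ ! x ⟧⟦ ! z ⟧ ⊞ w ⟦ ! z ⟧⟦ ! y ⟧) ⨾
                      (w ⟦ ! y ⟧⟦ ! x ⟧≔ w ⟦ ! y ⟧⟦ ! x ⟧ ⊓ᵉ w ⟦ ! y ⟧⟦ ! z ⟧ ⊞ w ⟦ ! z ⟧⟦ ! x ⟧) ⨾
                      addEdge ⨾
                      (when w ⟦ ! x ⟧⟦ ! y ⟧ ⊞ w ⟦ ! y ⟧⟦ ! x ⟧ <ʷ 0ʷ then reject)))))))))

-- z, x, y are the vertices at positions k, j, i.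
snowball : Cmd
snowball =
  dpc ⨾
  (for x < ! order run for y < ! order run D ⟦ ! x ⟧⟦ ! y ⟧≔ ∞ʷ) ⨾
  (for x < ! order run D ⟦ ! x ⟧⟦ ! x ⟧≔ 0ʷ) ⨾
  (for k < ! order run
    ( (z ≔ vert [ ! k ]) ⨾
      (for p < deg [ ! z ] run
        ( (x ≔ nbr [ ! z ][ ! p ]) ⨾
          (when pos [ ! x ] <ᵉ ! k then
            for r < ! k run
              ( (y ≔ vert [ ! r ]) ⨾
                (D ⟦ ! y ⟧⟦ ! z ⟧≔ D ⟦ ! y ⟧⟦ ! z ⟧ ⊓ᵉ D ⟦ ! y ⟧⟦ ! x ⟧ ⊞ w ⟦ ! x ⟧⟦ ! z ⟧) ⨾
                (D ⟦ ! z ⟧⟦ ! y ⟧≔ D ⟦ ! z ⟧⟦ ! y ⟧ ⊓ᵉ w ⟦ ! z ⟧⟦ ! x ⟧ ⊞ D ⟦ ! x ⟧⟦ ! y ⟧)))))))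

-- The source s is the position src.
minPaths : Cmd
minPaths =
  (for x < ! order run D′ ⟦ ! x ⟧≔ ∞ʷ) ⨾
  (D′ ⟦ vert [ ! src ] ⟧≔ 0ʷ) ⨾
  (for t < num 1 ∔ ! src run
    ( (k ≔ ! src ∸ᵉ ! t) ⨾
      (z ≔ vert [ ! k ]) ⨾
      (for p < deg [ ! z ] run
        ( (x ≔ nbr [ ! z ][ ! p ]) ⨾
          (when pos [ ! x ] <ᵉ ! k then
            D′ ⟦ ! x ⟧≔ D′ ⟦ ! x ⟧ ⊓ᵉ D′ ⟦ ! z ⟧ ⊞ w ⟦ ! z ⟧⟦ ! x ⟧))))) ⨾
  (for k < ! order run
    ( (z ≔ vert [ ! k ]) ⨾
      (for p < deg [ ! z ] run
        ( (x ≔ nbr [ ! z ][ ! p ]) ⨾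
          (when ! k <ᵉ pos [ ! x ] then
            D′ ⟦ ! x ⟧≔ D′ ⟦ ! x ⟧ ⊓ᵉ D′ ⟦ ! z ⟧ ⊞ w ⟦ ! z ⟧⟦ ! x ⟧)))))

chleqAPSP : Cmd
chleqAPSP =
  dpc ⨾
  (for src < ! order run
    ( minPaths ⨾
      (for x < ! order run D ⟦ vert [ ! src ] ⟧⟦ ! x ⟧≔ D′ ⟦ ! x ⟧)))

-- DPC tests w_{i→j} + w_{j→i} < 0 only for pairs i , j that it updates, so it
-- misses a pair of antiparallel arcs that is negative from the start and has
-- no common later neighbour (e.g. the graph with two vertices, w_{1→2} = -1
-- and w_{2→1} = 0). This is the missing test.
testEdges : Cmd
testEdges =
  for x < ! order run
    for p < deg [ ! x ] run
      ( (y ≔ nbr [ ! x ][ ! p ]) ⨾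
        (when w ⟦ ! x ⟧⟦ ! y ⟧ ⊞ w ⟦ ! y ⟧⟦ ! x ⟧ <ʷ 0ʷ then reject))

------------------------------------------------------------------------
-- Specifications

-- The bounds O(m) and O(nm) presuppose m ≥ n - 1, as for connected graphs:
-- otherwise already reading n vertices, or writing n² distances, exceeds
-- them. So m is replaced by max(m , n - 1).
effective-m : ∀ {n} → Graph n → ℕ
effective-m {n} U = #edges U ℕ.⊔ (n ∸ 1)

O[m] : ∀ {n} → ℕ → Graph n → ℕ
O[m] C U = C * ℕ.suc (effective-m U)

O[nm] : ∀ {n} → ℕ → Graph n → ℕ
O[nm] {n} C U = C * ℕ.suc (n * effective-m U)

module _ {c ℓ₁ ℓ₂ : Level} {W : OrderedAbelianGroup c ℓ₁ ℓ₂} where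

  record ComputesAPSP {n} (pgm : Cmd) (G : WeightedDigraph W n)
                      (input : Store W) (bound : ℕ) : Set (c ⊔ ℓ₁ ⊔ ℓ₂) where
    field
      time           : steps (exec pgm input) ≤ bound
      correct        : NoNegativePair G → SolvesAPSP G (result (exec pgm input))
      time-tested    : steps (exec (testEdges ⨾ pgm) input) ≤ bound
      correct-tested : SolvesAPSP G (result (exec (testEdges ⨾ pgm) input))

{-# OPTIONS --safe #-}
module Submission where

-- Along a perfect ordering, DPC adds no edges and makes the weights directed
-- path consistent: w i j ≤ w i k + w k j whenever i and j are neighbours of k
-- before k. If it finds no negative pair, the distances can be grown one
-- vertex at a time: a shortest path into the new vertex k ends with an arc
-- from an earlier neighbour, and a detour through k between earlier vertices
-- is never shorter than the direct arc. So the matrix δ computed by Snowball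
-- satisfies the triangle inequality and is at most w on arcs, hence is a lower
-- bound for all paths; as each of its entries is the weight of a path, δ is
-- the distance, and δ i i = 0 excludes negative cycles. The recursion for δ
-- also shows that one sweep down and one sweep up the ordering compute a row.
--
-- A perfect ordering is found by maximum cardinality search with buckets. If
-- a chordal graph had a vertex with two nonadjacent earlier neighbours, this
-- would be a chordless path whose inner vertex comes after both ends; the
-- choice made by the search yields such a path with earlier ends, ad
-- infinitum. A graph is recognised as chordal by testing whether the ordering
-- found is perfect, for which it suffices to compare the earlier neighbours of
-- each vertex with the latest of them.

open import Defs
open import Algebra.Structures using (IsAbelianGroup)
open import Data.Bool.Base using (Bool; true; false; T; not; _∨_; if_then_else_)
open import Data.Bool.Properties using (T?)
open import Data.Empty using (⊥; ⊥-elim)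
open import Data.Fin.Base as Fin using (Fin; toℕ; punchIn; punchOut)
open import Data.Fin.Permutation using (Permutation′; permutation; _⟨$⟩ʳ_; _⟨$⟩ˡ_; inverseˡ; inverseʳ)
import Data.Fin.Properties as Fin
open import Data.List.Base using (List; []; _∷_; length; map; filter; allFin; tabulate; cartesianProduct; lookup; _++_)
open import Data.List.Membership.Propositional.Properties using (∈-lookup; ∈-filter⁺; ∈-filter⁻; ∈-allFin)
open import Data.List.Properties using (map-tabulate; length-++; filter-++)
open import Data.List.Relation.Unary.All as All using ()
open import Data.List.Relation.Unary.AllPairs using (_∷_)
open import Data.List.Relation.Unary.Any as Any using ()
open import Data.List.Relation.Unary.Any.Properties using (lookup-index)
open import Data.List.Relation.Unary.Unique.Propositional using (Unique)
open import Data.List.Relation.Unary.Unique.Propositional.Properties using (filter⁺; allFin⁺)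
open import Data.Maybe using (Maybe; just; nothing; Is-just)
open import Data.Maybe.Relation.Unary.Any using (just)
open import Data.Nat.Base hiding (_!)
open import Data.Nat.Properties
open import Data.Nat.Tactic.RingSolver using (solve-∀)
open import Data.Product.Base using (Σ-syntax; ∃-syntax; _×_; _,_; proj₁; proj₂)
open import Data.Sum.Base using (_⊎_; inj₁; inj₂)
open import Data.Unit.Base using (⊤; tt)
open import Function.Base using (_∘_; id)
open import Function.Bundles using (_⇔_; mk⇔; module Equivalence)
open import Function.Definitions using (Injective)
open import Level using (Level) renaming (_⊔_ to _⊔ˡ_)
open import Relation.Binary.Definitions using (Tri; tri<; tri≈; tri>)
open import Relation.Binary.PropositionalEquality hiding ([_])
open import Relation.Binary.Structures using (IsDecTotalOrder)
open import Relation.Nullary using (¬_; Dec; yes; no; contradiction)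
open import Relation.Nullary.Decidable using (does; _×-dec_; dec-true; dec-false)
open import Relation.Unary using (Decidable; Pred)
import Algebra.Properties.CommutativeMonoid.Sum as SumProperties
open SumProperties +-0-commutativeMonoid using (sum; sum-cong-≗; sum-remove; ∑-distrib-+; ∑-comm)

-- Finite sums

-- Correctness and running time are proved together, in one program logic that attaches a step bound
-- to each specification; the final constants merely exceed the sums that arise. Because DPC never
-- inserts an edge here, the adjacency lists are constant and every loop over neighbours is charged
-- a degree of the input graph.
--
-- Rejection and acceptance are treated asymmetrically. All matrix entries are weights of actual
-- paths, so a rejection is justified on any input. Acceptance is not: DPC tests only the pairs that
-- it updates, so nonnegativity is carried along under the assumption `NoNegativePair`, which either
-- is given or is established by `testEdges`.
--
-- Chleq-APSP never computes δ as such. It is compared with the matrix that the growing phase of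
-- Snowball would leave on the same store.
--
-- The search cannot be bounded step by step, as one visit may push many entries. It is amortised
-- against the degrees of the visited vertices, and the same potential shows that the fixed number
-- of iterations reaches every vertex.

sum-mono : ∀ {n} {f g : Fin n → ℕ} → (∀ i → f i ≤ g i) → sum f ≤ sum g
sum-mono {zero}  h = z≤n
sum-mono {suc n} h = +-mono-≤ (h Fin.zero) (sum-mono (h ∘ Fin.suc))

sum-const : ∀ n c → sum {n} (λ _ → c) ≡ n * c
sum-const zero    c = refl
sum-const (suc n) c = cong (c +_) (sum-const n c)

sum-*ʳ : ∀ {n} (f : Fin n → ℕ) c → sum (λ i → f i * c) ≡ sum f * c
sum-*ʳ {zero}  f c = refl
sum-*ʳ {suc n} f c = trans (cong (f Fin.zero * c +_) (sum-*ʳ (f ∘ Fin.suc) c))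
                           (sym (*-distribʳ-+ c (f Fin.zero) (sum (f ∘ Fin.suc))))

sum-bound : ∀ {n} {f : Fin n → ℕ} c → (∀ i → f i ≤ c) → sum f ≤ n * c
sum-bound {n} c h = ≤-trans (sum-mono h) (≤-reflexive (sum-const n c))

sum-affine : ∀ {n} {f g : Fin n → ℕ} a b → (∀ i → f i ≤ a + g i * b) → sum f ≤ n * a + sum g * b
sum-affine {n} {f} {g} a b h = begin
  sum f                                ≤⟨ sum-mono h ⟩
  sum (λ i → a + g i * b)              ≡⟨ ∑-distrib-+ (λ _ → a) (λ i → g i * b) ⟩
  sum {n} (λ _ → a) + sum (λ i → g i * b) ≡⟨ cong₂ _+_ (sum-const n a) (sum-*ʳ g b) ⟩
  n * a + sum g * b                    ∎
  where open ≤-Reasoning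

sum-term : ∀ {n} (f : Fin n → ℕ) i → f i ≤ sum f
sum-term f Fin.zero    = m≤m+n _ _
sum-term f (Fin.suc i) = ≤-trans (sum-term (f ∘ Fin.suc) i) (m≤n+m _ _)

-- `f` is split at the first value of `g`; the other values avoid it, and `punchOut` turns them into
-- an injection into one point fewer. Loops that visit distinct vertices are thus charged at most a
-- total over all vertices.
sum-inj : ∀ {m n} (f : Fin n → ℕ) (g : Fin m → Fin n) → Injective _≡_ _≡_ g →
          sum (f ∘ g) ≤ sum f
sum-inj {zero}          f g g-inj = z≤n
sum-inj {suc m} {zero}  f g g-inj with () ← g Fin.zero
sum-inj {suc m} {suc n} f g g-inj = begin
  f g₀ + sum (f ∘ g ∘ Fin.suc)
    ≡⟨ cong (f g₀ +_) (sum-cong-≗ λ j → cong f (sym (Fin.punchIn-punchOut (g₀≢ j)))) ⟩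
  f g₀ + sum ((f ∘ punchIn g₀) ∘ g′)
    ≤⟨ +-monoʳ-≤ (f g₀) (sum-inj (f ∘ punchIn g₀) g′ g′-inj) ⟩
  f g₀ + sum (f ∘ punchIn g₀)
    ≡⟨ sum-remove {i = g₀} f ⟨
  sum f ∎
  where
  open ≤-Reasoning
  g₀ = g Fin.zero
  g₀≢ : ∀ j → g₀ ≢ g (Fin.suc j)
  g₀≢ j eq with () ← g-inj eq
  g′ : Fin m → Fin n
  g′ j = punchOut (g₀≢ j)
  g′-inj : Injective _≡_ _≡_ g′
  g′-inj {i} {j} eq = Fin.suc-injective (g-inj (Fin.punchOut-injective (g₀≢ i) (g₀≢ j) eq))

-- The changed entries stand crosswise on the two sides to avoid truncated subtraction.
sum-update : ∀ {n} {f g : Fin n → ℕ} i → (∀ j → j ≢ i → f j ≡ g j) → sum f + g i ≡ sum g + f i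
sum-update {suc n} {f} {g} i f≗g = begin
  sum f + g i                        ≡⟨ cong (_+ g i) (sum-remove {i = i} f) ⟩
  f i + sum (f ∘ punchIn i) + g i    ≡⟨ cong (λ x → f i + x + g i) (sum-cong-≗ λ j → f≗g _ (Fin.punchInᵢ≢i i j)) ⟩
  f i + sum (g ∘ punchIn i) + g i    ≡⟨ +-comm (f i + sum (g ∘ punchIn i)) (g i) ⟩
  g i + (f i + sum (g ∘ punchIn i))  ≡⟨ cong (g i +_) (+-comm (f i) _) ⟩
  g i + (sum (g ∘ punchIn i) + f i)  ≡⟨ +-assoc (g i) _ (f i) ⟨
  g i + sum (g ∘ punchIn i) + f i    ≡⟨ cong (_+ f i) (sum-remove {i = i} g) ⟨
  sum g + f i                        ∎
  where open ≡-Reasoning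

sum-<⇒∃ : ∀ {n} {f g : Fin n → ℕ} → sum f < sum g → ∃[ i ] f i < g i
sum-<⇒∃ {zero} ()
sum-<⇒∃ {suc n} {f} {g} h with f Fin.zero <? g Fin.zero
... | yes lt = Fin.zero , lt
... | no ≮ with i , lt ← sum-<⇒∃ {f = f ∘ Fin.suc} {g ∘ Fin.suc}
                          (+-cancelˡ-< (f Fin.zero) _ _ (<-≤-trans h (+-monoˡ-≤ _ (≮⇒≥ ≮))))
             = Fin.suc i , lt

-- Deleting the term at `a`, where `f` is larger, leaves a strictly smaller sum for `f`. In the
-- search this exchanges a neighbour `a` of one vertex for a neighbour of another.
sum-exceeds : ∀ {n} {f g : Fin n → ℕ} a → sum f ≤ sum g → g a < f a → ∃[ i ] f i < g i
sum-exceeds {suc n} {f} {g} a f≤g g<f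
  with i , lt ← sum-<⇒∃ {f = f ∘ punchIn a} {g ∘ punchIn a}
       (+-cancelˡ-< (f a) _ _ (≤-<-trans (≤-reflexive (sym (sum-remove {i = a} f)))
         (≤-<-trans f≤g (≤-<-trans (≤-reflexive (sum-remove {i = a} g)) (+-monoˡ-< _ g<f)))))
  = punchIn a i , lt

-- Running programs

≡ᵇ-refl : ∀ m → (m ≡ᵇ m) ≡ true
≡ᵇ-refl zero    = refl
≡ᵇ-refl (suc m) = ≡ᵇ-refl m

≢⇒≡ᵇ : ∀ m n → m ≢ n → (m ≡ᵇ n) ≡ false
≢⇒≡ᵇ zero    zero    h = contradiction refl h
≢⇒≡ᵇ zero    (suc n) h = refl
≢⇒≡ᵇ (suc m) zero    h = refl
≢⇒≡ᵇ (suc m) (suc n) h = ≢⇒≡ᵇ m n (h ∘ cong suc)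

module _ {ℓ : Level} {A : Set ℓ} where

  write-same : ∀ a i j (x : A) m → write a i j x m a i j ≡ x
  write-same a i j x m rewrite ≡ᵇ-refl a | ≡ᵇ-refl i | ≡ᵇ-refl j = refl

  write-agree : ∀ a i j (x : A) m a′ i′ j′ → (a ≡ᵇ a′) ≡ false →
                write a i j x m a′ i′ j′ ≡ m a′ i′ j′
  write-agree a i j x m a′ i′ j′ e rewrite e = refl

  write-row : ∀ a i j (x : A) m {i′ j′} → i ≢ i′ → write a i j x m a i′ j′ ≡ m a i′ j′
  write-row a i j x m {i′} i≢ rewrite ≡ᵇ-refl a | ≢⇒≡ᵇ i i′ i≢ = refl

  write-col : ∀ a i j (x : A) m {i′ j′} → j ≢ j′ → write a i j x m a i′ j′ ≡ m a i′ j′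
  write-col a i j x m {i′} {j′} j≢ rewrite ≡ᵇ-refl a | ≢⇒≡ᵇ j j′ j≢ with i ≡ᵇ i′
  ... | true  = refl
  ... | false = refl

  -- A view of `write` indexed by the value read: matching on it together with the abstracted value
  -- replaces the nested tests.
  data Written (i j : ℕ) (x : A) (m : ℕ → ℕ → A) (i′ j′ : ℕ) : A → Set ℓ where
    here  : i ≡ i′ → j ≡ j′ → Written i j x m i′ j′ x
    there : i ≢ i′ ⊎ j ≢ j′ → Written i j x m i′ j′ (m i′ j′)

  written : ∀ a i j (x : A) m i′ j′ → Written i j x (m a) i′ j′ (write a i j x m a i′ j′)
  written a i j x m i′ j′ with i ≟ i′
  ... | no ne rewrite write-row a i j x m {i′} {j′} ne = there (inj₁ ne)
  ... | yes refl with j ≟ j′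
  ...   | no ne rewrite write-col a i j x m {i} {j′} ne = there (inj₂ ne)
  ...   | yes refl rewrite write-same a i j x m = here refl refl

∨-false : ∀ {a b} → a ∨ b ≡ false → a ≡ false × b ≡ false
∨-false {false} eq = refl , eq

-- A syntactic over-approximation of the arrays written, loop counters included. It computes, so
-- that for a concrete program a frame condition is proved by `refl`.
modifiesN modifiesW : Cmd → Name → Bool
modifiesN skip                   a′ = false
modifiesN reject                 a′ = false
modifiesN (a [ e ][ f ]≔ g)      a′ = a ≡ᵇ a′
modifiesN (a ⟦ e ⟧⟦ f ⟧≔ g)      a′ = false
modifiesN (p ⨾ q)                a′ = modifiesN p a′ ∨ modifiesN q a′
modifiesN (cond b then p else q) a′ = modifiesN p a′ ∨ modifiesN q a′
modifiesN (for x < e run p)      a′ = (x ≡ᵇ a′) ∨ modifiesN p a′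

modifiesW skip                   a′ = false
modifiesW reject                 a′ = false
modifiesW (a [ e ][ f ]≔ g)      a′ = false
modifiesW (a ⟦ e ⟧⟦ f ⟧≔ g)      a′ = a ≡ᵇ a′
modifiesW (p ⨾ q)                a′ = modifiesW p a′ ∨ modifiesW q a′
modifiesW (cond b then p else q) a′ = modifiesW p a′ ∨ modifiesW q a′
modifiesW (for x < e run p)      a′ = modifiesW p a′

module _ {c ℓ₁ ℓ₂ : Level} {W : OrderedAbelianGroup c ℓ₁ ℓ₂} where
  open Store

  record Agree (p : Cmd) (s s′ : Store W) : Set c where
    field
      natᶠ : ∀ a i j → modifiesN p a ≡ false → nat s′ a i j ≡ nat s a i j
      wtᶠ  : ∀ a i j → modifiesW p a ≡ false → wt s′ a i j ≡ wt s a i j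
  open Agree public

  Agree-refl : ∀ {p s} → Agree p s s
  Agree-refl = record { natᶠ = λ _ _ _ _ → refl ; wtᶠ = λ _ _ _ _ → refl }

  Agree-trans : ∀ {p s s′ s″} → Agree p s s′ → Agree p s′ s″ → Agree p s s″
  Agree-trans h h′ = record
    { natᶠ = λ a i j e → trans (natᶠ h′ a i j e) (natᶠ h a i j e)
    ; wtᶠ  = λ a i j e → trans (wtᶠ h′ a i j e) (wtᶠ h a i j e)
    }

  Agree-weaken : ∀ {p q s s′} → (∀ a → modifiesN q a ≡ false → modifiesN p a ≡ false) →
                 (∀ a → modifiesW q a ≡ false → modifiesW p a ≡ false) →
                 Agree p s s′ → Agree q s s′
  Agree-weaken f g h = record
    { natᶠ = λ a i j e → natᶠ h a i j (f a e)
    ; wtᶠ  = λ a i j e → wtᶠ h a i j (g a e)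
    }

  -- `R` is what a stop by `reject` establishes: a negative cycle, the failure of a property, or ⊥
  -- for a program that never rejects.
  data Post {q r : Level} (Q : Store W → Set q) (R : Set r) : Maybe (Store W) → Set (c ⊔ˡ q ⊔ˡ r) where
    accepted : ∀ {s} → Q s → Post Q R (just s)
    rejected : R → Post Q R nothing

  -- Indexed by program and store rather than by the outcome, so that it can be
  -- unified without evaluating the program.
  record Runs {q r : Level} (p : Cmd) (s : Store W) (b : ℕ) (Q : Store W → Set q) (R : Set r) :
              Set (c ⊔ˡ q ⊔ˡ r) where
    constructor runs
    field
      time : steps (exec p s) ≤ b
      post : Post Q R (result (exec p s))
  open Runs public

  private
    continue-result : ∀ (o : Outcome {W = W}) f {s″} → result (continue o f) ≡ just s″ →
                      ∃[ s′ ] result o ≡ just s′ × result (f s′) ≡ just s″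
    continue-result (just s′ , t) f e = s′ , refl , e

  frame : ∀ p s {s′} → result (exec p s) ≡ just s′ → Agree p s s′
  private
    -- The number of iterations is arbitrary rather than the loop bound, because the loop rule
    -- applies this to the stores between two iterations.
    frame-iterate : ∀ x e p k i s {s′} →
      result (iterate (λ i s′ → tick (exec p (writeN x 0 0 i s′))) k i s) ≡ just s′ →
      Agree (for x < e run p) s s′
  frame skip              s refl = Agree-refl
  frame (a [ e ][ f ]≔ g) s refl = record
    { natᶠ = λ a′ i j eq → write-agree a (evalN e s) (evalN f s) (evalN g s) (nat s) a′ i j eq
    ; wtᶠ  = λ _ _ _ _ → refl
    }
  frame (a ⟦ e ⟧⟦ f ⟧≔ g) s refl = record
    { natᶠ = λ _ _ _ _ → refl
    ; wtᶠ  = λ a′ i j eq → write-agree a (evalN e s) (evalN f s) (evalW g s) (wt s) a′ i j eq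
    }
  frame (p ⨾ q) s eq with s′ , e₁ , e₂ ← continue-result (exec p s) (exec q) eq = Agree-trans
    (Agree-weaken (λ a → proj₁ ∘ ∨-false) (λ a → proj₁ ∘ ∨-false) (frame p s e₁))
    (Agree-weaken (λ a → proj₂ ∘ ∨-false {modifiesN p a}) (λ a → proj₂ ∘ ∨-false {modifiesW p a})
                  (frame q s′ e₂))
  frame (cond b then p else q) s eq with evalB b s
  ... | true  = Agree-weaken (λ a → proj₁ ∘ ∨-false) (λ a → proj₁ ∘ ∨-false) (frame p s eq)
  ... | false = Agree-weaken (λ a → proj₂ ∘ ∨-false {modifiesN p a})
                             (λ a → proj₂ ∘ ∨-false {modifiesW p a}) (frame q s eq)
  frame (for x < e run p) s eq = frame-iterate x e p (evalN e s) 0 s eq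
  frame-iterate x e p zero    i s refl = Agree-refl
  frame-iterate x e p (suc k) i s eq
    with s′ , e₁ , e₂ ← continue-result (tick (exec p (writeN x 0 0 i s))) _ eq = Agree-trans
    (Agree-trans
      (record { natᶠ = λ a i′ j f → write-agree x 0 0 i (nat s) a i′ j (proj₁ (∨-false f))
              ; wtᶠ = λ _ _ _ _ → refl })
      (Agree-weaken (λ a → proj₂ ∘ ∨-false {x ≡ᵇ a}) (λ a → id) (frame p _ e₁)))
    (frame-iterate x e p k (suc i) s′ e₂)

  module _ {q r : Level} {Q : Store W → Set q} {R : Set r} where

    runs-frame : ∀ {p s b} → Runs p s b Q R → Runs p s b (λ s′ → Agree p s s′ × Q s′) R
    runs-frame {p} {s} (runs t po) = runs t (aux po (frame p s))
      where
      aux : ∀ {o} → Post Q R o → (∀ {s′} → o ≡ just s′ → Agree p s s′) →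
            Post (λ s′ → Agree p s s′ × Q s′) R o
      aux (accepted x) f = accepted (f refl , x)
      aux (rejected x) f = rejected x

    weaken : ∀ {q′} {Q′ : Store W → Set q′} {p s b b′} → b ≤ b′ →
             (∀ {s′} → Agree p s s′ → Q s′ → Q′ s′) → Runs p s b Q R → Runs p s b′ Q′ R
    weaken {Q′ = Q′} {p} {s} b≤ f r with runs t po ← runs-frame r = runs (≤-trans t b≤) (aux po)
      where
      aux : ∀ {o} → Post (λ s′ → Agree p s s′ × Q s′) R o → Post Q′ R o
      aux (accepted (a , x)) = accepted (f a x)
      aux (rejected x) = rejected x

    within : ∀ {p s b b′} → b ≤ b′ → Runs p s b Q R → Runs p s b′ Q R
    within b≤ (runs t po) = runs (≤-trans t b≤) po

    infixr 1 _then_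
    -- The second program may also assume that arrays not modified by the first are unchanged, so
    -- postconditions need not carry them along.
    _then_ : ∀ {q′} {Q′ : Store W → Set q′} {p₁ p₂ s b b′} → Runs p₁ s b Q R →
             (∀ {s′} → Agree p₁ s s′ → Q s′ → Runs p₂ s′ b′ Q′ R) →
             Runs (p₁ ⨾ p₂) s (b + b′) Q′ R
    _then_ {Q′ = Q′} {p₁} {p₂} {s} {b} {b′} r f =
      let t , po = aux (exec p₁ s) (time r) (post (runs-frame r)) in runs t po
      where
      aux : ∀ o → steps o ≤ b → Post (λ s′ → Agree p₁ s s′ × Q s′) R (result o) →
            steps (continue o (exec p₂)) ≤ b + b′ × Post Q′ R (result (continue o (exec p₂)))
      aux (just s′ , t) t≤ (accepted (a , x)) = let r′ = f a x in +-mono-≤ t≤ (time r′) , post r′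
      aux (nothing , t) t≤ (rejected x)       = ≤-trans t≤ (m≤m+n b b′) , rejected x

    -- An assignment is absorbed into the store of what follows. Its address and value are named by
    -- equations, and later reads of other arrays reduce by computation.
    assignN : ∀ {a e f g p s b i j v} → evalN e s ≡ i → evalN f s ≡ j → evalN g s ≡ v →
              Runs p (writeN a i j v s) b Q R → Runs ((a [ e ][ f ]≔ g) ⨾ p) s (suc b) Q R
    assignN refl refl refl (runs t po) = runs (s≤s t) po

    assignW : ∀ {a e f g p s b i j v} → evalN e s ≡ i → evalN f s ≡ j → evalW g s ≡ v →
              Runs p (writeW a i j v s) b Q R → Runs ((a ⟦ e ⟧⟦ f ⟧≔ g) ⨾ p) s (suc b) Q R
    assignW refl refl refl (runs t po) = runs (s≤s t) po

    lastN : ∀ {a e f g s b i j v} → evalN e s ≡ i → evalN f s ≡ j → evalN g s ≡ v →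
            Q (writeN a i j v s) → Runs (a [ e ][ f ]≔ g) s (suc b) Q R
    lastN refl refl refl x = runs (s≤s z≤n) (accepted x)

    lastW : ∀ {a e f g s b i j v} → evalN e s ≡ i → evalN f s ≡ j → evalW g s ≡ v →
            Q (writeW a i j v s) → Runs (a ⟦ e ⟧⟦ f ⟧≔ g) s (suc b) Q R
    lastW refl refl refl x = runs (s≤s z≤n) (accepted x)

    skips : ∀ {s b} → Q s → Runs skip s (suc b) Q R
    skips x = runs (s≤s z≤n) (accepted x)

    rejects : ∀ {s b} → R → Runs reject s (suc b) Q R
    rejects x = runs (s≤s z≤n) (rejected x)

    cond-rule : ∀ {b p₁ p₂ s t} → (evalB b s ≡ true → Runs p₁ s t Q R) →
                (evalB b s ≡ false → Runs p₂ s t Q R) →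
                Runs (cond b then p₁ else p₂) s (suc t) Q R
    cond-rule {b} {p₁} {p₂} {s} {t} f g = aux (evalB b s) refl f g
      where
      aux : ∀ v → evalB b s ≡ v → (v ≡ true → Runs p₁ s t Q R) → (v ≡ false → Runs p₂ s t Q R) →
            Runs (cond b then p₁ else p₂) s (suc t) Q R
      aux true  eq f g = let r = f refl in
        runs (subst (λ v → steps (tick (if v then exec p₁ s else exec p₂ s)) ≤ suc t) (sym eq) (s≤s (time r)))
             (subst (λ v → Post Q R (result (tick (if v then exec p₁ s else exec p₂ s)))) (sym eq) (post r))
      aux false eq f g = let r = g refl in
        runs (subst (λ v → steps (tick (if v then exec p₁ s else exec p₂ s)) ≤ suc t) (sym eq) (s≤s (time r)))
             (subst (λ v → Post Q R (result (tick (if v then exec p₁ s else exec p₂ s)))) (sym eq) (post r))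

    if-< : ∀ {e f p₁ p₂ s t m n} → evalN e s ≡ m → evalN f s ≡ n →
           (m < n → Runs p₁ s t Q R) → (n ≤ m → Runs p₂ s t Q R) →
           Runs (cond e <ᵉ f then p₁ else p₂) s (suc t) Q R
    if-< {e} {f} {s = s} refl refl h k = cond-rule {b = e <ᵉ f}
      (λ eq → h (<ᵇ⇒< _ _ (subst T (sym eq) _)))
      (λ eq → k (≮⇒≥ λ lt → subst T eq (<⇒<ᵇ lt)))

    if-≡ : ∀ {e f p₁ p₂ s t m n} → evalN e s ≡ m → evalN f s ≡ n →
           (m ≡ n → Runs p₁ s t Q R) → (m ≢ n → Runs p₂ s t Q R) →
           Runs (cond e ≡ᵉ f then p₁ else p₂) s (suc t) Q R
    if-≡ {e} {f} {s = s} refl refl h k = cond-rule {b = e ≡ᵉ f}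
      (λ eq → h (≡ᵇ⇒≡ _ _ (subst T (sym eq) _)))
      (λ eq → k (λ m≡n → subst T eq (≡⇒≡ᵇ _ _ m≡n)))

  private
    -- The body is told that its store results from the first `i` iterations; from this `for-rule`
    -- derives agreement with the store before the loop.
    iterate-runs : ∀ {q r} {R : Set r} {x p} k i₀ (I : ℕ → Store W → Set q) (f : Fin k → ℕ) {s} →
      I i₀ s →
      (∀ (i : Fin k) {s′} → result (iterate (λ i s′ → tick (exec p (writeN x 0 0 i s′))) (toℕ i) i₀ s) ≡ just s′ →
         I (i₀ + toℕ i) s′ →
         Runs p (writeN x 0 0 (i₀ + toℕ i) s′) (f i) (I (suc (i₀ + toℕ i))) R) →
      let o = iterate (λ i s′ → tick (exec p (writeN x 0 0 i s′))) k i₀ s in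
      steps o ≤ sum (suc ∘ f) × Post (I (i₀ + k)) R (result o)
    iterate-runs zero i₀ I f {s} init body =
      z≤n , accepted (subst (λ i → I i s) (sym (+-identityʳ i₀)) init)
    iterate-runs {R = R} {x} {p} (suc k) i₀ I f {s} init body =
      aux (exec p (writeN x 0 0 i₀ s)) refl (time first) (post first)
      where
      F = λ i s′ → tick (exec p (writeN x 0 0 i s′))
      first = subst (λ i → Runs p (writeN x 0 0 i s) (f Fin.zero) (I (suc i)) R) (+-identityʳ i₀)
                (body Fin.zero refl (subst (λ i → I i s) (sym (+-identityʳ i₀)) init))
      aux : ∀ o → exec p (writeN x 0 0 i₀ s) ≡ o → steps o ≤ f Fin.zero → Post (I (suc i₀)) R (result o) →
            let o′ = continue (tick o) (iterate F k (suc i₀)) in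
            steps o′ ≤ sum (suc ∘ f) × Post (I (i₀ + suc k)) R (result o′)
      aux (nothing , t) eq t≤ (rejected y) = ≤-trans (s≤s t≤) (m≤m+n (suc (f Fin.zero)) _) , rejected y
      aux (just s₁ , t) eq t≤ (accepted y) =
        let t≤′ , po′ = iterate-runs {x = x} {p} k (suc i₀) I (f ∘ Fin.suc) {s₁} y λ i {s′} e h →
              subst (λ j → Runs p (writeN x 0 0 j s′) (f (Fin.suc i)) (I (suc j)) R) (+-suc i₀ (toℕ i))
                (body (Fin.suc i)
                  (trans (cong (λ o → result (continue (tick o) (iterate F (toℕ i) (suc i₀)))) eq) e)
                  (subst (λ j → I j s′) (sym (+-suc i₀ (toℕ i))) h))
        in +-mono-≤ (s≤s t≤) t≤′ , subst (λ j → Post (I j) R (result (iterate F k (suc i₀) s₁))) (sym (+-suc i₀ k)) po′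

  for-rule : ∀ {q r} {R : Set r} {x e p s} N (I : ℕ → Store W → Set q) (f : Fin N → ℕ) →
    evalN e s ≡ N → I 0 s →
    (∀ (i : Fin N) {s′} → Agree (for x < e run p) s s′ → I (toℕ i) s′ →
       Runs p (writeN x 0 0 (toℕ i) s′) (f i) (I (suc (toℕ i))) R) →
    Runs (for x < e run p) s (suc (sum (suc ∘ f))) (I N) R
  for-rule {x = x} {e} {p} {s} N I f refl init body =
    let t , po = iterate-runs {x = x} {p} (evalN e s) 0 I f init
                   (λ i eq → body i (frame-iterate x e p (toℕ i) 0 s eq))
    in runs (s≤s t) po

-- Degrees and edges

Unique⇒lookup-injective : ∀ {a} {A : Set a} {xs : List A} → Unique xs → Injective _≡_ _≡_ (lookup xs)
Unique⇒lookup-injective (x∉ ∷ u) {Fin.zero}  {Fin.zero}  eq = refl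
Unique⇒lookup-injective (x∉ ∷ u) {Fin.zero}  {Fin.suc j} eq = contradiction eq (All.lookup x∉ (∈-lookup j))
Unique⇒lookup-injective (x∉ ∷ u) {Fin.suc i} {Fin.zero}  eq = contradiction (sym eq) (All.lookup x∉ (∈-lookup i))
Unique⇒lookup-injective (x∉ ∷ u) {Fin.suc i} {Fin.suc j} eq = cong Fin.suc (Unique⇒lookup-injective u eq)

[_]ᵇ : Bool → ℕ
[ b ]ᵇ = if b then 1 else 0

[]ᵇ≤1 : ∀ b → [ b ]ᵇ ≤ 1
[]ᵇ≤1 true  = ≤-refl
[]ᵇ≤1 false = z≤n

T⇒[]ᵇ≡1 : ∀ {b} → T b → [ b ]ᵇ ≡ 1
T⇒[]ᵇ≡1 {true} _ = refl

length-filter-tabulate : ∀ {a p} {A : Set a} {P : Pred A p} (P? : Decidable P) {n} (f : Fin n → A) →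
  length (filter P? (tabulate f)) ≡ sum (λ i → [ does (P? (f i)) ]ᵇ)
length-filter-tabulate P? {zero}  f = refl
length-filter-tabulate P? {suc n} f with ih ← length-filter-tabulate P? (f ∘ Fin.suc) | does (P? (f Fin.zero))
... | true  = cong suc ih
... | false = ih

length-filter-product : ∀ {a b p} {A : Set a} {B : Set b} {P : Pred (A × B) p} (P? : Decidable P)
  {m n} (f : Fin m → A) (g : Fin n → B) →
  length (filter P? (cartesianProduct (tabulate f) (tabulate g))) ≡
  sum (λ i → sum (λ j → [ does (P? (f i , g j)) ]ᵇ))
length-filter-product P? {zero}  f g = refl
length-filter-product P? {suc m} f g = begin
  length (filter P? (map (f Fin.zero ,_) (tabulate g) ++ rest))
    ≡⟨ cong length (filter-++ P? (map (f Fin.zero ,_) (tabulate g)) rest) ⟩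
  length (filter P? (map (f Fin.zero ,_) (tabulate g)) ++ filter P? rest)
    ≡⟨ length-++ (filter P? (map (f Fin.zero ,_) (tabulate g))) ⟩
  length (filter P? (map (f Fin.zero ,_) (tabulate g))) + length (filter P? rest)
    ≡⟨ cong₂ _+_ (trans (cong (length ∘ filter P?) (map-tabulate g _)) (length-filter-tabulate P? (λ j → f Fin.zero , g j)))
                 (length-filter-product P? (f ∘ Fin.suc) g) ⟩
  sum (λ i → sum (λ j → [ does (P? (f i , g j)) ]ᵇ)) ∎
  where
  open ≡-Reasoning
  rest = cartesianProduct (tabulate (f ∘ Fin.suc)) (tabulate g)

module _ {n : ℕ} (U : Graph n) where

  adj? : ∀ i j → Dec (Adj U i j)
  adj? i j = T? (Graph.adj U i j)

  Adj-sym : ∀ {i j} → Adj U i j → Adj U j i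
  Adj-sym {i} {j} = subst T (Graph.adj-sym U i j)

  Adj-irrefl : ∀ {i j} → Adj U i j → i ≢ j
  Adj-irrefl {i} a refl = subst T (Graph.no-loop U i) a

  private
    arc : Fin n → Fin n → ℕ
    arc i j = [ does ((i Fin.<? j) ×-dec adj? i j) ]ᵇ

    arc≡1 : ∀ {i j} → i Fin.< j → Adj U i j → 1 ≤ arc i j
    arc≡1 {i} {j} lt a = ≤-reflexive (sym (T⇒[]ᵇ≡1
      (subst T (sym (dec-true ((i Fin.<? j) ×-dec adj? i j) (lt , a))) _)))

    adj≤arcs : ∀ i j → [ Graph.adj U i j ]ᵇ ≤ arc i j + arc j i
    adj≤arcs i j = []ᵇ≤ (Graph.adj U i j) λ a → case (Fin.<-cmp i j) a
      where
      []ᵇ≤ : ∀ b {x} → (T b → 1 ≤ x) → [ b ]ᵇ ≤ x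
      []ᵇ≤ true  h = h _
      []ᵇ≤ false h = z≤n
      case : Tri (i Fin.< j) (i ≡ j) (j Fin.< i) → Adj U i j → 1 ≤ arc i j + arc j i
      case (tri< lt _ _) a = ≤-trans (arc≡1 lt a) (m≤m+n _ _)
      case (tri≈ _ eq _) a = contradiction eq (Adj-irrefl a)
      case (tri> _ _ gt) a = ≤-trans (arc≡1 gt (Adj-sym a)) (m≤n+m _ _)

  -- An adjacent pair is increasing in one of its two directions, and `edges` lists the increasing
  -- pairs. Summing `arc` and its transpose therefore gives twice their number.
  sum-adj≤2#edges : sum (λ i → sum (λ j → [ Graph.adj U i j ]ᵇ)) ≤ 2 * #edges U
  sum-adj≤2#edges = begin
    sum (λ i → sum (λ j → [ Graph.adj U i j ]ᵇ))       ≤⟨ sum-mono (λ i → sum-mono (adj≤arcs i)) ⟩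
    sum (λ i → sum (λ j → arc i j + arc j i))
      ≡⟨ sum-cong-≗ (λ i → ∑-distrib-+ (arc i) (λ j → arc j i)) ⟩
    sum (λ i → sum (arc i) + sum (λ j → arc j i))
      ≡⟨ ∑-distrib-+ (λ i → sum (arc i)) (λ i → sum (λ j → arc j i)) ⟩
    sum (λ i → sum (arc i)) + sum (λ i → sum (λ j → arc j i))
      ≡⟨ cong (sum (λ i → sum (arc i)) +_) (trans (∑-comm (λ i j → arc j i)) (sym (+-identityʳ _))) ⟩
    2 * sum (λ i → sum (arc i))
      ≡⟨ cong (2 *_) (length-filter-product (λ (i , j) → (i Fin.<? j) ×-dec adj? i j) id id) ⟨
    2 * #edges U ∎
    where open ≤-Reasoning

  adjacencyLists : AdjacencyLists U
  adjacencyLists = record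
    { neighbours = λ i → filter (adj? i) (allFin n)
    ; unique     = λ i → filter⁺ (adj? i) (allFin⁺ n)
    ; complete   = λ i j → mk⇔ (proj₂ ∘ ∈-filter⁻ (adj? i) {xs = allFin n}) (∈-filter⁺ (adj? i) {xs = allFin n} (∈-allFin j))
    }

module Neighbours {n : ℕ} {U : Graph n} (L : AdjacencyLists U) where
  open AdjacencyLists L

  degree : Fin n → ℕ
  degree v = length (neighbours v)

  neighbour : ∀ v → Fin (degree v) → Fin n
  neighbour v = lookup (neighbours v)

  neighbour-adj : ∀ v i → Adj U v (neighbour v i)
  neighbour-adj v i = Equivalence.to (complete v _) (∈-lookup i)

  adj-neighbour : ∀ {v u} → Adj U v u → ∃[ i ] neighbour v i ≡ u
  adj-neighbour {v} {u} a = Any.index m , sym (lookup-index m)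
    where m = Equivalence.from (complete v u) a

  neighbour-injective : ∀ v → Injective _≡_ _≡_ (neighbour v)
  neighbour-injective v = Unique⇒lookup-injective (unique v)

  degree≤ : ∀ v → degree v ≤ sum (λ u → [ Graph.adj U v u ]ᵇ)
  degree≤ v = begin
    degree v                                                    ≡⟨ *-identityʳ _ ⟨
    degree v * 1                                                ≡⟨ sum-const (degree v) 1 ⟨
    sum {degree v} (λ _ → 1)                                    ≡⟨ sum-cong-≗ (λ i → sym (T⇒[]ᵇ≡1 (neighbour-adj v i))) ⟩
    sum (λ i → [ Graph.adj U v (neighbour v i) ]ᵇ)              ≤⟨ sum-inj (λ u → [ Graph.adj U v u ]ᵇ) (neighbour v) (neighbour-injective v) ⟩
    sum (λ u → [ Graph.adj U v u ]ᵇ)                            ∎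
    where open ≤-Reasoning

  degree≤n : ∀ v → degree v ≤ n
  degree≤n v = ≤-trans (degree≤ v) (≤-trans (sum-bound 1 (λ u → []ᵇ≤1 (Graph.adj U v u))) (≤-reflexive (*-identityʳ n)))

  sum-degree : sum degree ≤ 2 * #edges U
  sum-degree = ≤-trans (sum-mono degree≤) (sum-adj≤2#edges U)

  -- The neighbours handled after `i` iterations over the list of `v`; the invariants of the
  -- neighbour loops are phrased with it.
  Seen : Fin n → ℕ → Fin n → Set
  Seen v i u = ∃[ j ] toℕ j < i × neighbour v j ≡ u

  Seen-zero : ∀ {v u} → ¬ Seen v 0 u
  Seen-zero (_ , () , _)

  Seen-suc : ∀ {v u} i → Seen v (suc (toℕ i)) u → Seen v (toℕ i) u ⊎ neighbour v i ≡ u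
  Seen-suc i (j , lt , e) with m≤n⇒m<n∨m≡n (s≤s⁻¹ lt)
  ... | inj₁ lt′ = inj₁ (j , lt′ , e)
  ... | inj₂ eq  = inj₂ (trans (cong (neighbour _) (sym (Fin.toℕ-injective eq))) e)

  Seen-all : ∀ {v u} → Adj U v u → Seen v (degree v) u
  Seen-all a with i , e ← adj-neighbour a = i , Fin.toℕ<n i , e

  Seen-adj : ∀ {v i u} → Seen v i u → Adj U v u
  Seen-adj {v} (j , _ , e) = subst (Adj U v) e (neighbour-adj v j)

  Seen-next : ∀ {v} i → ¬ Seen v (toℕ i) (neighbour v i)
  Seen-next {v} i (j , lt , e) = <-irrefl (cong toℕ (neighbour-injective v e)) lt

  Seen-step : ∀ {v i u} → Seen v i u → Seen v (suc i) u
  Seen-step (j , lt , e) = j , m<n⇒m<1+n lt , e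

  Seen-here : ∀ {v} i → Seen v (suc (toℕ i)) (neighbour v i)
  Seen-here i = i , ≤-refl , refl

-- Perfect orderings and chordality

argmax : ∀ {n} (f : Fin (suc n) → ℕ) → ∃[ i ] (∀ j → f j ≤ f i)
argmax {zero}  f = Fin.zero , λ { Fin.zero → ≤-refl }
argmax {suc n} f with i , max ← argmax (f ∘ Fin.suc) with ≤-total (f Fin.zero) (f (Fin.suc i))
... | inj₁ le = Fin.suc i , λ { Fin.zero → le ; (Fin.suc j) → max j }
... | inj₂ ge = Fin.zero , λ { Fin.zero → ≤-refl ; (Fin.suc j) → ≤-trans (max j) ge }

private
  Next : ℕ → ℕ → ℕ → Set
  Next ℓ a b = (b ≡ suc a) ⊎ (suc a ≡ ℓ × b ≡ 0)

  no-3-cycle : ∀ {ℓ a b c} → 3 < ℓ → Next ℓ c a → Next ℓ a b → ¬ Next ℓ b c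
  no-3-cycle h (inj₁ refl) (inj₁ refl) (inj₂ (refl , refl)) = <-irrefl refl h
  no-3-cycle h (inj₁ refl) (inj₂ (refl , refl)) (inj₁ refl) = <-irrefl refl h
  no-3-cycle h (inj₁ refl) (inj₂ (refl , refl)) (inj₂ (() , _))
  no-3-cycle h (inj₂ (refl , refl)) (inj₁ refl) (inj₁ refl) = <-irrefl refl h
  no-3-cycle h (inj₂ (refl , refl)) (inj₁ refl) (inj₂ (refl , ()))
  no-3-cycle (s≤s ()) (inj₂ (refl , refl)) (inj₂ (refl , refl)) nx

  Next-functional : ∀ {ℓ a b b′} → b < ℓ → b′ < ℓ → Next ℓ a b → Next ℓ a b′ → b ≡ b′
  Next-functional lt lt′ (inj₁ refl)       (inj₁ refl)       = refl
  Next-functional lt lt′ (inj₁ refl)       (inj₂ (refl , _)) = contradiction lt (<-irrefl refl)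
  Next-functional lt lt′ (inj₂ (refl , _)) (inj₁ refl)       = contradiction lt′ (<-irrefl refl)
  Next-functional lt lt′ (inj₂ (_ , refl)) (inj₂ (_ , refl)) = refl

  no-1-cycle : ∀ {ℓ a} → 3 < ℓ → ¬ Next ℓ a a
  no-1-cycle (s≤s ()) (inj₂ (refl , refl))

  no-2-cycle : ∀ {ℓ a b} → 3 < ℓ → Next ℓ a b → ¬ Next ℓ b a
  no-2-cycle h            (inj₁ refl)          (inj₂ (refl , refl)) with s≤s (s≤s ()) ← h
  no-2-cycle h            (inj₂ (refl , refl)) (inj₁ refl)          with s≤s (s≤s ()) ← h
  no-2-cycle (s≤s ())     (inj₂ (refl , refl)) (inj₂ (refl , e))

  next : ∀ {ℓ} (a : Fin ℓ) → ∃[ b ] CyclicSuc a b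
  next {suc ℓ} a with suc (toℕ a) <? suc ℓ
  ... | yes lt = Fin.fromℕ< lt , inj₁ (Fin.toℕ-fromℕ< lt)
  ... | no ≮   = Fin.zero , inj₂ (≤-antisym (Fin.toℕ<n a) (≮⇒≥ ≮) , refl)

  previous : ∀ {ℓ} (a : Fin ℓ) → ∃[ b ] CyclicSuc b a
  previous {suc ℓ} Fin.zero    = Fin.fromℕ ℓ , inj₂ (cong suc (Fin.toℕ-fromℕ ℓ) , refl)
  previous {suc ℓ} (Fin.suc a) = Fin.inject₁ a , inj₁ (cong suc (sym (Fin.toℕ-inject₁ a)))

-- At the latest vertex of the cycle both cycle neighbours are earlier, hence adjacent. A cycle
-- longer than 3 makes them distinct and not consecutive, so their edge is a chord.
perfect⇒chordal : ∀ {n} {U : Graph n} (d : Permutation′ n) → Perfect U d → Chordal U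
perfect⇒chordal {n} {U} d perfect {suc ℓ} h C
  with a , max ← argmax (λ a → toℕ (d ⟨$⟩ʳ Cycle.vertex C a))
  with b , a→b ← next a | c , c→a ← previous a = b , c , b≢c , no-3-cycle h c→a a→b , c↛b , b~c
  where
  open Cycle C
  b≢c : b ≢ c
  b≢c refl = no-2-cycle h a→b c→a
  c↛b : ¬ CyclicSuc c b
  c↛b c→b with refl ← Fin.toℕ-injective (Next-functional (Fin.toℕ<n a) (Fin.toℕ<n b) c→a c→b) = no-1-cycle h a→b
  earlier : ∀ {e} → Adj U (vertex e) (vertex a) → toℕ (d ⟨$⟩ʳ vertex e) < toℕ (d ⟨$⟩ʳ vertex a)
  earlier {e} e~a = ≤∧≢⇒< (max e) λ eq → Adj-irrefl U e~a
    (trans (sym (inverseˡ d)) (trans (cong (d ⟨$⟩ˡ_) (Fin.toℕ-injective eq)) (inverseˡ d)))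
  b~a = Adj-sym U (edge a→b)
  b~c : Adj U (vertex b) (vertex c)
  b~c = perfect (vertex a) (inj₂ (b~a , earlier {b} b~a)) (inj₂ (edge c→a , earlier {c} (edge c→a))) (b≢c ∘ injective)

-- Maximum cardinality orderings

least : ∀ {p} {P : ℕ → Set p} → (∀ i → Dec (P i)) → ∀ r → P r →
        ∃[ i ] i ≤ r × P i × (∀ {j} → j < i → ¬ P j)
least P? zero    Pr = zero , z≤n , Pr , λ ()
least {P = P} P? (suc r) Pr with P? 0
... | yes P0 = 0 , z≤n , P0 , λ ()
... | no ¬P0 with i , i≤r , Pi , min ← least (P? ∘ suc) r Pr =
  suc i , s≤s i≤r , Pi , λ { {zero} _ → ¬P0 ; {suc j} (s≤s j<i) → min j<i }

-- If every vertex maximises, among the vertices not yet visited, the number of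
-- visited neighbours, then a visited neighbour a of c but not of b is offset
-- by a visited neighbour d of b but not of c.
Maximal : ∀ {n} → Graph n → (Fin n → ℕ) → Set
Maximal U π = ∀ {a b c} → π a < π b → π b < π c → Adj U a c → ¬ Adj U a b →
              ∃[ d ] π d < π b × Adj U d b × ¬ Adj U d c

module _ {n : ℕ} (U : Graph n) where

  -- `r` is the index of the last vertex. The pair of both ends is exempt from `chordless`, so that
  -- a path with adjacent ends closes to a chordless cycle of `suc r` vertices.
  record NearlyInducedPath (v : ℕ → Fin n) (r : ℕ) : Set where
    field
      step      : ∀ {i} → i < r → Adj U (v i) (v (suc i))
      distinct  : ∀ {i j} → i < j → j ≤ r → v i ≢ v j
      chordless : ∀ {i j} → suc i < j → j ≤ r → ¬ (i ≡ 0 × j ≡ r) → ¬ Adj U (v i) (v j)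
  open NearlyInducedPath

  induced-cycle⇒¬chordal : ∀ {v r} → NearlyInducedPath v r → 3 ≤ r → Adj U (v r) (v 0) → ¬ Chordal U
  induced-cycle⇒¬chordal {v} {r} P 3≤r closed chordal = contra (chordal (s≤s 3≤r) C)
    where
    bound : ∀ (a : Fin (suc r)) → toℕ a ≤ r
    bound a = s≤s⁻¹ (Fin.toℕ<n a)
    C : Cycle U (suc r)
    C = record
      { vertex    = v ∘ toℕ
      ; injective = inj
      ; edge      = edge′
      }
      where
      inj : Injective _≡_ _≡_ (v ∘ toℕ)
      inj {a} {b} eq with <-cmp (toℕ a) (toℕ b)
      ... | tri< lt _ _ = contradiction eq (distinct P lt (bound b))
      ... | tri≈ _ e _  = Fin.toℕ-injective e
      ... | tri> _ _ gt = contradiction (sym eq) (distinct P gt (bound a))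
      edge′ : ∀ {a b} → CyclicSuc a b → Adj U (v (toℕ a)) (v (toℕ b))
      edge′ {a} {b} (inj₁ e) = subst (λ j → Adj U (v (toℕ a)) (v j)) (sym e)
                                 (step P (subst (_≤ r) e (bound b)))
      edge′ (inj₂ (e , e′)) = subst₂ (λ i j → Adj U (v i) (v j)) (sym (suc-injective e)) (sym e′) closed
    far : ∀ a b → toℕ a < toℕ b → ¬ CyclicSuc a b → ¬ CyclicSuc b a → ¬ Adj U (v (toℕ a)) (v (toℕ b))
    far a b lt a↛b b↛a = chordless P (≤∧≢⇒< lt (a↛b ∘ inj₁ ∘ sym)) (bound b)
                           λ (e , e′) → b↛a (inj₂ (cong suc e′ , e))
    contra : ¬ HasChord C
    contra (a , b , a≢b , a↛b , b↛a , adj) with <-cmp (toℕ a) (toℕ b)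
    ... | tri< lt _ _ = far a b lt a↛b b↛a adj
    ... | tri≈ _ e _  = a≢b (Fin.toℕ-injective e)
    ... | tri> _ _ gt = far b a gt b↛a a↛b (Adj-sym U adj)

  -- Allows the later of the two ends to be taken as the last vertex.
  reverse-path : ∀ {v r} → NearlyInducedPath v r → NearlyInducedPath (λ i → v (r ∸ i)) r
  reverse-path {v} {r} P = record
    { step      = λ {i} lt → Adj-sym U (subst (λ j → Adj U (v (r ∸ suc i)) (v j)) (suc∸ lt)
                    (step P (subst (_≤ r) (sym (suc∸ lt)) (m∸n≤m r i))))
    ; distinct  = λ {i} {j} lt j≤ → distinct P (∸-monoʳ-< lt j≤) (m∸n≤m r i) ∘ sym
    ; chordless = λ { {i} {suc j} (s≤s lt) j≤ ends → chordless P
                        (subst (_< r ∸ i) (sym (suc∸ j≤)) (∸-monoʳ-< lt (<⇒≤ j≤))) (m∸n≤m r i)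
                        (λ (e , e′) → ends (≤-antisym (≮⇒≥ λ 0<i → <-irrefl e′ (∸-monoʳ-< 0<i (<⇒≤ (<-trans lt j≤)))) z≤n
                                           , ≤-antisym j≤ (m∸n≡0⇒m≤n e)))
                      ∘ Adj-sym U }
    }
    where
    suc∸ : ∀ {i} → i < r → suc (r ∸ suc i) ≡ r ∸ i
    suc∸ {i} lt = sym (+-∸-assoc 1 lt)

  module _ (π : Fin n → ℕ) (π-injective : Injective _≡_ _≡_ π) (maximal : Maximal U π) (chordal : Chordal U) where

    private
      Interior : (ℕ → Fin n) → ℕ → Set
      Interior v r = ∀ {i} → 0 < i → i < r → π (v 0) < π (v i) × π (v r) < π (v i)

      -- The larger end w = v r and the first interior vertex v 1 yield, by
      -- maximality, a vertex d before w that is adjacent to w but not to v 1.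
      -- Cutting the path at the first neighbour of d and continuing to d gives
      -- a path with earlier ends, or a chordless cycle.
      no-path : ∀ m v r → NearlyInducedPath v r → 2 ≤ r → ¬ Adj U (v 0) (v r) → Interior v r →
                π (v 0) < m → π (v r) < m → ⊥

      shorten : ∀ m v r → NearlyInducedPath v r → 2 ≤ r → ¬ Adj U (v 0) (v r) → Interior v r →
                π (v 0) < π (v r) → π (v r) < suc m → ⊥
      shorten m v (suc r) P (s≤s 1≤r) u≁w interior u<w w<m
        with d , d<w , d~w , d≁v₁ ← maximal {v 0} {v (suc r)} {v 1} u<w
               (proj₂ (interior z<s (s≤s 1≤r))) (step P z<s) u≁w
        with least (λ i → adj? U d (v (suc i))) r d~w
      ... | zero   , _   , d~v₁ , _   = d≁v₁ d~v₁
      ... | suc i₀ , i≤r , d~vᵢ , min = finish (adj? U (v 0) d)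
        where
        i = suc (suc i₀)
        v′ : ℕ → Fin n
        v′ j = if does (j ≤? i) then v j else d
        v′-≤ : ∀ {j} → j ≤ i → v′ j ≡ v j
        v′-≤ {j} le = cong (λ b → if b then v j else d) (dec-true (j ≤? i) le)
        v′-last : v′ (suc i) ≡ d
        v′-last = cong (λ b → if b then v (suc i) else d) (dec-false (suc i ≤? i) (<-irrefl refl))
        w≤ : ∀ {j} → 0 < j → j ≤ suc r → π (v (suc r)) ≤ π (v j)
        w≤ 0<j le with m≤n⇒m<n∨m≡n le
        ... | inj₁ lt   = <⇒≤ (proj₂ (interior 0<j lt))
        ... | inj₂ refl = ≤-refl
        -- The ends of the old path are nonadjacent as well, so here no pair is exempt.
        nonadjacent : ∀ {j k} → suc j < k → k ≤ suc r → ¬ Adj U (v j) (v k)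
        nonadjacent {j} {k} lt le with j ≟ 0 | k ≟ suc r
        ... | yes refl | yes refl = u≁w
        ... | no ne    | _        = chordless P lt le (ne ∘ proj₁)
        ... | yes refl | no ne    = chordless P lt le (ne ∘ proj₂)
        v≢d : ∀ {j} → j ≤ i → v j ≢ d
        v≢d {zero}  le refl = u≁w d~w
        v≢d {suc j} le refl = <-irrefl refl (<-≤-trans d<w (w≤ z<s (≤-trans le (s≤s i≤r))))
        v≁d : ∀ {j} → 0 < j → j < i → ¬ Adj U (v j) d
        v≁d {suc j} _ (s≤s lt) = min lt ∘ Adj-sym U
        P′ : NearlyInducedPath v′ (suc i)
        P′ = record { step = step′ ; distinct = distinct′ ; chordless = chordless′ }
          where
          step′ : ∀ {j} → j < suc i → Adj U (v′ j) (v′ (suc j))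
          step′ (s≤s le) with m≤n⇒m<n∨m≡n le
          ... | inj₁ lt   = subst₂ (Adj U) (sym (v′-≤ le)) (sym (v′-≤ lt)) (step P (≤-trans lt (s≤s i≤r)))
          ... | inj₂ refl = subst₂ (Adj U) (sym (v′-≤ le)) (sym v′-last) (Adj-sym U d~vᵢ)
          distinct′ : ∀ {j k} → j < k → k ≤ suc i → v′ j ≢ v′ k
          distinct′ lt le with m≤n⇒m<n∨m≡n le
          ... | inj₁ (s≤s le′) = subst₂ _≢_ (sym (v′-≤ (≤-trans (<⇒≤ lt) le′))) (sym (v′-≤ le′))
                                   (distinct P lt (≤-trans le′ (s≤s i≤r)))
          ... | inj₂ refl = subst₂ _≢_ (sym (v′-≤ (s≤s⁻¹ lt))) (sym v′-last) (v≢d (s≤s⁻¹ lt))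
          chordless′ : ∀ {j k} → suc j < k → k ≤ suc i → ¬ (j ≡ 0 × k ≡ suc i) → ¬ Adj U (v′ j) (v′ k)
          chordless′ lt le ends with m≤n⇒m<n∨m≡n le
          ... | inj₁ (s≤s le′) = subst₂ (λ a b → ¬ Adj U a b) (sym (v′-≤ (≤-trans (n≤1+n _) (≤-trans (<⇒≤ lt) le′))))
                                   (sym (v′-≤ le′)) (nonadjacent lt (≤-trans le′ (s≤s i≤r)))
          ... | inj₂ refl = subst₂ (λ a b → ¬ Adj U a b) (sym (v′-≤ (≤-trans (n≤1+n _) (s≤s⁻¹ lt)))) (sym v′-last)
                              (v≁d (n≢0⇒n>0 λ e → ends (e , refl)) (s≤s⁻¹ lt))
        interior′ : Interior v′ (suc i)
        interior′ {j} 0<j (s≤s le) = subst₂ (λ a b → π a < π b) (sym (v′-≤ z≤n)) (sym (v′-≤ le)) u<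
                                   , subst₂ (λ a b → π a < π b) (sym v′-last) (sym (v′-≤ le)) (<-≤-trans d<w w≤v)
          where
          w≤v = w≤ 0<j (≤-trans le (s≤s i≤r))
          u< = <-≤-trans u<w w≤v
        finish : Dec (Adj U (v 0) d) → ⊥
        -- The cycle is `v 0`, ..., `v i`, `d`; it has more than 3 vertices because `i` is at least
        -- 2.
        finish (yes u~d) = induced-cycle⇒¬chordal P′ (s≤s (s≤s (s≤s z≤n)))
          (subst₂ (Adj U) (sym v′-last) (sym (v′-≤ z≤n)) (Adj-sym U u~d)) chordal
        finish (no u≁d) = no-path m v′ (suc i) P′ (s≤s (s≤s z≤n))
          (subst₂ (λ a b → ¬ Adj U a b) (sym (v′-≤ z≤n)) (sym v′-last) u≁d) interior′
          (subst (λ a → π a < m) (sym (v′-≤ z≤n)) (<-≤-trans u<w (s≤s⁻¹ w<m)))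
          (subst (λ a → π a < m) (sym v′-last) (<-≤-trans d<w (s≤s⁻¹ w<m)))

      no-path zero v r P 2≤r u≁w interior () w<m
      no-path (suc m) v r P 2≤r u≁w interior u<m w<m with <-cmp (π (v 0)) (π (v r))
      ... | tri< u<w _ _ = shorten m v r P 2≤r u≁w interior u<w w<m
      ... | tri≈ _ e _   = distinct P (≤-trans (s≤s z≤n) 2≤r) ≤-refl (π-injective e)
      ... | tri> _ _ w<u = shorten m (λ i → v (r ∸ i)) r (reverse-path P) 2≤r
        (subst (λ j → ¬ Adj U (v r) (v j)) (sym (n∸n≡0 r)) (u≁w ∘ Adj-sym U))
        (λ {i} 0<i i<r → let lt = m<n⇒0<n∸m i<r ; lt′ = ∸-monoʳ-< 0<i (<⇒≤ i<r) in
           proj₂ (interior lt lt′)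
         , subst (λ j → π (v j) < π (v (r ∸ i))) (sym (n∸n≡0 r)) (proj₁ (interior lt lt′)))
        (subst (λ j → π (v r) < π (v j)) (sym (n∸n≡0 r)) w<u)
        (subst (λ j → π (v j) < suc m) (sym (n∸n≡0 r)) u<m)

    -- Otherwise `x`, `z`, `y` would be a path of the kind excluded by `no-path`, with `z` as its
    -- only interior vertex.
    earlier-neighbours-adjacent : ∀ {x y z} → Adj U x z → Adj U y z → π x < π z → π y < π z → x ≢ y → Adj U x y
    earlier-neighbours-adjacent {x} {y} {z} x~z y~z x<z y<z x≢y with adj? U x y
    ... | yes x~y = x~y
    ... | no x≁y  = ⊥-elim (no-path (π z) v 2 P ≤-refl x≁y interior x<z y<z)
      where
      v : ℕ → Fin n
      v 0 = x
      v 1 = z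
      v _ = y
      P : NearlyInducedPath v 2
      P = record
        { step      = λ { {0} _ → x~z ; {1} _ → Adj-sym U y~z ; {suc (suc _)} (s≤s (s≤s ())) }
        ; distinct  = λ { {0} {1} _ _ refl → <-irrefl refl x<z ; {0} {2} _ _ e → x≢y e
                        ; {1} {2} _ _ refl → <-irrefl refl y<z
                        ; {suc _} {1} (s≤s ()) ; {suc (suc _)} {2} (s≤s (s≤s ()))
                        ; {_} {suc (suc (suc _))} _ (s≤s (s≤s ())) }
        ; chordless = λ { {0} {2} _ _ ends → contradiction (refl , refl) ends
                        ; {suc _} {2} (s≤s (s≤s ())) ; {_} {1} (s≤s ())
                        ; {_} {suc (suc (suc _))} _ (s≤s (s≤s ())) }
        }
      interior : Interior v 2
      interior {1} _ _ = x<z , y<z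
      interior {suc (suc _)} _ (s≤s (s≤s ()))

module _ {n : ℕ} (U : Graph n) (d : Permutation′ n) where

  position : Fin n → ℕ
  position v = toℕ (d ⟨$⟩ʳ v)

  position-injective : Injective _≡_ _≡_ position
  position-injective eq = trans (sym (inverseˡ d)) (trans (cong (d ⟨$⟩ˡ_) (Fin.toℕ-injective eq)) (inverseˡ d))

  EarlierNeighboursAdjacent : Set
  EarlierNeighboursAdjacent = ∀ {x y z} → Adj U x z → Adj U y z → position x < position z → position y < position z →
                              x ≢ y → Adj U x y

  perfect-intro : EarlierNeighboursAdjacent → Perfect U d
  perfect-intro h k (inj₁ refl)        (inj₁ refl)        ne = contradiction refl ne
  perfect-intro h k (inj₁ refl)        (inj₂ (v~k , _))   ne = Adj-sym U v~k
  perfect-intro h k (inj₂ (u~k , _))   (inj₁ refl)        ne = u~k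
  perfect-intro h k (inj₂ (u~k , u<k)) (inj₂ (v~k , v<k)) ne = h u~k v~k u<k v<k ne

  perfect-elim : Perfect U d → EarlierNeighboursAdjacent
  perfect-elim perfect {z = z} x~z y~z x<z y<z ne = perfect z (inj₂ (x~z , x<z)) (inj₂ (y~z , y<z)) ne

  maximal⇒perfect : Maximal U position → Chordal U → Perfect U d
  maximal⇒perfect maximal chordal =
    perfect-intro (earlier-neighbours-adjacent U position position-injective maximal chordal)

open import Algebra.Structures using (IsAbelianGroup)
open import Relation.Binary.Structures using (IsDecTotalOrder)
-- Extended weights

module ExtendedWeights {c ℓ₁ ℓ₂ : Level} (W : OrderedAbelianGroup c ℓ₁ ℓ₂) where
  open OrderedAbelianGroup W hiding (_≤?_)
  open IsDecTotalOrder isDecTotalOrder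
    using () renaming (refl to ≤ᴳ-refl; trans to ≤ᴳ-trans; reflexive to ≤ᴳ-reflexive; total to ≤ᴳ-total)
  open IsAbelianGroup isAbelianGroup
    using () renaming (assoc to +ᴳ-assoc; comm to +ᴳ-comm; identityˡ to +ᴳ-identityˡ; identityʳ to +ᴳ-identityʳ;
                       sym to ≈-sym; refl to ≈-refl; trans to ≈-trans; ∙-cong to +ᴳ-cong; ∙-congˡ to +ᴳ-congˡ)

  Weight : Set c
  Weight = Weight∞ W

  infixl 6 _⊕_
  _⊕_ : Weight → Weight → Weight
  _⊕_ = _+∞_ W

  infix 4 _≤∞_
  data _≤∞_ : Weight → Weight → Set (c ⊔ˡ ℓ₂) where
    ≤∞-top : ∀ {x} → x ≤∞ nothing
    ≤∞-fin : ∀ {a b} → a ≤ᴳ b → just a ≤∞ just b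

  𝟘 : Weight
  𝟘 = just 0ᴳ

  ≤∞-refl : ∀ {x} → x ≤∞ x
  ≤∞-refl {nothing} = ≤∞-top
  ≤∞-refl {just a}  = ≤∞-fin ≤ᴳ-refl

  ≤∞-reflexive : ∀ {x y} → x ≡ y → x ≤∞ y
  ≤∞-reflexive refl = ≤∞-refl

  ≤∞-trans : ∀ {x y z} → x ≤∞ y → y ≤∞ z → x ≤∞ z
  ≤∞-trans h          ≤∞-top     = ≤∞-top
  ≤∞-trans (≤∞-fin h) (≤∞-fin k) = ≤∞-fin (≤ᴳ-trans h k)

  +ᴳ-mono-≤ᴳ : ∀ {a b a′ b′} → a ≤ᴳ a′ → b ≤ᴳ b′ → a +ᴳ b ≤ᴳ a′ +ᴳ b′
  +ᴳ-mono-≤ᴳ {a} {b} {a′} {b′} h k = ≤ᴳ-trans (+ᴳ-monoʳ-≤ᴳ a k)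
    (≤ᴳ-trans (≤ᴳ-reflexive (+ᴳ-comm a b′)) (≤ᴳ-trans (+ᴳ-monoʳ-≤ᴳ b′ h) (≤ᴳ-reflexive (+ᴳ-comm b′ a′))))

  ⊕-nothing : ∀ x → x ⊕ nothing ≡ nothing
  ⊕-nothing nothing  = refl
  ⊕-nothing (just _) = refl

  ⊕-mono : ∀ {x y x′ y′} → x ≤∞ x′ → y ≤∞ y′ → x ⊕ y ≤∞ x′ ⊕ y′
  ⊕-mono ≤∞-top     k          = ≤∞-top
  ⊕-mono (≤∞-fin h) ≤∞-top     = ≤∞-top
  ⊕-mono (≤∞-fin h) (≤∞-fin k) = ≤∞-fin (+ᴳ-mono-≤ᴳ h k)

  ⊕-monoˡ : ∀ {x x′} y → x ≤∞ x′ → x ⊕ y ≤∞ x′ ⊕ y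
  ⊕-monoˡ y h = ⊕-mono h ≤∞-refl

  ⊕-monoʳ : ∀ x {y y′} → y ≤∞ y′ → x ⊕ y ≤∞ x ⊕ y′
  ⊕-monoʳ x h = ⊕-mono {x} ≤∞-refl h

  -- Finite weights obey the group laws only up to `≈`, whereas extended weights are compared by `≡`
  -- and `≤∞`. The laws are therefore stated as inequalities, in the directions that are used.
  ⊕-comm : ∀ x y → x ⊕ y ≤∞ y ⊕ x
  ⊕-comm nothing  y        = ≤∞-trans ≤∞-top (≤∞-reflexive (sym (⊕-nothing y)))
  ⊕-comm (just a) nothing  = ≤∞-top
  ⊕-comm (just a) (just b) = ≤∞-fin (≤ᴳ-reflexive (+ᴳ-comm a b))

  ⊕-assoc : ∀ x y z → (x ⊕ y) ⊕ z ≤∞ x ⊕ (y ⊕ z)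
  ⊕-assoc nothing  y        z        = ≤∞-top
  ⊕-assoc (just a) nothing  z        = ≤∞-top
  ⊕-assoc (just a) (just b) nothing  = ≤∞-top
  ⊕-assoc (just a) (just b) (just c) = ≤∞-fin (≤ᴳ-reflexive (+ᴳ-assoc a b c))

  ⊕-assoc⁻¹ : ∀ x y z → x ⊕ (y ⊕ z) ≤∞ (x ⊕ y) ⊕ z
  ⊕-assoc⁻¹ nothing  y        z        = ≤∞-top
  ⊕-assoc⁻¹ (just a) nothing  z        = ≤∞-top
  ⊕-assoc⁻¹ (just a) (just b) nothing  = ≤∞-top
  ⊕-assoc⁻¹ (just a) (just b) (just c) = ≤∞-fin (≤ᴳ-reflexive (≈-sym (+ᴳ-assoc a b c)))

  ⊕-identityˡ : ∀ x → 𝟘 ⊕ x ≤∞ x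
  ⊕-identityˡ nothing  = ≤∞-top
  ⊕-identityˡ (just a) = ≤∞-fin (≤ᴳ-reflexive (+ᴳ-identityˡ a))

  ⊕-identityˡ⁻¹ : ∀ x → x ≤∞ 𝟘 ⊕ x
  ⊕-identityˡ⁻¹ nothing  = ≤∞-top
  ⊕-identityˡ⁻¹ (just a) = ≤∞-fin (≤ᴳ-reflexive (≈-sym (+ᴳ-identityˡ a)))

  ⊕-identityʳ⁻¹ : ∀ x → x ≤∞ x ⊕ 𝟘
  ⊕-identityʳ⁻¹ nothing  = ≤∞-top
  ⊕-identityʳ⁻¹ (just a) = ≤∞-fin (≤ᴳ-reflexive (≈-sym (+ᴳ-identityʳ a)))

  ≤∞ᵇ-sound : ∀ x y → _≤∞ᵇ_ W x y ≡ true → x ≤∞ y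
  ≤∞ᵇ-sound x        nothing  e = ≤∞-top
  ≤∞ᵇ-sound (just a) (just b) e with OrderedAbelianGroup._≤?_ W a b
  ... | yes h = ≤∞-fin h

  ≤∞ᵇ-complete : ∀ x y → _≤∞ᵇ_ W x y ≡ false → ¬ (x ≤∞ y) × y ≤∞ x
  ≤∞ᵇ-complete nothing  (just b) e = (λ ()) , ≤∞-top
  ≤∞ᵇ-complete (just a) (just b) e with OrderedAbelianGroup._≤?_ W a b
  ... | no ¬h with ≤ᴳ-total a b
  ...   | inj₁ h = contradiction h ¬h
  ...   | inj₂ h = (λ { (≤∞-fin k) → ¬h k }) , ≤∞-fin h

  infixl 5 _⊓∞_
  _⊓∞_ : Weight → Weight → Weight
  _⊓∞_ = min∞ W

  ⊓∞-sel : ∀ x y → x ⊓∞ y ≡ x ⊎ x ⊓∞ y ≡ y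
  ⊓∞-sel x y with _≤∞ᵇ_ W x y
  ... | true  = inj₁ refl
  ... | false = inj₂ refl

  ⊓∞-≤ˡ : ∀ x y → x ⊓∞ y ≤∞ x
  ⊓∞-≤ˡ x y with _≤∞ᵇ_ W x y in e
  ... | true  = ≤∞-refl
  ... | false = proj₂ (≤∞ᵇ-complete x y e)

  ⊓∞-≤ʳ : ∀ x y → x ⊓∞ y ≤∞ y
  ⊓∞-≤ʳ x y with _≤∞ᵇ_ W x y in e
  ... | true  = ≤∞ᵇ-sound x y e
  ... | false = ≤∞-refl

  module ≤∞-Reasoning where
    open import Relation.Binary.Reasoning.Base.Single _≤∞_ ≤∞-refl ≤∞-trans public

  Matrix : ℕ → Set c
  Matrix n = Fin n → Fin n → Weight

  -- Ordered elimination

  module _ {n : ℕ} (U : Graph n) (π : Fin n → ℕ) (π-injective : Injective _≡_ _≡_ π)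
           (clique : ∀ {x y z} → Adj U x z → Adj U y z → π x < π z → π y < π z → x ≢ y → Adj U x y) where

    -- `nonneg` also supplies the case `i = j`, which `bypass` leaves out: going to a later
    -- neighbour and back is not negative.
    record PathConsistent (ω : Matrix n) : Set (c ⊔ˡ ℓ₂) where
      field
        bypass : ∀ {i j k} → π i < π k → π j < π k → Adj U i k → Adj U j k → i ≢ j →
                 ω i j ≤∞ ω i k ⊕ ω k j
        nonneg : ∀ i j → 𝟘 ≤∞ ω i j ⊕ ω j i

    -- δ is computed from ω by adding the vertices one at a time: the last arc
    -- of a shortest path into k, and the first one out of k, is incident to k.
    record Grown (ω δ : Matrix n) : Set (c ⊔ˡ ℓ₂) where
      field
        diagonal : ∀ i → δ i i ≡ 𝟘
        upper-in : ∀ {i j k} → π i < π k → π j < π k → Adj U j k → δ i k ≤∞ δ i j ⊕ ω j k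
        upper-out : ∀ {i j k} → π i < π k → π j < π k → Adj U j k → δ k i ≤∞ ω k j ⊕ δ j i
        attained-in : ∀ {i k} → π i < π k → δ i k ≡ nothing ⊎
                      ∃[ j ] (π j < π k × Adj U j k × δ i j ⊕ ω j k ≤∞ δ i k)
        attained-out : ∀ {i k} → π i < π k → δ k i ≡ nothing ⊎
                       ∃[ j ] (π j < π k × Adj U j k × ω k j ⊕ δ j i ≤∞ δ k i)

    private
      infinite : ∀ {x y z} → y ≡ nothing → x ≤∞ y ⊕ z
      infinite refl = ≤∞-top

      infiniteʳ : ∀ {x} y {z} → z ≡ nothing → x ≤∞ y ⊕ z
      infiniteʳ y refl = ≤∞-trans ≤∞-top (≤∞-reflexive (sym (⊕-nothing y)))

    module _ {ω δ : Matrix n} (Gr : Grown ω δ) where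
      open Grown Gr
      open ≤∞-Reasoning

      -- Relaxing first all arcs to earlier vertices and then all arcs to later
      -- vertices suffices, because the recursion for δ peels vertices off both
      -- ends of a path in decreasing order.
      module _ {down final : Fin n → Weight}
               (down-step  : ∀ {i j} → Adj U i j → π j < π i → down j ≤∞ down i ⊕ ω i j)
               (final≤down : ∀ i → final i ≤∞ down i)
               (final-step : ∀ {i j} → Adj U i j → π i < π j → final j ≤∞ final i ⊕ ω i j) where

        private
          -- Replacing the source by an arbitrary `a` makes induction on `π a + π i` possible: a
          -- last arc into `i` is relaxed on the way up and lowers `i`, a first arc out of `a` is
          -- relaxed on the way down and lowers `a`.
          final≤-below : ∀ m a i → π a + π i < m → final i ≤∞ down a ⊕ δ a i
          final≤-below (suc m) a i (s≤s le) with <-cmp (π a) (π i)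
          ... | tri≈ _ e _ with refl ← π-injective e = begin
            final a        ∼⟨ final≤down a ⟩
            down a         ∼⟨ ⊕-identityʳ⁻¹ _ ⟩
            down a ⊕ 𝟘     ≡⟨ cong (down a ⊕_) (diagonal a) ⟨
            down a ⊕ δ a a ∎
          ... | tri< a<i _ _ with attained-in a<i
          ...   | inj₁ e = infiniteʳ (down a) e
          ...   | inj₂ (l , l<i , l~i , h) = begin
            final i                   ∼⟨ final-step l~i l<i ⟩
            final l ⊕ ω l i           ∼⟨ ⊕-monoˡ _ (final≤-below m a l (<-≤-trans (+-monoʳ-< (π a) l<i) le)) ⟩
            (down a ⊕ δ a l) ⊕ ω l i  ∼⟨ ⊕-assoc (down a) _ _ ⟩
            down a ⊕ (δ a l ⊕ ω l i)  ∼⟨ ⊕-monoʳ (down a) h ⟩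
            down a ⊕ δ a i            ∎
          final≤-below (suc m) a i (s≤s le) | tri> _ _ i<a with attained-out i<a
          ...   | inj₁ e = infiniteʳ (down a) e
          ...   | inj₂ (j , j<a , j~a , h) = begin
            final i                   ∼⟨ final≤-below m j i (<-≤-trans (+-monoˡ-< (π i) j<a) le) ⟩
            down j ⊕ δ j i            ∼⟨ ⊕-monoˡ _ (down-step (Adj-sym U j~a) j<a) ⟩
            (down a ⊕ ω a j) ⊕ δ j i  ∼⟨ ⊕-assoc (down a) _ _ ⟩
            down a ⊕ (ω a j ⊕ δ j i)  ∼⟨ ⊕-monoʳ (down a) h ⟩
            down a ⊕ δ a i            ∎

        final≤δ : ∀ s i → down s ≤∞ 𝟘 → final i ≤∞ δ s i
        final≤δ s i h = begin
          final i         ∼⟨ final≤-below (suc (π s + π i)) s i ≤-refl ⟩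
          down s ⊕ δ s i  ∼⟨ ⊕-monoˡ _ h ⟩
          𝟘 ⊕ δ s i       ∼⟨ ⊕-identityˡ _ ⟩
          δ s i           ∎

    module _ {ω δ : Matrix n} (PC : PathConsistent ω) (Gr : Grown ω δ) where
      open PathConsistent PC
      open Grown Gr
      open ≤∞-Reasoning

      -- The arc is the last arc, or the first one, of a path whose remainder is a diagonal entry of
      -- `δ`, which is zero.
      δ≤ω : ∀ {i j} → Adj U i j → δ i j ≤∞ ω i j
      δ≤ω {i} {j} i~j with <-cmp (π i) (π j)
      ... | tri< lt _ _ = begin
        δ i j          ∼⟨ upper-in lt lt i~j ⟩
        δ i i ⊕ ω i j  ≡⟨ cong (_⊕ ω i j) (diagonal i) ⟩
        𝟘 ⊕ ω i j      ∼⟨ ⊕-identityˡ _ ⟩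
        ω i j          ∎
      ... | tri≈ _ e _  = contradiction (π-injective e) (Adj-irrefl U i~j)
      ... | tri> _ _ gt = begin
        δ i j          ∼⟨ upper-out gt gt (Adj-sym U i~j) ⟩
        ω i j ⊕ δ j j  ≡⟨ cong (ω i j ⊕_) (diagonal j) ⟩
        ω i j ⊕ 𝟘      ∼⟨ ⊕-comm (ω i j) 𝟘 ⟩
        𝟘 ⊕ ω i j      ∼⟨ ⊕-identityˡ _ ⟩
        ω i j          ∎

      -- Here perfectness enters the distances: distinct earlier neighbours of `k` are adjacent, so
      -- path consistency bounds their direct arc.
      δ-bypass : ∀ {i j k} → π i < π k → π j < π k → Adj U i k → Adj U j k → δ i j ≤∞ ω i k ⊕ ω k j
      δ-bypass {i} {j} {k} i<k j<k i~k j~k with i Fin.≟ j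
      ... | yes refl = ≤∞-trans (≤∞-reflexive (diagonal i)) (nonneg i k)
      ... | no i≢j   = ≤∞-trans (δ≤ω (clique i~k j~k i<k j<k i≢j)) (bypass i<k j<k i~k j~k i≢j)

      private
        Triangle : Fin n → Fin n → Fin n → Set (c ⊔ˡ ℓ₂)
        Triangle i j l = δ i l ≤∞ δ i j ⊕ δ j l

        module _ (k : Fin n) (IH : ∀ {i j l} → π i < π k → π j < π k → π l < π k → Triangle i j l) where

          from-k : ∀ {j l} → π j < π k → π l < π k → Triangle k j l
          from-k {j} {l} j<k l<k with attained-out j<k
          ... | inj₁ e = infinite e
          ... | inj₂ (a , a<k , a~k , h) = begin
            δ k l                    ∼⟨ upper-out l<k a<k a~k ⟩
            ω k a ⊕ δ a l            ∼⟨ ⊕-monoʳ (ω k a) (IH a<k j<k l<k) ⟩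
            ω k a ⊕ (δ a j ⊕ δ j l)  ∼⟨ ⊕-assoc⁻¹ (ω k a) _ _ ⟩
            (ω k a ⊕ δ a j) ⊕ δ j l  ∼⟨ ⊕-monoˡ _ h ⟩
            δ k j ⊕ δ j l            ∎

          into-k : ∀ {i j} → π i < π k → π j < π k → Triangle i j k
          into-k {i} {j} i<k j<k with attained-in j<k
          ... | inj₁ e = infiniteʳ (δ i j) e
          ... | inj₂ (a , a<k , a~k , h) = begin
            δ i k                    ∼⟨ upper-in i<k a<k a~k ⟩
            δ i a ⊕ ω a k            ∼⟨ ⊕-monoˡ _ (IH i<k j<k a<k) ⟩
            (δ i j ⊕ δ j a) ⊕ ω a k  ∼⟨ ⊕-assoc (δ i j) _ _ ⟩
            δ i j ⊕ (δ j a ⊕ ω a k)  ∼⟨ ⊕-monoʳ (δ i j) h ⟩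
            δ i j ⊕ δ j k            ∎

          -- The last arc into `k` and the first one out of `k` form a detour between two earlier
          -- neighbours, and `δ a b` does not exceed it.
          through-k : ∀ {i l} → π i < π k → π l < π k → Triangle i k l
          through-k {i} {l} i<k l<k with attained-in i<k | attained-out l<k
          ... | inj₁ e | _ = infinite e
          ... | inj₂ _ | inj₁ e = infiniteʳ (δ i k) e
          ... | inj₂ (a , a<k , a~k , h) | inj₂ (b , b<k , b~k , h′) = begin
            δ i l                              ∼⟨ IH i<k a<k l<k ⟩
            δ i a ⊕ δ a l                      ∼⟨ ⊕-monoʳ (δ i a) (IH a<k b<k l<k) ⟩
            δ i a ⊕ (δ a b ⊕ δ b l)            ∼⟨ ⊕-monoʳ (δ i a) (⊕-monoˡ _ (δ-bypass a<k b<k a~k b~k)) ⟩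
            δ i a ⊕ ((ω a k ⊕ ω k b) ⊕ δ b l)  ∼⟨ ⊕-monoʳ (δ i a) (⊕-assoc (ω a k) _ _) ⟩
            δ i a ⊕ (ω a k ⊕ (ω k b ⊕ δ b l))  ∼⟨ ⊕-assoc⁻¹ (δ i a) _ _ ⟩
            (δ i a ⊕ ω a k) ⊕ (ω k b ⊕ δ b l)  ∼⟨ ⊕-mono h h′ ⟩
            δ i k ⊕ δ k l                      ∎

          -- The closed walk through `k` and `j` is rotated to start at `a`. It then meets `k` only
          -- between `b` and `a`, where `k` is bypassed, and the remaining walk is nonnegative by
          -- the inductive hypothesis.
          around-k : ∀ {j} → π j < π k → Triangle k j k
          around-k {j} j<k with attained-out j<k | attained-in j<k
          ... | inj₁ e | _ = infinite e
          ... | inj₂ _ | inj₁ e = infiniteʳ (δ k j) e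
          ... | inj₂ (a , a<k , a~k , h) | inj₂ (b , b<k , b~k , h′) = begin
            δ k k                              ≡⟨ trans (diagonal k) (sym (diagonal a)) ⟩
            δ a a                              ∼⟨ IH a<k b<k a<k ⟩
            δ a b ⊕ δ b a                      ∼⟨ ⊕-monoʳ (δ a b) (δ-bypass b<k a<k b~k a~k) ⟩
            δ a b ⊕ (ω b k ⊕ ω k a)            ∼⟨ ⊕-assoc⁻¹ (δ a b) _ _ ⟩
            (δ a b ⊕ ω b k) ⊕ ω k a            ∼⟨ ⊕-comm _ (ω k a) ⟩
            ω k a ⊕ (δ a b ⊕ ω b k)            ∼⟨ ⊕-monoʳ (ω k a) (⊕-monoˡ _ (IH a<k j<k b<k)) ⟩
            ω k a ⊕ ((δ a j ⊕ δ j b) ⊕ ω b k)  ∼⟨ ⊕-monoʳ (ω k a) (⊕-assoc (δ a j) _ _) ⟩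
            ω k a ⊕ (δ a j ⊕ (δ j b ⊕ ω b k))  ∼⟨ ⊕-assoc⁻¹ (ω k a) _ _ ⟩
            (ω k a ⊕ δ a j) ⊕ (δ j b ⊕ ω b k)  ∼⟨ ⊕-mono h h′ ⟩
            δ k j ⊕ δ j k                      ∎

        stay-first : ∀ i l → Triangle i i l
        stay-first i l = ≤∞-trans (⊕-identityˡ⁻¹ _) (≤∞-reflexive (cong (_⊕ δ i l) (sym (diagonal i))))

        stay-last : ∀ i l → Triangle i l l
        stay-last i l = ≤∞-trans (⊕-identityʳ⁻¹ _) (≤∞-reflexive (cong (δ i l ⊕_) (sym (diagonal l))))

        below⁻ : ∀ {i k m} → π k ≡ m → π i < m → π i < π k
        below⁻ refl lt = lt

        below : ∀ m {k} → π k ≡ m → ∀ {i j l} → π i < π k → π j < π k → π l < π k → Triangle i j l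
        -- Induction on a bound for the three positions. A vertex that attains the bound plays the
        -- role of `k` in the lemmas above, and two vertices that attain it coincide.
        triangle-below : ∀ m {i j l} → π i < m → π j < m → π l < m → Triangle i j l
        triangle-below (suc m) {i} {j} {l} (s≤s i≤) (s≤s j≤) (s≤s l≤)
          with m≤n⇒m<n∨m≡n i≤ | m≤n⇒m<n∨m≡n j≤ | m≤n⇒m<n∨m≡n l≤
        ... | inj₁ i< | inj₁ j< | inj₁ l<   = triangle-below m i< j< l<
        ... | inj₁ i< | inj₁ j< | inj₂ e = into-k l (below m e) (below⁻ e i<) (below⁻ e j<)
        ... | inj₁ i< | inj₂ e | inj₁ l< = through-k j (below m e) (below⁻ e i<) (below⁻ e l<)
        ... | inj₂ e | inj₁ j< | inj₁ l< = from-k i (below m e) (below⁻ e j<) (below⁻ e l<)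
        ... | _ | inj₂ e | inj₂ e′ with refl ← π-injective (trans e (sym e′)) = stay-last i j
        ... | inj₂ e | inj₂ e′ | _ with refl ← π-injective (trans e (sym e′)) = stay-first i l
        ... | inj₂ e | inj₁ j< | inj₂ e′ with refl ← π-injective (trans e (sym e′)) =
          around-k i (below m e) (below⁻ e j<)
        below m e i< j< l< = triangle-below m (subst (_ <_) e i<) (subst (_ <_) e j<) (subst (_ <_) e l<)

      triangle : ∀ i j l → δ i l ≤∞ δ i j ⊕ δ j l
      triangle i j l = triangle-below (suc (π i + π j + π l))
        (s≤s (≤-trans (m≤m+n (π i) (π j)) (m≤m+n _ (π l))))
        (s≤s (≤-trans (m≤n+m (π j) (π i)) (m≤m+n _ (π l)))) (s≤s (m≤n+m (π l) _))

  -- Path weights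

  module _ {n : ℕ} (G : WeightedDigraph W n) where
    open WeightedDigraph G

    infixr 5 _++ᴾ_
    _++ᴾ_ : ∀ {i j k} → Path G i j → Path G j k → Path G i k
    []      ++ᴾ q = q
    (e ▹ p) ++ᴾ q = e ▹ (p ++ᴾ q)

    pathWeight-++ : ∀ {i j k} (p : Path G i j) (q : Path G j k) →
                    pathWeight G (p ++ᴾ q) ≈ pathWeight G p +ᴳ pathWeight G q
    pathWeight-++ []            q = ≈-sym (+ᴳ-identityˡ _)
    pathWeight-++ ((a , _) ▹ p) q = ≈-trans (+ᴳ-congˡ (pathWeight-++ p q)) (≈-sym (+ᴳ-assoc a _ _))

    -- An infinite weight is realised by default. Since the invariants keep all entries realised, a
    -- finite entry is never below the distance.
    Realised : Fin n → Fin n → Weight → Set (c ⊔ˡ ℓ₁)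
    Realised i j x = ∀ {a} → x ≡ just a → Σ[ p ∈ Path G i j ] pathWeight G p ≈ a

    realised-⊕ : ∀ {i j k} x y → Realised i j x → Realised j k y → Realised i k (x ⊕ y)
    realised-⊕ (just a) (just b) f g refl with p , e ← f refl | q , e′ ← g refl =
      p ++ᴾ q , ≈-trans (pathWeight-++ p q) (+ᴳ-cong e e′)

    realised-⊓ : ∀ {i j} x y → Realised i j x → Realised i j y → Realised i j (x ⊓∞ y)
    realised-⊓ x y f g e with ⊓∞-sel x y
    ... | inj₁ s = f (trans (sym s) e)
    ... | inj₂ s = g (trans (sym s) e)

    realised-weight : ∀ i j → Realised i j (weight i j)
    realised-weight i j {a} e = (a , e) ▹ [] , +ᴳ-identityʳ a

    realised-𝟘 : ∀ i → Realised i i 𝟘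
    realised-𝟘 i refl = [] , ≈-refl

    negative⇒cycle : ∀ i x → Realised i i x → ¬ 𝟘 ≤∞ x → NegativeCycle G
    negative⇒cycle i nothing  f h = contradiction ≤∞-top h
    negative⇒cycle i (just a) f h with p , e ← f refl =
      i , p , λ le → h (≤∞-fin (≤ᴳ-trans le (≤ᴳ-reflexive e)))

    isDistance : ∀ {i j} x → Realised i j x → (∀ (p : Path G i j) → x ≤∞ just (pathWeight G p)) → IsDistance G i j x
    isDistance {i} {j} nothing  f h = unreachable λ p → case (h p)
      where case : ∀ {a} → ¬ (nothing ≤∞ just a)
            case ()
    isDistance (just a) f h = let p , e = f refl in shortest p e λ q → case (h q)
      where case : ∀ {a b} → just a ≤∞ just b → a ≤ᴳ b
            case (≤∞-fin le) = le

    module _ (δ : Matrix n) (step : ∀ {s i j a} → weight i j ≡ just a → δ s j ≤∞ δ s i ⊕ just a) where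

      -- For fixed `s`, `δ s` is a potential that no arc improves, and summing along the path gives
      -- the bound.
      δ≤path : ∀ {s i j} (p : Path G i j) → δ s j ≤∞ δ s i ⊕ just (pathWeight G p)
      δ≤path []                  = ⊕-identityʳ⁻¹ _
      δ≤path {s} {i} ((a , e) ▹ p) = ≤∞-trans (δ≤path p)
        (≤∞-trans (⊕-monoˡ _ (step e)) (⊕-assoc (δ s i) (just a) _))

      module _ (diagonal : ∀ i → δ i i ≡ 𝟘) where

        δ≤pathWeight : ∀ {i j} (p : Path G i j) → δ i j ≤∞ just (pathWeight G p)
        δ≤pathWeight {i} p = ≤∞-trans (δ≤path p)
          (≤∞-trans (≤∞-reflexive (cong (_⊕ _) (diagonal i))) (⊕-identityˡ _))

        ¬negativeCycle : ¬ NegativeCycle G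
        ¬negativeCycle (i , p , neg) with ≤∞-fin h ← ≤∞-trans (≤∞-reflexive (sym (diagonal i))) (δ≤pathWeight p) = neg h

-- Loops over vertices and neighbours

module _ {c ℓ₁ ℓ₂ : Level} {W : OrderedAbelianGroup c ℓ₁ ℓ₂} where
  open Store

  module _ {q r : Level} {R : Set r} where

    for-const : ∀ {x e p s} N (I : ℕ → Store W → Set q) b → evalN e s ≡ N → I 0 s →
      (∀ (i : Fin N) {s′} → Agree (for x < e run p) s s′ → I (toℕ i) s′ →
         Runs p (writeN x 0 0 (toℕ i) s′) b (I (suc (toℕ i))) R) →
      Runs (for x < e run p) s (suc (N * suc b)) (I N) R
    for-const N I b eq init body =
      within (s≤s (≤-reflexive (sum-const N (suc b)))) (for-rule N I (λ _ → b) eq init body)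

    -- `g` names the vertex visited in each iteration. As these are distinct, work proportional to
    -- `h` adds up to at most `sum h`; with degrees for `h`, this is the source of the factor m in
    -- the running times.
    for-sum : ∀ {n x e p s} N (I : ℕ → Store W → Set q) (h : Fin n → ℕ) (g : Fin N → Fin n) →
      Injective _≡_ _≡_ g → ∀ a b → evalN e s ≡ N → I 0 s →
      (∀ (i : Fin N) {s′} → Agree (for x < e run p) s s′ → I (toℕ i) s′ →
         Runs p (writeN x 0 0 (toℕ i) s′) (a + h (g i) * b) (I (suc (toℕ i))) R) →
      Runs (for x < e run p) s (suc (N * suc a + sum h * b)) (I N) R
    for-sum N I h g g-inj a b eq init body = within
      (s≤s (≤-trans (sum-affine {g = h ∘ g} (suc a) b (λ _ → ≤-refl))
                    (+-monoʳ-≤ (N * suc a) (*-monoˡ-≤ b (sum-inj h g g-inj)))))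
      (for-rule N I (λ i → a + h (g i) * b) eq init body)

  module GraphInput {n : ℕ} {U : Graph n} (L : AdjacencyLists U) where
    open Neighbours L public

    HoldsGraph : Store W → Set
    HoldsGraph s = (nat s order 0 0 ≡ n) × (∀ v → nat s deg (toℕ v) 0 ≡ degree v) ×
                   (∀ v (i : Fin (degree v)) → nat s nbr (toℕ v) (toℕ i) ≡ toℕ (neighbour v i))

    holdsGraph-agree : ∀ {p s s′} → Agree p s s′ → modifiesN p order ≡ false → modifiesN p deg ≡ false →
                       modifiesN p nbr ≡ false → HoldsGraph s → HoldsGraph s′
    holdsGraph-agree ag e₀ e₁ e₂ (h₀ , h₁ , h₂) =
      trans (natᶠ ag order 0 0 e₀) h₀ ,
      (λ v → trans (natᶠ ag deg (toℕ v) 0 e₁) (h₁ v)) ,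
      (λ v i → trans (natᶠ ag nbr (toℕ v) (toℕ i) e₂) (h₂ v i))

    -- The premises on names hold by `refl` for concrete loops. They ensure that the vertex held in
    -- `e` and its adjacency list can be read in every iteration.
    neighbours-rule : ∀ {q r} {R : Set r} {a b e body s} (u : Fin n) (I : ℕ → Store W → Set q) c →
      let loop = for a < deg [ ! e ] run ((b ≔ nbr [ ! e ][ ! a ]) ⨾ body) in
      (a ≡ᵇ e) ≡ false → (a ≡ᵇ nbr) ≡ false → modifiesN loop e ≡ false →
      HoldsGraph s → (∀ {i s′} → Agree loop s s′ → I i s′ → HoldsGraph s′) →
      nat s e 0 0 ≡ toℕ u → I 0 s →
      (∀ i {s′} → Agree loop s s′ → I (toℕ i) s′ →
         Runs body (writeN b 0 0 (toℕ (neighbour u i)) (writeN a 0 0 (toℕ i) s′)) c (I (suc (toℕ i))) R) →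
      Runs loop s (suc (degree u * suc (suc c))) (I (degree u)) R
    neighbours-rule {a = a} {b} {e} {body} {s} u I c a≢e a≢nbr e-kept hg hgI e≡ init step =
      for-const (degree u) I (suc c) (trans (cong (λ v → nat s deg v 0) e≡) (proj₁ (proj₂ hg) u)) init
        λ i {s′} ag h →
          let e≡′ = trans (write-agree a 0 0 (toℕ i) (nat s′) e 0 0 a≢e) (trans (natᶠ ag e 0 0 e-kept) e≡) in
          assignN refl refl
            (trans (cong₂ (λ v j → write a 0 0 (toℕ i) (nat s′) nbr v j) e≡′ (write-same a 0 0 (toℕ i) (nat s′)))
              (trans (write-agree a 0 0 (toℕ i) (nat s′) nbr (toℕ u) (toℕ i) a≢nbr)
                     (proj₂ (proj₂ (hgI ag h)) u i)))
            (step i ag h)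

  extend-toℕ : ∀ {a} {A : Set a} {n} (z : A) (f : Fin n → A) v → extend z f (toℕ v) ≡ f v
  extend-toℕ z f Fin.zero    = refl
  extend-toℕ z f (Fin.suc v) = extend-toℕ z (f ∘ Fin.suc) v

  nth-toℕ : ∀ {n} (xs : List (Fin n)) i → nth (map toℕ xs) (toℕ i) ≡ toℕ (lookup xs i)
  nth-toℕ (x ∷ xs) Fin.zero    = refl
  nth-toℕ (x ∷ xs) (Fin.suc i) = nth-toℕ xs i

  module _ {n : ℕ} {U : Graph n} (L : AdjacencyLists U) where
    open GraphInput L
    open AdjacencyLists L

    graphMemory-holds : ∀ ω → HoldsGraph (store (graphMemory L) ω)
    graphMemory-holds ω = refl , extend-toℕ 0 degree ,
      λ v i → trans (extend-toℕ 0 (λ v → nth (map toℕ (neighbours v)) (toℕ i)) v) (nth-toℕ (neighbours v) i)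

    orderedGraphMemory-holds : ∀ d ω → HoldsGraph (store (orderedGraphMemory L d) ω) ×
                                       HoldsOrdering {W = W} d (store (orderedGraphMemory L d) ω)
    orderedGraphMemory-holds d ω = graphMemory-holds ω , extend-toℕ 0 _ , extend-toℕ 0 _

  weightMatrix : ∀ {n} → Name → Store W → Fin n → Fin n → Weight∞ W
  weightMatrix a s i j = wt s a (toℕ i) (toℕ j)

  weightMemory-holds : ∀ {n} (G : WeightedDigraph W n) i j →
                       extend nothing (λ u → extend nothing (WeightedDigraph.weight G u) (toℕ j)) (toℕ i) ≡
                       WeightedDigraph.weight G i j
  weightMemory-holds G i j =
    trans (extend-toℕ nothing (λ u → extend nothing (WeightedDigraph.weight G u) (toℕ j)) i)
          (extend-toℕ nothing (WeightedDigraph.weight G i) j)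

  reject-if-negative : ∀ {q r} {Q : Store W → Set q} {R : Set r} {e s v} → evalW e s ≡ v →
    let open ExtendedWeights W in (¬ 𝟘 ≤∞ v → R) → (𝟘 ≤∞ v → Q s) →
    Runs (when e <ʷ 0ʷ then reject) s 2 Q R
  reject-if-negative {e = e} refl h k = cond-rule {b = e <ʷ 0ʷ}
    (λ eq → rejects (h (proj₁ (≤∞ᵇ-complete _ _ (not-true eq)))))
    (λ eq → skips (k (≤∞ᵇ-sound _ _ (not-false eq))))
    where
    open ExtendedWeights W
    not-true : ∀ {b} → not b ≡ true → b ≡ false
    not-true {false} _ = refl
    not-false : ∀ {b} → not b ≡ false → b ≡ true
    not-false {true} _ = refl

-- Testing and loading edges

private
  pattern edgeᵛ = 5
  pattern kᵛ = 7
  pattern pᵛ = 8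
  pattern qᵛ = 9
  pattern rᵛ = 10
  pattern srcᵛ = 11
  pattern xᵛ = 12
  pattern yᵛ = 13
  pattern zᵛ = 14
  pattern D′ᵛ = 2

markEdges : Cmd
markEdges = for xᵛ < ! order run for pᵛ < deg [ ! xᵛ ] run edgeᵛ [ ! xᵛ ][ nbr [ ! xᵛ ][ ! pᵛ ] ]≔ num 1

module _ {c ℓ₁ ℓ₂ : Level} {W : OrderedAbelianGroup c ℓ₁ ℓ₂} where
  open Store
  open ExtendedWeights W

  -- DPC and Snowball always write the entries at `(a , b)` and `(b , a)` together; this view gives
  -- the value read at `(i , j)` afterwards.
  data TwoWrites {n} (a b : Fin n) (u v : Weight) (m : Matrix n) (i j : Fin n) : Weight → Set c where
    first  : i ≡ a → j ≡ b → TwoWrites a b u v m i j u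
    second : i ≡ b → j ≡ a → TwoWrites a b u v m i j v
    other  : ¬ (i ≡ a × j ≡ b) → ¬ (i ≡ b × j ≡ a) → TwoWrites a b u v m i j (m i j)

  first-write : ∀ {n} A {a b : Fin n} u (s : Store W) {i j} → ¬ (i ≡ a × j ≡ b) →
                weightMatrix A (writeW A (toℕ a) (toℕ b) u s) i j ≡ weightMatrix A s i j
  first-write A {a} {b} u s {i} {j} ne with i Fin.≟ a
  ... | no i≢a   = write-row A (toℕ a) (toℕ b) u (wt s) (i≢a ∘ sym ∘ Fin.toℕ-injective)
  ... | yes refl = write-col A (toℕ a) (toℕ b) u (wt s) (λ e → ne (refl , sym (Fin.toℕ-injective e)))

  two-writes : ∀ {n} A {a b : Fin n} u v (s : Store W) i j →
    TwoWrites a b u v (weightMatrix A s) i j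
      (weightMatrix A (writeW A (toℕ b) (toℕ a) v (writeW A (toℕ a) (toℕ b) u s)) i j)
  two-writes A {a} {b} u v s i j =
    aux (written A (toℕ b) (toℕ a) v (wt (writeW A (toℕ a) (toℕ b) u s)) (toℕ i) (toℕ j))
        refl (written A (toℕ a) (toℕ b) u (wt s) (toℕ i) (toℕ j))
    where
    aux : ∀ {m₁ x y} → Written (toℕ b) (toℕ a) v m₁ (toℕ i) (toℕ j) x → m₁ (toℕ i) (toℕ j) ≡ y →
          Written (toℕ a) (toℕ b) u (wt s A) (toℕ i) (toℕ j) y → TwoWrites a b u v (weightMatrix A s) i j x
    aux (here e e′) _ _ = second (sym (Fin.toℕ-injective e)) (sym (Fin.toℕ-injective e′))
    aux (there ne) refl′ (here e e′) =
      subst (TwoWrites a b u v _ i j) (sym refl′) (first (sym (Fin.toℕ-injective e)) (sym (Fin.toℕ-injective e′)))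
    aux (there ne) refl′ (there ne′) =
      subst (TwoWrites a b u v _ i j) (sym refl′) (other (differs ne′) (differs ne))
      where
      differs : ∀ {a b : Fin _} → toℕ a ≢ toℕ i ⊎ toℕ b ≢ toℕ j → ¬ (i ≡ a × j ≡ b)
      differs (inj₁ h) (refl , refl) = h refl
      differs (inj₂ h) (refl , refl) = h refl

  module _ {n : ℕ} {U : Graph n} (L : AdjacencyLists U) where
    open GraphInput {W = W} L

    -- In DPC the marks serve to show that `addEdge` changes nothing. Recognition also relies on
    -- nonadjacent pairs being unmarked, hence the second conclusion of `markEdges-runs`.
    EdgesMarked : Store W → Set
    EdgesMarked s = ∀ {u v} → Adj U u v → nat s edgeᵛ (toℕ u) (toℕ v) ≡ 1

    markEdges-bound : ℕ
    markEdges-bound = suc (n * 2 + sum degree * 2)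

    markEdges-runs : ∀ {r} {R : Set r} {s} → HoldsGraph s → Runs markEdges s markEdges-bound
      (λ s′ → EdgesMarked s′ × (∀ {u v} → ¬ Adj U u v → nat s′ edgeᵛ (toℕ u) (toℕ v) ≡ nat s edgeᵛ (toℕ u) (toℕ v))) R
    markEdges-runs {R = R} {s₀} hg₀ = weaken ≤-refl
      (λ _ (h , k) → (λ {u} {v} a → h u v (Fin.toℕ<n u) a) , λ {u} {v} → k u v)
      (for-sum n (λ i s → Marked i s × Unmarked s) degree id id 1 2 (proj₁ hg₀) ((λ _ _ ()) , λ _ _ _ → refl) λ x {s₁} ag₁ (h₁ , k₁) →
        let hg₁ = holdsGraph-agree ag₁ refl refl refl hg₀ in weaken ≤-refl
        (λ {s′} _ (h , h′ , k) → (λ u v lt a → cover x s′ h h′ u v (m<1+n⇒m<n∨m≡n lt) a) , k)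
        (for-const (degree x) (λ i s → Marked (toℕ x) s × (∀ v → Seen x i v → nat s edgeᵛ (toℕ x) (toℕ v) ≡ 1) × Unmarked s) 1
          (proj₁ (proj₂ hg₁) x) (h₁ , (λ _ → ⊥-elim ∘ Seen-zero) , k₁)
          λ i {s₂} ag₂ (h₂ , h₂′ , k₂) →
            let hg₂ = holdsGraph-agree ag₂ refl refl refl hg₁
                x≡ = natᶠ ag₂ xᵛ 0 0 refl
            in lastN {i = toℕ x} {j = toℕ (neighbour x i)} {v = 1} x≡
                     (trans (cong (λ x → nat s₂ nbr x (toℕ i)) x≡) (proj₂ (proj₂ hg₂) x i)) refl
               ((λ u v lt a → mark s₂ x (neighbour x i) u v (h₂ u v lt a))
               , (λ v seen → new s₂ x i h₂′ v (Seen-suc i seen))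
               , λ u v ¬a → trans (unmarked s₂ x i u v ¬a) (k₂ u v ¬a))))
      where
      Marked : ℕ → Store W → Set
      Marked i s = ∀ u v → toℕ u < i → Adj U u v → nat s edgeᵛ (toℕ u) (toℕ v) ≡ 1
      Unmarked : Store W → Set
      Unmarked s = ∀ u v → ¬ Adj U u v → nat s edgeᵛ (toℕ u) (toℕ v) ≡ nat s₀ edgeᵛ (toℕ u) (toℕ v)
      unmarked : ∀ s x i u v → ¬ Adj U u v →
                 write edgeᵛ (toℕ x) (toℕ (neighbour x i)) 1 (nat s) edgeᵛ (toℕ u) (toℕ v) ≡ nat s edgeᵛ (toℕ u) (toℕ v)
      unmarked s x i u v ¬a with write edgeᵛ (toℕ x) (toℕ (neighbour x i)) 1 (nat s) edgeᵛ (toℕ u) (toℕ v)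
                               | written edgeᵛ (toℕ x) (toℕ (neighbour x i)) 1 (nat s) (toℕ u) (toℕ v)
      ... | _ | there _   = refl
      ... | _ | here e e′ = contradiction (subst₂ (Adj U) (Fin.toℕ-injective e) (Fin.toℕ-injective e′) (neighbour-adj x i)) ¬a
      mark : ∀ s x y u v → nat s edgeᵛ (toℕ u) (toℕ v) ≡ 1 →
             write edgeᵛ (toℕ x) (toℕ y) 1 (nat s) edgeᵛ (toℕ u) (toℕ v) ≡ 1
      mark s x y u v h with write edgeᵛ (toℕ x) (toℕ y) 1 (nat s) edgeᵛ (toℕ u) (toℕ v)
                          | written edgeᵛ (toℕ x) (toℕ y) 1 (nat s) (toℕ u) (toℕ v)
      ... | _ | here _ _ = refl
      ... | _ | there _  = h
      new : ∀ s x i → (∀ v → Seen x (toℕ i) v → nat s edgeᵛ (toℕ x) (toℕ v) ≡ 1) →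
            ∀ v → Seen x (toℕ i) v ⊎ neighbour x i ≡ v →
            write edgeᵛ (toℕ x) (toℕ (neighbour x i)) 1 (nat s) edgeᵛ (toℕ x) (toℕ v) ≡ 1
      new s x i h v (inj₁ seen) = mark s x (neighbour x i) x v (h v seen)
      new s x i h v (inj₂ refl) = write-same edgeᵛ (toℕ x) (toℕ (neighbour x i)) 1 (nat s)
      cover : ∀ x s → Marked (toℕ x) s → (∀ v → Seen x (degree x) v → nat s edgeᵛ (toℕ x) (toℕ v) ≡ 1) →
              ∀ u v → toℕ u < toℕ x ⊎ toℕ u ≡ toℕ x → Adj U u v → nat s edgeᵛ (toℕ u) (toℕ v) ≡ 1
      cover x s h h′ u v (inj₁ lt) a = h u v lt a
      cover x s h h′ u v (inj₂ eq) a with refl ← Fin.toℕ-injective eq = h′ v (Seen-all a)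

    loadEdges-bound : ℕ
    loadEdges-bound = suc (n * suc (suc (n * 2))) + markEdges-bound

    loadEdges-runs : ∀ {r} {R : Set r} {s} → HoldsGraph s → Runs loadEdges s loadEdges-bound EdgesMarked R
    loadEdges-runs {R = R} {s} hg =
      for-const n (λ _ _ → ⊤) (suc (n * 2)) (proj₁ hg) tt (λ x ag _ →
        for-const n (λ _ _ → ⊤) 1 (trans (natᶠ ag order 0 0 refl) (proj₁ hg)) tt
          λ y _ _ → lastN {Q = λ _ → ⊤} refl refl refl tt)
      then λ {s₀} ag₀ _ → weaken ≤-refl (λ _ → proj₁) (markEdges-runs (holdsGraph-agree ag₀ refl refl refl hg))

  module _ {n : ℕ} (G : WeightedDigraph W n) (L : AdjacencyLists (skeleton G)) where
    open WeightedDigraph G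
    open GraphInput {W = W} L

    private
      U = skeleton G

    arc⇒adj : ∀ {i j a} → weight i j ≡ just a → Adj U i j
    arc⇒adj {i} {j} e rewrite e = _

    HoldsWeights : Store W → Set c
    HoldsWeights s = ∀ i j → weightMatrix w s i j ≡ weight i j

    testEdges-bound : ℕ
    testEdges-bound = suc (n * 2 + sum degree * 4)

    -- A rejected pair of antiparallel arcs is itself a closed path of negative weight.
    testEdges-runs : ∀ {s} → HoldsGraph s → HoldsWeights s →
                     Runs testEdges s testEdges-bound (λ _ → NoNegativePair G) (NegativeCycle G)
    testEdges-runs {s} hg hw = weaken ≤-refl (λ _ h {i} {j} → conclude h {i} {j})
      (for-sum n (λ i _ → ∀ v → toℕ v < i → ∀ u → Adj U v u → 𝟘 ≤∞ weight v u ⊕ weight u v)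
        degree id id 1 4 (proj₁ hg) (λ _ ())
        λ v {s₁} ag h → weaken ≤-refl (λ _ h′ v′ lt u a → cover v h h′ v′ (m<1+n⇒m<n∨m≡n lt) u a)
          (neighbours-rule v (λ i _ → ∀ u → Seen v i u → 𝟘 ≤∞ weight v u ⊕ weight u v) 2 refl refl refl
            (holdsGraph-agree ag refl refl refl hg)
            (λ ag′ _ → holdsGraph-agree ag′ refl refl refl (holdsGraph-agree ag refl refl refl hg))
            refl (λ u → ⊥-elim ∘ Seen-zero)
            λ i {s₂} ag′ h′ →
              let u = neighbour v i
                  v≡ = natᶠ ag′ xᵛ 0 0 refl
                  ω≡ = λ i j → trans (wtᶠ ag′ w (toℕ i) (toℕ j) refl) (trans (wtᶠ ag w (toℕ i) (toℕ j) refl) (hw i j))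
              in reject-if-negative {R = NegativeCycle G}
                (trans (cong (λ x → wt s₂ w x (toℕ u) ⊕ wt s₂ w (toℕ u) x) v≡) (cong₂ _⊕_ (ω≡ v u) (ω≡ u v)))
                (negative⇒cycle G v (weight v u ⊕ weight u v)
                  (realised-⊕ G (weight v u) (weight u v) (realised-weight G v u) (realised-weight G u v)))
                λ nneg u′ seen → case-seen v i h′ nneg u′ (Seen-suc i seen)))
      where
      case-seen : ∀ v i → (∀ u → Seen v (toℕ i) u → 𝟘 ≤∞ weight v u ⊕ weight u v) →
                  let u = neighbour v i in 𝟘 ≤∞ weight v u ⊕ weight u v →
                  ∀ u′ → Seen v (toℕ i) u′ ⊎ neighbour v i ≡ u′ → 𝟘 ≤∞ weight v u′ ⊕ weight u′ v
      case-seen v i h nneg u′ (inj₁ s)    = h u′ s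
      case-seen v i h nneg u′ (inj₂ refl) = nneg
      cover : ∀ v → (∀ v′ → toℕ v′ < toℕ v → ∀ u → Adj U v′ u → 𝟘 ≤∞ weight v′ u ⊕ weight u v′) →
              (∀ u → Seen v (degree v) u → 𝟘 ≤∞ weight v u ⊕ weight u v) →
              ∀ v′ → toℕ v′ < toℕ v ⊎ toℕ v′ ≡ toℕ v → ∀ u → Adj U v′ u → 𝟘 ≤∞ weight v′ u ⊕ weight u v′
      cover v h h′ v′ (inj₁ lt) u a = h v′ lt u a
      cover v h h′ v′ (inj₂ eq) u a with refl ← Fin.toℕ-injective eq = h′ u (Seen-all a)
      conclude : (∀ v → toℕ v < n → ∀ u → Adj U v u → 𝟘 ≤∞ weight v u ⊕ weight u v) → NoNegativePair G
      conclude h {i} {j} e e′ with ≤∞-fin le ← subst₂ (λ x y → 𝟘 ≤∞ x ⊕ y) e e′ (h i (Fin.toℕ<n i) j (arc⇒adj e)) = le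

    noNegativePair⇒nonneg : NoNegativePair G → ∀ i j → 𝟘 ≤∞ weight i j ⊕ weight j i
    noNegativePair⇒nonneg h i j with weight i j in e | weight j i in e′
    ... | nothing | _       = ≤∞-top
    ... | just a  | nothing = ≤∞-top
    ... | just a  | just b  = ≤∞-fin (h e e′)

-- Directed path consistency

private
  -- These are the nested parts of `dpc` up to definitional unfolding; naming them gives each level
  -- of the loop nest its own specification.
  dpcTest dpcRelax dpcVisit-y dpcVisit-x dpcVisit-z : Cmd
  dpcTest    = when w ⟦ ! xᵛ ⟧⟦ ! yᵛ ⟧ ⊞ w ⟦ ! yᵛ ⟧⟦ ! xᵛ ⟧ <ʷ 0ʷ then reject
  dpcRelax   = (w ⟦ ! xᵛ ⟧⟦ ! yᵛ ⟧≔ w ⟦ ! xᵛ ⟧⟦ ! yᵛ ⟧ ⊓ᵉ w ⟦ ! xᵛ ⟧⟦ ! zᵛ ⟧ ⊞ w ⟦ ! zᵛ ⟧⟦ ! yᵛ ⟧) ⨾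
               (w ⟦ ! yᵛ ⟧⟦ ! xᵛ ⟧≔ w ⟦ ! yᵛ ⟧⟦ ! xᵛ ⟧ ⊓ᵉ w ⟦ ! yᵛ ⟧⟦ ! zᵛ ⟧ ⊞ w ⟦ ! zᵛ ⟧⟦ ! xᵛ ⟧) ⨾
               addEdge ⨾ dpcTest
  dpcVisit-y = when pos [ ! yᵛ ] <ᵉ ! kᵛ then when pos [ ! xᵛ ] <ᵉ pos [ ! yᵛ ] then dpcRelax
  dpcVisit-x = when pos [ ! xᵛ ] <ᵉ ! kᵛ then
                 for qᵛ < deg [ ! zᵛ ] run ((yᵛ ≔ nbr [ ! zᵛ ][ ! qᵛ ]) ⨾ dpcVisit-y)
  dpcVisit-z = for pᵛ < deg [ ! zᵛ ] run ((xᵛ ≔ nbr [ ! zᵛ ][ ! pᵛ ]) ⨾ dpcVisit-x)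

module _ {c ℓ₁ ℓ₂ : Level} {W : OrderedAbelianGroup c ℓ₁ ℓ₂} {n : ℕ}
         (G : WeightedDigraph W n) (L : AdjacencyLists (skeleton G))
         (d : Permutation′ n) (perfect : Perfect (skeleton G) d) where
  open Store
  open ExtendedWeights W
  open WeightedDigraph G
  open GraphInput {W = W} L

  private
    U = skeleton G
    π = position U d
    π-injective = position-injective U d

    clique : EarlierNeighboursAdjacent U d
    clique = perfect-elim U d perfect

    weights : Store W → Matrix n
    weights = weightMatrix w

    relaxed : ∀ (m : ℕ → ℕ → Weight) {a b c a′ b′ c′} → a ≡ a′ → b ≡ b′ → c ≡ c′ →
              m a b ⊓∞ (m a c ⊕ m c b) ≡ m a′ b′ ⊓∞ (m a′ c′ ⊕ m c′ b′)
    relaxed m refl refl refl = refl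

  π-vertex : ∀ k → π (d ⟨$⟩ˡ k) ≡ toℕ k
  π-vertex k = cong toℕ (inverseʳ d)

  Context : Store W → Set
  Context s = HoldsGraph s × HoldsOrdering d s × EdgesMarked L s

  Bypassable : Fin n → Fin n → Fin n → Set
  Bypassable i j k = π i < π k × π j < π k × Adj U i k × Adj U j k × i ≢ j

  -- `nonneg` is conditional because DPC does not test the pairs that it leaves alone. `realised`
  -- holds on any input, so a rejection always exhibits a negative cycle.
  record Relaxing (goal : Fin n → Fin n → Fin n → Set) (ω : Matrix n) : Set (c ⊔ˡ ℓ₁ ⊔ˡ ℓ₂) where
    field
      realised : ∀ i j → Realised G i j (ω i j)
      below    : ∀ i j → ω i j ≤∞ weight i j
      bypass   : ∀ {i j k} → goal i j k → ω i j ≤∞ ω i k ⊕ ω k j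
      nonneg   : NoNegativePair G → ∀ i j → 𝟘 ≤∞ ω i j ⊕ ω j i
  open Relaxing

  Relaxing-map : ∀ {g g′ ω} → (∀ {i j k} → g′ i j k → g i j k) → Relaxing g ω → Relaxing g′ ω
  Relaxing-map f R = record
    { realised = realised R ; below = below R ; bypass = bypass R ∘ f ; nonneg = nonneg R }

  Relaxed : Store W → Set (c ⊔ˡ ℓ₁ ⊔ˡ ℓ₂)
  Relaxed s = Context s × Relaxing Bypassable (weights s)

  private
    -- The pairs already relaxed when z, at position n - 1 - t, is visited: all
    -- those below later vertices, and S among those below z.
    Goal : ℕ → Fin n → (Fin n → Fin n → Set) → Fin n → Fin n → Fin n → Set
    Goal t z S i j k = Bypassable i j k × (n ≤ π k + t ⊎ (k ≡ z × (S i j ⊎ S j i)))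

    Inv : ℕ → Fin n → (Fin n → Fin n → Set) → Store W → Set (c ⊔ˡ ℓ₁ ⊔ˡ ℓ₂)
    Inv t z S s = Context s × Relaxing (Goal t z S) (weights s)

    Inv-map : ∀ {t z S S′} s → (∀ {a b} → π a < π z → π b < π z → Adj U a z → Adj U b z → S′ a b → S a b) →
              Inv t z S s → Inv t z S′ s
    Inv-map {t} {z} {S} {S′} s f (ctx , R) = ctx , Relaxing-map goal R
      where
      goal : ∀ {i j k} → Goal t z S′ i j k → Goal t z S i j k
      goal (b , inj₁ h) = b , inj₁ h
      goal (b@(i<k , j<k , i~k , j~k , _) , inj₂ (refl , inj₁ h)) = b , inj₂ (refl , inj₁ (f i<k j<k i~k j~k h))
      goal (b@(i<k , j<k , i~k , j~k , _) , inj₂ (refl , inj₂ h)) = b , inj₂ (refl , inj₂ (f j<k i<k j~k i~k h))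

    module Relax {x y z : Fin n} (x<y : π x < π y) (y<z : π y < π z) {t : ℕ} (z≡ : π z + suc t ≡ n)
                 {S : Fin n → Fin n → Set} {ω : Matrix n} (R : Relaxing (Goal t z S) ω) where

      x≢y : x ≢ y
      x≢y refl = <-irrefl refl x<y

      u v : Weight
      u = ω x y ⊓∞ (ω x z ⊕ ω z y)
      v = ω y x ⊓∞ (ω y z ⊕ ω z x)

      module _ (ω′ : Matrix n) (tw : ∀ i j → TwoWrites {W = W} x y u v ω i j (ω′ i j)) where

        decreasing : ∀ i j → ω′ i j ≤∞ ω i j
        decreasing i j with ω′ i j | tw i j
        ... | _ | first refl refl  = ⊓∞-≤ˡ (ω i j) (ω i z ⊕ ω z j)
        ... | _ | second refl refl = ⊓∞-≤ˡ (ω i j) (ω i z ⊕ ω z j)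
        ... | _ | other _ _        = ≤∞-refl

        at-xy : ω′ x y ≡ u
        at-xy with ω′ x y | tw x y
        ... | _ | first _ _  = refl
        ... | _ | second e _ = contradiction e x≢y
        ... | _ | other ne _ = contradiction (refl , refl) ne

        at-yx : ω′ y x ≡ v
        at-yx with ω′ y x | tw y x
        ... | _ | first e _  = contradiction (sym e) x≢y
        ... | _ | second _ _ = refl
        ... | _ | other _ ne = contradiction (refl , refl) ne

        -- Relaxing at `z` writes only between vertices before `z`, so the right-hand sides of all
        -- bypasses at `z` and at later vertices persist.
        unchanged : ∀ {i j} → π z ≤ π i ⊎ π z ≤ π j → ω′ i j ≡ ω i j
        unchanged {i} {j} h with ω′ i j | tw i j | h
        ... | _ | first refl refl  | inj₁ le = contradiction (<-trans x<y y<z) (≤⇒≯ le)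
        ... | _ | first refl refl  | inj₂ le = contradiction y<z (≤⇒≯ le)
        ... | _ | second refl refl | inj₁ le = contradiction y<z (≤⇒≯ le)
        ... | _ | second refl refl | inj₂ le = contradiction (<-trans x<y y<z) (≤⇒≯ le)
        ... | _ | other _ _        | _       = refl

        realised′ : ∀ i j → Realised G i j (ω′ i j)
        realised′ i j with ω′ i j | tw i j
        ... | _ | first refl refl  = realised-⊓ G (ω i j) (ω i z ⊕ ω z j) (realised R i j) (realised-⊕ G (ω i z) (ω z j) (realised R i z) (realised R z j))
        ... | _ | second refl refl = realised-⊓ G (ω i j) (ω i z ⊕ ω z j) (realised R i j) (realised-⊕ G (ω i z) (ω z j) (realised R i z) (realised R z j))
        ... | _ | other _ _        = realised R i j

        old : ∀ {i j k} → π z ≤ π k → ω i j ≤∞ ω i k ⊕ ω k j → ω′ i j ≤∞ ω′ i k ⊕ ω′ k j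
        old {i} {j} {k} z≤k h = ≤∞-trans (decreasing i j) (≤∞-trans h
          (≤∞-reflexive (sym (cong₂ _⊕_ (unchanged {i} {k} (inj₂ z≤k)) (unchanged {k} {j} (inj₁ z≤k))))))

        later : ∀ {k} → n ≤ π k + t → π z ≤ π k
        later {k} le = <⇒≤ (+-cancelʳ-< t (π z) (π k) (subst (_≤ π k + t) (trans (sym z≡) (+-suc (π z) t)) le))

        bypass-xy : ω′ x y ≤∞ ω′ x z ⊕ ω′ z y
        bypass-xy = ≤∞-trans (≤∞-reflexive at-xy) (≤∞-trans (⊓∞-≤ʳ (ω x y) (ω x z ⊕ ω z y))
          (≤∞-reflexive (sym (cong₂ _⊕_ (unchanged {x} {z} (inj₂ ≤-refl)) (unchanged {z} {y} (inj₁ ≤-refl))))))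

        bypass-yx : ω′ y x ≤∞ ω′ y z ⊕ ω′ z x
        bypass-yx = ≤∞-trans (≤∞-reflexive at-yx) (≤∞-trans (⊓∞-≤ʳ (ω y x) (ω y z ⊕ ω z x))
          (≤∞-reflexive (sym (cong₂ _⊕_ (unchanged {y} {z} (inj₂ ≤-refl)) (unchanged {z} {x} (inj₁ ≤-refl))))))

        bypass′ : ∀ {i j k} → Goal t z (λ a b → S a b ⊎ (a ≡ x × b ≡ y)) i j k → ω′ i j ≤∞ ω′ i k ⊕ ω′ k j
        bypass′ (b , inj₁ le)                                = old (later le) (bypass R (b , inj₁ le))
        bypass′ (b , inj₂ (refl , inj₁ (inj₁ h)))            = old ≤-refl (bypass R (b , inj₂ (refl , inj₁ h)))
        bypass′ (b , inj₂ (refl , inj₂ (inj₁ h)))            = old ≤-refl (bypass R (b , inj₂ (refl , inj₂ h)))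
        bypass′ (b , inj₂ (refl , inj₁ (inj₂ (refl , refl)))) = bypass-xy
        bypass′ (b , inj₂ (refl , inj₂ (inj₂ (refl , refl)))) = bypass-yx

        nonneg′ : 𝟘 ≤∞ ω′ x y ⊕ ω′ y x → NoNegativePair G → ∀ i j → 𝟘 ≤∞ ω′ i j ⊕ ω′ j i
        nonneg′ xy h i j with i Fin.≟ x ×-dec j Fin.≟ y | i Fin.≟ y ×-dec j Fin.≟ x
        ... | yes (refl , refl) | _ = xy
        ... | no _ | yes (refl , refl) = ≤∞-trans xy (⊕-comm (ω′ x y) (ω′ y x))
        ... | no ne | no ne′ = ≤∞-trans (nonneg R h i j) (≤∞-reflexive (sym (cong₂ _⊕_ (same ne ne′)
                                 (same (λ (e , e′) → ne′ (e′ , e)) (λ (e , e′) → ne (e′ , e))))))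
          where
          same : ∀ {i j} → ¬ (i ≡ x × j ≡ y) → ¬ (i ≡ y × j ≡ x) → ω′ i j ≡ ω i j
          same {i} {j} ne ne′ with ω′ i j | tw i j
          ... | _ | first e e′  = contradiction (e , e′) ne
          ... | _ | second e e′ = contradiction (e , e′) ne′
          ... | _ | other _ _   = refl

    dpcRelax-runs : ∀ {s x y z t S} → nat s xᵛ 0 0 ≡ toℕ x → nat s yᵛ 0 0 ≡ toℕ y → nat s zᵛ 0 0 ≡ toℕ z →
      Adj U x z → Adj U y z → π x < π y → π y < π z → π z + suc t ≡ n → Inv t z S s →
      Runs dpcRelax s 6 (Inv t z (λ a b → S a b ⊎ (a ≡ x × b ≡ y))) (NegativeCycle G)
    dpcRelax-runs {s} {x} {y} {z} {t} {S} x≡ y≡ z≡ x~z y~z x<y y<z zt (ctx@(_ , _ , marked) , R) =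
      assignW {i = toℕ x} {toℕ y} {u} x≡ y≡ (relaxed (wt s w) x≡ y≡ z≡)
      (assignW {i = toℕ y} {toℕ x} {v} y≡ x≡
        -- The second assignment reads no entry written by the first, so its value can be expressed
        -- by the old matrix `ω`.
        (trans (relaxed (wt s₁ w) y≡ x≡ z≡)
          (cong₂ _⊓∞_ (first-write w {x} {y} u s (λ (e , _) → x≢y (sym e)))
            (cong₂ _⊕_ (first-write w {x} {y} u s (λ (e , _) → x≢y (sym e)))
                       (first-write w {x} {y} u s (λ (e , _) → <-irrefl (cong π (sym e)) (<-trans x<y y<z))))))
        -- By perfectness `x` and `y` are adjacent already, so `addEdge` falls through and leaves
        -- the store as it was.
        (skip-addEdge then λ { _ refl →
          reject-if-negative {e = w ⟦ ! xᵛ ⟧⟦ ! yᵛ ⟧ ⊞ w ⟦ ! yᵛ ⟧⟦ ! xᵛ ⟧} {s = s₂}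
            (cong₂ (λ a b → wt s₂ w a b ⊕ wt s₂ w b a) x≡ y≡)
            (negative⇒cycle G x (ω′ x y ⊕ ω′ y x)
              (realised-⊕ G (ω′ x y) (ω′ y x) (realised′ ω′ tw x y) (realised′ ω′ tw y x)))
            λ h → ctx , record { realised = realised′ ω′ tw
                               ; below = λ i j → ≤∞-trans (decreasing ω′ tw i j) (below R i j)
                               ; bypass = bypass′ ω′ tw ; nonneg = nonneg′ ω′ tw h } }))
      where
      open Relax x<y y<z zt R
      s₁ = writeW w (toℕ x) (toℕ y) u s
      s₂ = writeW w (toℕ y) (toℕ x) v s₁
      ω′ = weights s₂
      tw = two-writes {W = W} w {x} {y} u v s
      edge≡1 : nat s₂ edgeᵛ (nat s₂ xᵛ 0 0) (nat s₂ yᵛ 0 0) ≡ 1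
      edge≡1 = trans (cong₂ (nat s edgeᵛ) x≡ y≡) (marked (clique x~z y~z (<-trans x<y y<z) y<z x≢y))
      skip-addEdge : Runs addEdge s₂ 2 (_≡ s₂) (NegativeCycle G)
      skip-addEdge = if-≡ refl refl (λ e → contradiction (trans (sym edge≡1) e) λ ()) (λ _ → skips refl)

    module _ {t : ℕ} {z : Fin n} (z≡ : π z + suc t ≡ n) where

      -- Pairs are listed with the earlier vertex first, the order in which the program accepts
      -- them. `Goal` closes them under symmetry, since one relaxation treats both directions.
      S-x : ℕ → Fin n → Fin n → Set
      S-x p a b = π a < π b × Seen z p a

      S-y : ℕ → Fin n → ℕ → Fin n → Fin n → Set
      S-y p x q a b = π a < π b × (Seen z p a ⊎ (a ≡ x × Seen z q b))

      dpcVisit-y-runs : ∀ {s p x q} → let y = neighbour z q in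
        nat s xᵛ 0 0 ≡ toℕ x → nat s yᵛ 0 0 ≡ toℕ y → nat s zᵛ 0 0 ≡ toℕ z → nat s kᵛ 0 0 ≡ π z → Adj U x z → π x < π z →
        Inv t z (S-y p x (toℕ q)) s →
        Runs dpcVisit-y s 8 (Inv t z (S-y p x (suc (toℕ q)))) (NegativeCycle G)
      dpcVisit-y-runs {s} {p} {x} {q} hx hy hz hk x~z x<z inv@((_ , (hpos , _) , _) , _) =
        if-< (trans (cong (λ v → nat s pos v 0) hy) (hpos y)) hk
          (λ y<z → if-< (trans (cong (λ v → nat s pos v 0) hx) (hpos x)) (trans (cong (λ v → nat s pos v 0) hy) (hpos y))
            (λ x<y → weaken ≤-refl (λ {s′} _ → Inv-map s′ λ a<z b<z a~z b~z (a<b , h) → done a<b h (λ e → e))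
              (dpcRelax-runs hx hy hz x~z (Adj-sym U (neighbour-adj z q)) x<y y<z z≡ inv))
            (λ y≤x → skips (Inv-map s (λ a<z b<z a~z b~z (a<b , h) →
               nothing-new a<b h λ { (refl , refl) → <-irrefl refl (<-≤-trans a<b y≤x) }) inv)))
          (λ z≤y → skips (Inv-map s (λ a<z b<z a~z b~z (a<b , h) →
             nothing-new a<b h λ { (_ , refl) → <-irrefl refl (<-≤-trans b<z z≤y) }) inv))
        where
        y = neighbour z q
        done : ∀ {a b} {X : Set} → π a < π b → Seen z p a ⊎ (a ≡ x × Seen z (suc (toℕ q)) b) →
               (a ≡ x × b ≡ y → X) → S-y p x (toℕ q) a b ⊎ X
        done a<b (inj₁ h) f = inj₁ (a<b , inj₁ h)
        done a<b (inj₂ (e , h)) f with Seen-suc q h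
        ... | inj₁ h′ = inj₁ (a<b , inj₂ (e , h′))
        ... | inj₂ e′ = inj₂ (f (e , sym e′))
        nothing-new : ∀ {a b} → π a < π b → Seen z p a ⊎ (a ≡ x × Seen z (suc (toℕ q)) b) →
                      ¬ (a ≡ x × b ≡ y) → S-y p x (toℕ q) a b
        nothing-new a<b h f with done a<b h f
        ... | inj₁ h = h

      dpcVisit-x-runs : ∀ {s p} → let x = neighbour z p in
        nat s xᵛ 0 0 ≡ toℕ x → nat s zᵛ 0 0 ≡ toℕ z → nat s kᵛ 0 0 ≡ π z → Inv t z (S-x (toℕ p)) s →
        Runs dpcVisit-x s (suc (suc (degree z * 10))) (Inv t z (S-x (suc (toℕ p)))) (NegativeCycle G)
      dpcVisit-x-runs {s} {p} hx hz hk inv@((hg , (hpos , _) , _) , _) =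
        if-< (trans (cong (λ v → nat s pos v 0) hx) (hpos x)) hk
          (λ x<z → weaken ≤-refl (λ {s′} _ → Inv-map s′ done)
            (neighbours-rule z (λ q → Inv t z (S-y (toℕ p) x q)) 8 refl refl refl hg (λ _ h → proj₁ (proj₁ h)) hz
              (Inv-map s (λ { _ _ _ _ (a<b , inj₁ h) → a<b , h ; _ _ _ _ (a<b , inj₂ (_ , h)) → ⊥-elim (Seen-zero h) }) inv)
              λ q ag inv′ → dpcVisit-y-runs {s = _} {p = toℕ p} {x} {q = q} (trans (natᶠ ag xᵛ 0 0 refl) hx) refl
                              (trans (natᶠ ag zᵛ 0 0 refl) hz) (trans (natᶠ ag kᵛ 0 0 refl) hk)
                              (Adj-sym U (neighbour-adj z p)) x<z inv′))
          (λ z≤x → skips (Inv-map s (λ a<z _ _ _ (a<b , h) → a<b , skip-x a<z z≤x (Seen-suc p h)) inv))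
        where
        x = neighbour z p
        done : ∀ {a b} → π a < π z → π b < π z → Adj U a z → Adj U b z → S-x (suc (toℕ p)) a b →
               S-y (toℕ p) x (degree z) a b
        done _ _ _ b~z (a<b , h) with Seen-suc p h
        ... | inj₁ h′ = a<b , inj₁ h′
        ... | inj₂ e  = a<b , inj₂ (sym e , Seen-all (Adj-sym U b~z))
        skip-x : ∀ {a} → π a < π z → π z ≤ π x → Seen z (toℕ p) a ⊎ x ≡ a → Seen z (toℕ p) a
        skip-x a<z z≤x (inj₁ h)    = h
        skip-x a<z z≤x (inj₂ refl) = contradiction a<z (≤⇒≯ z≤x)

      dpcVisit-z-runs : ∀ {s} → nat s zᵛ 0 0 ≡ toℕ z → nat s kᵛ 0 0 ≡ π z → Inv t z (λ _ _ → ⊥) s →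
        Runs dpcVisit-z s (suc (degree z * (4 + n * 10))) (Inv t z (λ a b → π a < π b)) (NegativeCycle G)
      dpcVisit-z-runs {s} hz hk inv@((hg , _) , _) = weaken
        -- Of the two nested loops over the neighbours of `z`, one is bounded by `n`; the other
        -- keeps its degree, to be summed over all `z`.
        (s≤s (*-monoʳ-≤ (degree z) (+-monoʳ-≤ 4 (*-monoˡ-≤ 10 (degree≤n z)))))
        (λ {s′} _ → Inv-map s′ λ _ _ a~z _ a<b → a<b , Seen-all (Adj-sym U a~z))
        (neighbours-rule z (λ p → Inv t z (S-x p)) (suc (suc (degree z * 10))) refl refl refl hg
          (λ _ h → proj₁ (proj₁ h)) hz (Inv-map s (λ { _ _ _ _ (_ , h) → Seen-zero h }) inv)
          λ p ag inv′ → dpcVisit-x-runs {p = p} refl (trans (natᶠ ag zᵛ 0 0 refl) hz) (trans (natᶠ ag kᵛ 0 0 refl) hk) inv′)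

  dpc-bound : ℕ
  dpc-bound = loadEdges-bound {W = W} L + suc (n * 4 + sum degree * (4 + n * 10))

  dpc-runs : ∀ {s} → HoldsGraph s → HoldsOrdering d s → HoldsWeights G L s →
             Runs dpc s dpc-bound Relaxed (NegativeCycle G)
  dpc-runs {s} hg ho hw = loadEdges-runs L hg then λ {s₀} ag marked →
    let hg₀ = holdsGraph-agree ag refl refl refl hg
        ho₀ = (λ v → trans (natᶠ ag pos (toℕ v) 0 refl) (proj₁ ho v)) , (λ k → trans (natᶠ ag vert (toℕ k) 0 refl) (proj₂ ho k))
        hw₀ = λ i j → trans (wtᶠ ag w (toℕ i) (toℕ j) refl) (hw i j)
    in weaken ≤-refl (λ _ (ctx , R) → ctx , Relaxing-map (λ b → b , m≤n+m n _) R)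
       (for-sum n (λ t s → Context s × Relaxing (λ i j k → Bypassable i j k × n ≤ π k + t) (weights s))
         degree vertex vertex-injective 3 (4 + n * 10) (proj₁ hg₀)
         ((hg₀ , ho₀ , marked) , initially s₀ hw₀)
         λ t {s₁} _ ((hg₁ , ho₁ , marked₁) , R) →
           let k = Fin.opposite t
               z = vertex t
               k≡ = trans (cong (_∸ suc (toℕ t)) (proj₁ hg₁)) (sym (Fin.opposite-prop t))
           in assignN refl refl k≡ (assignN refl refl (proj₂ ho₁ k)
             (weaken ≤-refl (λ _ (ctx , R′) → ctx , Relaxing-map (advance t) R′)
               (dpcVisit-z-runs {t = toℕ t} {z} (z≡ t) refl (sym (π-vertex k))
                 ((hg₁ , ho₁ , marked₁) , Relaxing-map (λ { (b , inj₁ h) → b , h ; (_ , inj₂ (_ , inj₁ ())) ; (_ , inj₂ (_ , inj₂ ())) }) R)))))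
    where
    vertex : Fin n → Fin n
    vertex t = d ⟨$⟩ˡ Fin.opposite t
    vertex-injective : Injective _≡_ _≡_ vertex
    vertex-injective {i} {j} e = trans (sym (Fin.opposite-involutive i))
      (trans (cong Fin.opposite (trans (sym (inverseʳ d)) (trans (cong (d ⟨$⟩ʳ_) e) (inverseʳ d)))) (Fin.opposite-involutive j))
    z≡ : ∀ t → π (vertex t) + suc (toℕ t) ≡ n
    z≡ t = trans (cong (_+ suc (toℕ t)) (trans (π-vertex (Fin.opposite t)) (Fin.opposite-prop t))) (m∸n+n≡m (Fin.toℕ<n t))
    advance : ∀ t {i j k} → Bypassable i j k × n ≤ π k + suc (toℕ t) → Goal (toℕ t) (vertex t) (λ a b → π a < π b) i j k
    advance t {i} {j} {k} (b@(_ , _ , _ , _ , i≢j) , le) with m≤n⇒m<n∨m≡n le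
    ... | inj₁ lt = b , inj₁ (s≤s⁻¹ (subst (n <_) (+-suc (π k) (toℕ t)) lt))
    ... | inj₂ eq with <-cmp (π i) (π j)
    ...   | tri< lt _ _ = b , inj₂ (π-injective (+-cancelʳ-≡ (suc (toℕ t)) _ _ (trans (sym eq) (sym (z≡ t)))) , inj₁ lt)
    ...   | tri> _ _ gt = b , inj₂ (π-injective (+-cancelʳ-≡ (suc (toℕ t)) _ _ (trans (sym eq) (sym (z≡ t)))) , inj₂ gt)
    ...   | tri≈ _ e _  = contradiction (π-injective e) i≢j
    initially : ∀ s → HoldsWeights G L s → Relaxing (λ i j k → Bypassable i j k × n ≤ π k + 0) (weights s)
    initially s hw = record
      { realised = λ i j → subst (Realised G i j) (sym (hw i j)) (realised-weight G i j)
      ; below    = λ i j → ≤∞-reflexive (hw i j)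
      ; bypass   = λ {i} {j} {k} (_ , le) → contradiction (subst (n ≤_) (+-identityʳ (π k)) le) (<⇒≱ (Fin.toℕ<n _))
      ; nonneg   = λ h i j → ≤∞-trans (noNegativePair⇒nonneg G L h i j) (≤∞-reflexive (sym (cong₂ _⊕_ (hw i j) (hw j i))))
      }

-- Snowball

private
  growRelax growVisit-x growVisit-z growTail : Cmd
  growRelax   = (D ⟦ ! yᵛ ⟧⟦ ! zᵛ ⟧≔ D ⟦ ! yᵛ ⟧⟦ ! zᵛ ⟧ ⊓ᵉ D ⟦ ! yᵛ ⟧⟦ ! xᵛ ⟧ ⊞ w ⟦ ! xᵛ ⟧⟦ ! zᵛ ⟧) ⨾
                (D ⟦ ! zᵛ ⟧⟦ ! yᵛ ⟧≔ D ⟦ ! zᵛ ⟧⟦ ! yᵛ ⟧ ⊓ᵉ w ⟦ ! zᵛ ⟧⟦ ! xᵛ ⟧ ⊞ D ⟦ ! xᵛ ⟧⟦ ! yᵛ ⟧)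
  growVisit-x = when pos [ ! xᵛ ] <ᵉ ! kᵛ then
                  for rᵛ < ! kᵛ run ((yᵛ ≔ vert [ ! rᵛ ]) ⨾ growRelax)
  growVisit-z = for pᵛ < deg [ ! zᵛ ] run ((xᵛ ≔ nbr [ ! zᵛ ][ ! pᵛ ]) ⨾ growVisit-x)
  growTail    = (for xᵛ < ! order run for yᵛ < ! order run D ⟦ ! xᵛ ⟧⟦ ! yᵛ ⟧≔ ∞ʷ) ⨾
                (for xᵛ < ! order run D ⟦ ! xᵛ ⟧⟦ ! xᵛ ⟧≔ 0ʷ) ⨾
                (for kᵛ < ! order run ((zᵛ ≔ vert [ ! kᵛ ]) ⨾ growVisit-z))

APSPSolution : ∀ {c ℓ₁ ℓ₂} {W : OrderedAbelianGroup c ℓ₁ ℓ₂} {n} → WeightedDigraph W n → Store W → Set (c ⊔ˡ ℓ₁ ⊔ˡ ℓ₂)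
APSPSolution G s = NoNegativePair G → ¬ NegativeCycle G × (∀ i j → IsDistance G i j (weightMatrix D s i j))

module _ {c ℓ₁ ℓ₂ : Level} {W : OrderedAbelianGroup c ℓ₁ ℓ₂} {n : ℕ}
         (G : WeightedDigraph W n) (L : AdjacencyLists (skeleton G))
         (d : Permutation′ n) (perfect : Perfect (skeleton G) d) where
  open Store
  open ExtendedWeights W
  open WeightedDigraph G
  open GraphInput {W = W} L

  private
    U = skeleton G
    π = position U d
    π-injective = position-injective U d

    clique : EarlierNeighboursAdjacent U d
    clique = perfect-elim U d perfect

    weights distance : Store W → Matrix n
    weights  = weightMatrix w
    distance = weightMatrix D

  HoldsOrderedGraph : Store W → Set
  HoldsOrderedGraph s = HoldsGraph s × HoldsOrdering d s

  holdsOrderedGraph-agree : ∀ {p s s′} → Agree p s s′ → modifiesN p order ≡ false → modifiesN p deg ≡ false →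
    modifiesN p nbr ≡ false → modifiesN p pos ≡ false → modifiesN p vert ≡ false →
    HoldsOrderedGraph s → HoldsOrderedGraph s′
  holdsOrderedGraph-agree ag e₀ e₁ e₂ e₃ e₄ (hg , hp , hv) = holdsGraph-agree ag e₀ e₁ e₂ hg ,
    (λ v → trans (natᶠ ag pos (toℕ v) 0 e₃) (hp v)) , (λ k → trans (natᶠ ag vert (toℕ k) 0 e₄) (hv k))

  private
    module _ (ω : Matrix n) (ω-realised : ∀ i j → Realised G i j (ω i j)) where

      -- goal i j k: the last arc j → k has been tried for i → k, and the first
      -- arc k → j for k → i. No vertex at position f or later has been reached.
      record Growing (f : ℕ) (goal : Fin n → Fin n → Fin n → Set) (δ : Matrix n) : Set (c ⊔ˡ ℓ₁ ⊔ˡ ℓ₂) where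
        field
          realised     : ∀ i j → Realised G i j (δ i j)
          diagonal     : ∀ i → δ i i ≡ 𝟘
          fresh-in     : ∀ {i k} → π i < π k → f ≤ π k → δ i k ≡ nothing
          fresh-out    : ∀ {i k} → π i < π k → f ≤ π k → δ k i ≡ nothing
          upper-in     : ∀ {i j k} → goal i j k → δ i k ≤∞ δ i j ⊕ ω j k
          upper-out    : ∀ {i j k} → goal i j k → δ k i ≤∞ ω k j ⊕ δ j i
          attained-in  : ∀ {i k} → π i < π k → δ i k ≡ nothing ⊎
                         ∃[ j ] (π j < π k × Adj U j k × δ i j ⊕ ω j k ≡ δ i k)
          attained-out : ∀ {i k} → π i < π k → δ k i ≡ nothing ⊎
                         ∃[ j ] (π j < π k × Adj U j k × ω k j ⊕ δ j i ≡ δ k i)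

      Growing-map : ∀ {f f′ g g′ δ} → f ≤ f′ → (∀ {i j k} → g′ i j k → g i j k) → Growing f g δ → Growing f′ g′ δ
      Growing-map le h S = record
        { realised = realised ; diagonal = diagonal
        ; fresh-in = λ lt le′ → fresh-in lt (≤-trans le le′) ; fresh-out = λ lt le′ → fresh-out lt (≤-trans le le′)
        ; upper-in = upper-in ∘ h ; upper-out = upper-out ∘ h ; attained-in = attained-in ; attained-out = attained-out }
        where open Growing S

      Step : Fin n → Fin n → Fin n → Set
      Step i j k = π i < π k × π j < π k × Adj U j k

      Goal : Fin n → (Fin n → Fin n → Set) → Fin n → Fin n → Fin n → Set
      Goal z S i j k = Step i j k × (π k < π z ⊎ (k ≡ z × S i j))

      Inv : Fin n → (Fin n → Fin n → Set) → Store W → Set (c ⊔ˡ ℓ₁ ⊔ˡ ℓ₂)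
      Inv z S s = Growing (suc (π z)) (Goal z S) (distance s)

      Inv-map : ∀ {z S S′} s → (∀ {i j} → π i < π z → π j < π z → Adj U j z → S′ i j → S i j) → Inv z S s → Inv z S′ s
      Inv-map {z} {S} {S′} s f = Growing-map ≤-refl goal
        where
        goal : ∀ {i j k} → Goal z S′ i j k → Goal z S i j k
        goal (b , inj₁ h) = b , inj₁ h
        goal (b@(i<k , j<k , j~k) , inj₂ (refl , h)) = b , inj₂ (refl , f i<k j<k j~k h)

      module Relax {x y z : Fin n} (y<z : π y < π z) (x<z : π x < π z) (x~z : Adj U x z)
                   {S : Fin n → Fin n → Set} {δ : Matrix n} (R : Growing (suc (π z)) (Goal z S) δ) where
        open Growing R

        y≢z : y ≢ z
        y≢z refl = <-irrefl refl y<z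

        u v : Weight
        u = δ y z ⊓∞ (δ y x ⊕ ω x z)
        v = δ z y ⊓∞ (ω z x ⊕ δ x y)

        module _ (δ′ : Matrix n) (tw : ∀ i j → TwoWrites {W = W} y z u v δ i j (δ′ i j)) where

          decreasing : ∀ i j → δ′ i j ≤∞ δ i j
          decreasing i j with δ′ i j | tw i j
          ... | _ | first refl refl  = ⊓∞-≤ˡ (δ i j) (δ i x ⊕ ω x j)
          ... | _ | second refl refl = ⊓∞-≤ˡ (δ i j) (ω i x ⊕ δ x j)
          ... | _ | other _ _        = ≤∞-refl

          at-yz : δ′ y z ≡ u
          at-yz with δ′ y z | tw y z
          ... | _ | first _ _  = refl
          ... | _ | second e _ = contradiction e y≢z
          ... | _ | other ne _ = contradiction (refl , refl) ne

          at-zy : δ′ z y ≡ v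
          at-zy with δ′ z y | tw z y
          ... | _ | first e _  = contradiction (sym e) y≢z
          ... | _ | second _ _ = refl
          ... | _ | other _ ne = contradiction (refl , refl) ne

          unchanged : ∀ {i j} → (i ≡ y → j ≢ z) → (i ≡ z → j ≢ y) → δ′ i j ≡ δ i j
          unchanged {i} {j} ne ne′ with δ′ i j | tw i j
          ... | _ | first e e′  = contradiction e′ (ne e)
          ... | _ | second e e′ = contradiction e′ (ne′ e)
          ... | _ | other _ _   = refl

          -- Growing by `z` writes only row and column `z`, whereas the sums compared with an entry
          -- involve distances between earlier vertices only. The bounds found so far therefore stay
          -- valid, and so do the attaining arcs of entries that are not improved.
          unchanged-below : ∀ {i j} → π i < π z → π j < π z → δ′ i j ≡ δ i j
          unchanged-below i<z j<z = unchanged (λ { _ refl → <-irrefl refl j<z }) (λ { refl _ → <-irrefl refl i<z })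

          unchanged-above : ∀ {i j} → π z < π i ⊎ π z < π j → δ′ i j ≡ δ i j
          unchanged-above (inj₁ lt) = unchanged (λ { refl _ → <-asym lt y<z }) (λ { refl _ → <-irrefl refl lt })
          unchanged-above (inj₂ lt) = unchanged (λ { _ refl → <-irrefl refl lt }) (λ { _ refl → <-asym lt y<z })

          ≤z : ∀ {i j k} → Goal z S i j k → π k ≤ π z
          ≤z (_ , inj₁ lt)         = <⇒≤ lt
          ≤z (_ , inj₂ (refl , _)) = ≤-refl

          old-in : ∀ {i j k} → Goal z S i j k → δ′ i k ≤∞ δ′ i j ⊕ ω j k
          old-in {i} {j} {k} g@((i<k , j<k , _) , _) = ≤∞-trans (decreasing i k) (≤∞-trans (upper-in g)
            (≤∞-reflexive (cong (_⊕ ω j k) (sym (unchanged-below (<-≤-trans i<k (≤z g)) (<-≤-trans j<k (≤z g)))))))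

          old-out : ∀ {i j k} → Goal z S i j k → δ′ k i ≤∞ ω k j ⊕ δ′ j i
          old-out {i} {j} {k} g@((i<k , j<k , _) , _) = ≤∞-trans (decreasing k i) (≤∞-trans (upper-out g)
            (≤∞-reflexive (cong (ω k j ⊕_) (sym (unchanged-below (<-≤-trans j<k (≤z g)) (<-≤-trans i<k (≤z g)))))))

          new-in : δ′ y z ≤∞ δ′ y x ⊕ ω x z
          new-in = ≤∞-trans (≤∞-reflexive at-yz) (≤∞-trans (⊓∞-≤ʳ (δ y z) (δ y x ⊕ ω x z))
            (≤∞-reflexive (cong (_⊕ ω x z) (sym (unchanged-below y<z x<z)))))

          new-out : δ′ z y ≤∞ ω z x ⊕ δ′ x y
          new-out = ≤∞-trans (≤∞-reflexive at-zy) (≤∞-trans (⊓∞-≤ʳ (δ z y) (ω z x ⊕ δ x y))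
            (≤∞-reflexive (cong (ω z x ⊕_) (sym (unchanged-below x<z y<z)))))

          keep-in : ∀ {i k} → π i < π k → π k ≤ π z → δ′ i k ≡ δ i k →
            δ i k ≡ nothing ⊎ ∃[ j ] (π j < π k × Adj U j k × δ i j ⊕ ω j k ≡ δ i k) →
            δ′ i k ≡ nothing ⊎ ∃[ j ] (π j < π k × Adj U j k × δ′ i j ⊕ ω j k ≡ δ′ i k)
          keep-in i<k k≤z e (inj₁ h) = inj₁ (trans e h)
          keep-in {k = k} i<k k≤z e (inj₂ (j , j<k , j~k , h)) = inj₂ (j , j<k , j~k ,
            trans (cong (_⊕ ω j k) (unchanged-below (<-≤-trans i<k k≤z) (<-≤-trans j<k k≤z))) (trans h (sym e)))

          keep-out : ∀ {i k} → π i < π k → π k ≤ π z → δ′ k i ≡ δ k i →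
            δ k i ≡ nothing ⊎ ∃[ j ] (π j < π k × Adj U j k × ω k j ⊕ δ j i ≡ δ k i) →
            δ′ k i ≡ nothing ⊎ ∃[ j ] (π j < π k × Adj U j k × ω k j ⊕ δ′ j i ≡ δ′ k i)
          keep-out i<k k≤z e (inj₁ h) = inj₁ (trans e h)
          keep-out {k = k} i<k k≤z e (inj₂ (j , j<k , j~k , h)) = inj₂ (j , j<k , j~k ,
            trans (cong (ω k j ⊕_) (unchanged-below (<-≤-trans j<k k≤z) (<-≤-trans i<k k≤z))) (trans h (sym e)))

          grown : Growing (suc (π z)) (Goal z (λ i j → S i j ⊎ (i ≡ y × j ≡ x))) δ′
          grown = record
            { realised = real ; diagonal = λ i → trans (unchanged (λ { refl e → y≢z e }) (λ { refl e → y≢z (sym e) })) (diagonal i)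
            ; fresh-in  = λ lt le → trans (unchanged-above (inj₂ le)) (fresh-in lt le)
            ; fresh-out = λ lt le → trans (unchanged-above (inj₁ le)) (fresh-out lt le)
            ; upper-in  = λ { (b , inj₁ h) → old-in (b , inj₁ h) ; (b , inj₂ (e , inj₁ h)) → old-in (b , inj₂ (e , h))
                            ; (_ , inj₂ (refl , inj₂ (refl , refl))) → new-in }
            ; upper-out = λ { (b , inj₁ h) → old-out (b , inj₁ h) ; (b , inj₂ (e , inj₁ h)) → old-out (b , inj₂ (e , h))
                            ; (_ , inj₂ (refl , inj₂ (refl , refl))) → new-out }
            ; attained-in = att-in ; attained-out = att-out }
            where
            real : ∀ i j → Realised G i j (δ′ i j)
            real i j with δ′ i j | tw i j
            ... | _ | first refl refl  = realised-⊓ G (δ i j) (δ i x ⊕ ω x j) (realised i j)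
                                           (realised-⊕ G (δ i x) (ω x j) (realised i x) (ω-realised x j))
            ... | _ | second refl refl = realised-⊓ G (δ i j) (ω i x ⊕ δ x j) (realised i j)
                                           (realised-⊕ G (ω i x) (δ x j) (ω-realised i x) (realised x j))
            ... | _ | other _ _        = realised i j
            att-in : ∀ {i k} → π i < π k → δ′ i k ≡ nothing ⊎
                     ∃[ j ] (π j < π k × Adj U j k × δ′ i j ⊕ ω j k ≡ δ′ i k)
            att-in {i} {k} i<k with π k ≤? π z | i Fin.≟ y | k Fin.≟ z
            ... | no k≰z  | _ | _ = inj₁ (trans (unchanged-above (inj₂ (≰⇒> k≰z))) (fresh-in i<k (≰⇒> k≰z)))
            ... | yes k≤z | no ne | _ = keep-in i<k k≤z (unchanged (λ e → contradiction e ne)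
                                          λ { refl refl → <-asym i<k y<z }) (attained-in i<k)
            ... | yes k≤z | yes _ | no ne = keep-in i<k k≤z (unchanged (λ _ → ne)
                                              λ { refl refl → <-asym i<k y<z }) (attained-in i<k)
            ... | yes k≤z | yes refl | yes refl with ⊓∞-sel (δ y z) (δ y x ⊕ ω x z)
            ...   | inj₁ e = keep-in i<k k≤z (trans at-yz e) (attained-in i<k)
            ...   | inj₂ e = inj₂ (x , x<z , x~z , trans (cong (_⊕ ω x z) (unchanged-below y<z x<z)) (sym (trans at-yz e)))
            att-out : ∀ {i k} → π i < π k → δ′ k i ≡ nothing ⊎
                      ∃[ j ] (π j < π k × Adj U j k × ω k j ⊕ δ′ j i ≡ δ′ k i)
            att-out {i} {k} i<k with π k ≤? π z | i Fin.≟ y | k Fin.≟ z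
            ... | no k≰z  | _ | _ = inj₁ (trans (unchanged-above (inj₁ (≰⇒> k≰z))) (fresh-out i<k (≰⇒> k≰z)))
            ... | yes k≤z | no ne | _ = keep-out i<k k≤z (unchanged (λ { refl refl → <-asym i<k y<z })
                                          (λ _ → ne)) (attained-out i<k)
            ... | yes k≤z | yes _ | no ne = keep-out i<k k≤z (unchanged (λ { refl refl → <-asym i<k y<z })
                                              λ e → contradiction e ne) (attained-out i<k)
            ... | yes k≤z | yes refl | yes refl with ⊓∞-sel (δ z y) (ω z x ⊕ δ x y)
            ...   | inj₁ e = keep-out i<k k≤z (trans at-zy e) (attained-out i<k)
            ...   | inj₂ e = inj₂ (x , x<z , x~z , trans (cong (ω z x ⊕_) (unchanged-below x<z y<z)) (sym (trans at-zy e)))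

      module _ {r : Level} {R : Set r} where

        growRelax-runs : ∀ {s x y z S} → nat s xᵛ 0 0 ≡ toℕ x → nat s yᵛ 0 0 ≡ toℕ y → nat s zᵛ 0 0 ≡ toℕ z →
          (∀ i j → weights s i j ≡ ω i j) → π y < π z → π x < π z → Adj U x z → Inv z S s →
          Runs growRelax s 2 (Inv z (λ i j → S i j ⊎ (i ≡ y × j ≡ x))) R
        growRelax-runs {s} {x} {y} {z} {S} x≡ y≡ z≡ hω y<z x<z x~z inv =
          assignW {i = toℕ y} {toℕ z} {u} y≡ z≡
            (trans (value x≡ y≡ z≡) (cong (λ e → δ y z ⊓∞ (δ y x ⊕ e)) (hω x z)))
            (lastW {i = toℕ z} {toℕ y} {v} z≡ y≡
              (trans (value′ (wt s₁ D) x≡ y≡ z≡)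
                (cong₂ _⊓∞_ (first-write D {y} {z} u s (λ (e , _) → y≢z (sym e)))
                  (cong₂ _⊕_ (hω z x) (first-write D {y} {z} u s (λ (_ , e) → y≢z e)))))
              (grown (distance s₂) (two-writes {W = W} D {y} {z} u v s)))
          where
          open Relax {x} {y} {z} y<z x<z x~z {S} inv
          δ = distance s
          s₁ = writeW D (toℕ y) (toℕ z) u s
          s₂ = writeW D (toℕ z) (toℕ y) v s₁
          value : ∀ {a b c a′ b′ c′} → a ≡ a′ → b ≡ b′ → c ≡ c′ →
                  wt s D b c ⊓∞ (wt s D b a ⊕ wt s w a c) ≡ wt s D b′ c′ ⊓∞ (wt s D b′ a′ ⊕ wt s w a′ c′)
          value refl refl refl = refl
          value′ : ∀ (m : ℕ → ℕ → Weight) {a b c a′ b′ c′} → a ≡ a′ → b ≡ b′ → c ≡ c′ →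
                   m c b ⊓∞ (wt s w c a ⊕ m a b) ≡ m c′ b′ ⊓∞ (wt s w c′ a′ ⊕ m a′ b′)
          value′ m refl refl refl = refl

        S-x : Fin n → ℕ → Fin n → Fin n → Set
        S-x z p i j = Seen z p j

        growVisit-x-runs : ∀ {s z p} → let x = neighbour z p in
          nat s xᵛ 0 0 ≡ toℕ x → nat s zᵛ 0 0 ≡ toℕ z → nat s kᵛ 0 0 ≡ π z → (∀ i j → weights s i j ≡ ω i j) →
          HoldsOrderedGraph s → Inv z (S-x z (toℕ p)) s →
          Runs growVisit-x s (suc (suc (n * 4))) (Inv z (S-x z (suc (toℕ p)))) R
        growVisit-x-runs {s} {z} {p} hx hz hk hω ho@(_ , hpos , _) inv =
          if-< (trans (cong (λ v → nat s pos v 0) hx) (hpos x)) hk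
            -- The inner loop runs over the `π z` earlier positions, at most `n`; summed over all
            -- neighbours this gives the term of order nm.
            (λ x<z → weaken (s≤s (*-monoˡ-≤ 4 (<⇒≤ (Fin.toℕ<n (d ⟨$⟩ʳ z)))))
              (λ {s′} _ → Inv-map s′ λ i<z _ _ h → done i<z (Seen-suc p h))
              (for-const (π z) (λ r → Inv z (λ i j → Seen z (toℕ p) j ⊎ (j ≡ x × π i < r))) 3 hk
                (Inv-map s (λ { _ _ _ (inj₁ h) → h }) inv)
                λ r {s₁} ag inv₁ →
                  let r<n = <-trans (Fin.toℕ<n r) (Fin.toℕ<n (d ⟨$⟩ʳ z))
                      y = d ⟨$⟩ˡ Fin.fromℕ< r<n
                      πy = trans (π-vertex G L d perfect (Fin.fromℕ< r<n)) (Fin.toℕ-fromℕ< r<n)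
                      ho₁ = holdsOrderedGraph-agree ag refl refl refl refl refl ho
                  in assignN refl refl
                       (trans (cong (λ k → nat s₁ vert k 0) (sym (Fin.toℕ-fromℕ< r<n))) (proj₂ (proj₂ ho₁) (Fin.fromℕ< r<n)))
                       (weaken ≤-refl (λ {s′} _ → Inv-map s′ λ _ _ _ → advance πy)
                         (growRelax-runs {y = y} (trans (natᶠ ag xᵛ 0 0 refl) hx) refl (trans (natᶠ ag zᵛ 0 0 refl) hz)
                           (λ i j → trans (wtᶠ ag w (toℕ i) (toℕ j) refl) (hω i j))
                           (subst (_< π z) (sym πy) (Fin.toℕ<n r)) x<z (Adj-sym U (neighbour-adj z p)) inv₁))))
            (λ z≤x → skips (Inv-map s (λ _ j<z _ h → skip-x j<z z≤x (Seen-suc p h)) inv))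
          where
          x = neighbour z p
          done : ∀ {i j} → π i < π z → Seen z (toℕ p) j ⊎ x ≡ j → Seen z (toℕ p) j ⊎ (j ≡ x × π i < π z)
          done i<z (inj₁ h) = inj₁ h
          done i<z (inj₂ e) = inj₂ (sym e , i<z)
          skip-x : ∀ {j} → π j < π z → π z ≤ π x → Seen z (toℕ p) j ⊎ x ≡ j → Seen z (toℕ p) j
          skip-x j<z z≤x (inj₁ h)    = h
          skip-x j<z z≤x (inj₂ refl) = contradiction j<z (≤⇒≯ z≤x)
          advance : ∀ {r y i j} → π y ≡ r → Seen z (toℕ p) j ⊎ (j ≡ x × π i < suc r) →
                    (Seen z (toℕ p) j ⊎ (j ≡ x × π i < r)) ⊎ (i ≡ y × j ≡ x)
          advance πy (inj₁ h) = inj₁ (inj₁ h)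
          advance πy (inj₂ (e , le)) with m<1+n⇒m<n∨m≡n le
          ... | inj₁ lt = inj₁ (inj₂ (e , lt))
          ... | inj₂ eq = inj₂ (π-injective (trans eq (sym πy)) , e)

        growVisit-z-runs : ∀ {s z} → nat s zᵛ 0 0 ≡ toℕ z → nat s kᵛ 0 0 ≡ π z → (∀ i j → weights s i j ≡ ω i j) →
          HoldsOrderedGraph s → Inv z (λ _ _ → ⊥) s →
          Runs growVisit-z s (suc (degree z * (4 + n * 4))) (Inv z (λ _ _ → ⊤)) R
        growVisit-z-runs {s} {z} hz hk hω ho inv = weaken ≤-refl
          (λ {s′} _ → Inv-map s′ λ _ _ j~z _ → Seen-all (Adj-sym U j~z))
          (neighbours-rule z (λ p → Inv z (S-x z p)) (suc (suc (n * 4))) refl refl refl (proj₁ ho)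
            (λ ag _ → holdsGraph-agree ag refl refl refl (proj₁ ho)) hz
            (Inv-map s (λ _ _ _ h → Seen-zero h) inv)
            λ p ag inv₁ → growVisit-x-runs {p = p} refl (trans (natᶠ ag zᵛ 0 0 refl) hz) (trans (natᶠ ag kᵛ 0 0 refl) hk)
              (λ i j → trans (wtᶠ ag w (toℕ i) (toℕ j) refl) (hω i j))
              (holdsOrderedGraph-agree ag refl refl refl refl refl ho) inv₁)

  growTail-bound : ℕ
  growTail-bound = suc (n * suc (suc (n * 2))) + (suc (n * 2) + suc (n * 3 + sum degree * (4 + n * 4)))

  GrownDistances : Matrix n → Matrix n → Set (c ⊔ˡ ℓ₁ ⊔ˡ ℓ₂)
  GrownDistances ω δ = Grown U π π-injective clique ω δ × (∀ i j → Realised G i j (δ i j))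

  growTail-runs : ∀ {r} {R : Set r} {s} → Relaxed G L d perfect s →
                  Runs growTail s growTail-bound (λ s′ → GrownDistances (weights s) (distance s′)) R
  growTail-runs {R = R} {s} ((hg , ho , _) , Rx) =
    weaken ≤-refl (λ _ h i j → h i j (Fin.toℕ<n i))
      (for-const n (λ x s → ∀ i j → toℕ i < x → distance s i j ≡ nothing) (suc (n * 2)) (proj₁ hg) (λ _ _ ())
        λ x ag h → weaken ≤-refl (λ {s′} _ (h , h′) i j lt → cover s′ x h h′ i j (m<1+n⇒m<n∨m≡n lt))
          (for-const n (λ y s → (∀ i j → toℕ i < toℕ x → distance s i j ≡ nothing) × (∀ j → toℕ j < y → distance s x j ≡ nothing)) 1
            (trans (natᶠ ag order 0 0 refl) (proj₁ hg)) (h , λ _ ())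
            λ y {s₂} ag′ (h , h′) → let x≡ = natᶠ ag′ xᵛ 0 0 refl in lastW {i = toℕ x} {j = toℕ y} {v = nothing} x≡ refl refl
              ((λ i j lt → clear s₂ x y i j (inj₁ (h i j lt)))
              , λ j lt → clear s₂ x y x j (fresh {s₂} h′ j (m<1+n⇒m<n∨m≡n lt)))))
    then λ {s₁} ag₁ h₁ →
    let ho₁ = holdsOrderedGraph-agree ag₁ refl refl refl refl refl (hg , ho) in
    weaken ≤-refl (λ _ (h , h′) → (λ i → h i (Fin.toℕ<n i)) , h′)
      (for-const n (λ x s → (∀ i → toℕ i < x → distance s i i ≡ 𝟘) × (∀ i j → i ≢ j → distance s i j ≡ nothing)) 1
        (proj₁ (proj₁ ho₁)) ((λ _ ()) , λ i j _ → h₁ i j)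
        λ x {s₂} ag (h , h′) → lastW {i = toℕ x} {j = toℕ x} {v = 𝟘} refl refl refl
          ((λ i lt → diag s₂ x i h (m<1+n⇒m<n∨m≡n lt)) , λ i j ne → trans (off s₂ x i j ne) (h′ i j ne)))
    then λ {s₂} ag₂ (hd , hn) →
    let ho₂ = holdsOrderedGraph-agree ag₂ refl refl refl refl refl ho₁
        hω₂ = λ i j → trans (wtᶠ ag₂ w (toℕ i) (toℕ j) refl) (wtᶠ ag₁ w (toℕ i) (toℕ j) refl)
    in weaken ≤-refl (λ _ → finish)
      (for-sum n (λ K s′ → Growing ω (Relaxing.realised Rx) K (λ i j k → Stepω i j k × π k < K) (distance s′))
        degree (d ⟨$⟩ˡ_) vertex-injective 2 (4 + n * 4) (proj₁ (proj₁ ho₂)) (initially s₂ hd hn)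
        λ k {s₃} ag inv →
          let z = d ⟨$⟩ˡ k
              πz = π-vertex G L d perfect k
              ho₃ = holdsOrderedGraph-agree ag refl refl refl refl refl ho₂
          in assignN refl refl (proj₂ (proj₂ ho₃) k)
            (weaken ≤-refl (λ _ → Growing-map ω (Relaxing.realised Rx) (≤-reflexive (cong suc πz))
                              λ (b , le) → b , reached πz (m<1+n⇒m<n∨m≡n le))
              (growVisit-z-runs ω (Relaxing.realised Rx) {z = z} refl (sym πz)
                (λ i j → trans (wtᶠ ag w (toℕ i) (toℕ j) refl) (hω₂ i j)) ho₃
                (Growing-map ω (Relaxing.realised Rx) (m≤n⇒m≤1+n (≤-reflexive (sym πz)))
                  (λ { (b , inj₁ lt) → b , subst (_ <_) πz lt }) inv))))
    where
    ω = weights s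
    Stepω = Step ω (Relaxing.realised Rx)
    clear : ∀ s x y i j → distance s i j ≡ nothing ⊎ (i ≡ x × j ≡ y) →
            write D (toℕ x) (toℕ y) nothing (wt s) D (toℕ i) (toℕ j) ≡ nothing
    clear s x y i j h with write D (toℕ x) (toℕ y) nothing (wt s) D (toℕ i) (toℕ j)
                         | written D (toℕ x) (toℕ y) nothing (wt s) (toℕ i) (toℕ j) | h
    ... | _ | here _ _         | _                  = refl
    ... | _ | there _          | inj₁ e             = e
    ... | _ | there (inj₁ ne)  | inj₂ (refl , refl) = contradiction refl ne
    ... | _ | there (inj₂ ne)  | inj₂ (refl , refl) = contradiction refl ne
    fresh : ∀ {s : Store W} {x} {y : Fin n} → (∀ j → toℕ j < toℕ y → distance s x j ≡ nothing) →
            ∀ j → toℕ j < toℕ y ⊎ toℕ j ≡ toℕ y → distance s x j ≡ nothing ⊎ (x ≡ x × j ≡ y)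
    fresh {s} h j (inj₁ lt) = inj₁ (h j lt)
    fresh {s} h j (inj₂ eq) = inj₂ (refl , Fin.toℕ-injective eq)
    cover : ∀ s (x : Fin n) → (∀ i j → toℕ i < toℕ x → distance s i j ≡ nothing) →
            (∀ j → toℕ j < n → distance s x j ≡ nothing) →
            ∀ i j → toℕ i < toℕ x ⊎ toℕ i ≡ toℕ x → distance s i j ≡ nothing
    cover s x h h′ i j (inj₁ lt) = h i j lt
    cover s x h h′ i j (inj₂ eq) with refl ← Fin.toℕ-injective eq = h′ j (Fin.toℕ<n j)
    diag : ∀ s (x i : Fin n) → (∀ i → toℕ i < toℕ x → distance s i i ≡ 𝟘) → toℕ i < toℕ x ⊎ toℕ i ≡ toℕ x →
           write D (toℕ x) (toℕ x) 𝟘 (wt s) D (toℕ i) (toℕ i) ≡ 𝟘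
    diag s x i h (inj₁ lt) = trans (write-row D (toℕ x) (toℕ x) 𝟘 (wt s) (λ e → <-irrefl (sym e) lt)) (h i lt)
    diag s x i h (inj₂ eq) rewrite eq = write-same D (toℕ x) (toℕ x) 𝟘 (wt s)
    off : ∀ s (x i j : Fin n) → i ≢ j → write D (toℕ x) (toℕ x) 𝟘 (wt s) D (toℕ i) (toℕ j) ≡ distance s i j
    off s x i j ne with x Fin.≟ i
    ... | no x≢i   = write-row D (toℕ x) (toℕ x) 𝟘 (wt s) (x≢i ∘ Fin.toℕ-injective)
    ... | yes refl = write-col D (toℕ x) (toℕ x) 𝟘 (wt s) (ne ∘ Fin.toℕ-injective)
    vertex-injective : Injective _≡_ _≡_ (d ⟨$⟩ˡ_)
    vertex-injective e = trans (sym (inverseʳ d)) (trans (cong (d ⟨$⟩ʳ_) e) (inverseʳ d))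
    reached : ∀ {k : Fin n} {z k′} → π z ≡ toℕ k → π k′ < toℕ k ⊎ π k′ ≡ toℕ k → π k′ < π z ⊎ (k′ ≡ z × ⊤)
    reached e (inj₁ lt) = inj₁ (subst (_ <_) (sym e) lt)
    reached e (inj₂ eq) = inj₂ (π-injective (trans eq (sym e)) , tt)
    initially : ∀ s′ → (∀ i → distance s′ i i ≡ 𝟘) → (∀ i j → i ≢ j → distance s′ i j ≡ nothing) →
                Growing ω (Relaxing.realised Rx) 0 (λ i j k → Stepω i j k × π k < 0) (distance s′)
    initially s′ hd hn = record
      { realised = real ; diagonal = hd
      ; fresh-in  = λ lt _ → hn _ _ (differ lt) ; fresh-out = λ lt _ → hn _ _ (differ lt ∘ sym)
      ; upper-in  = λ () ; upper-out = λ ()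
      ; attained-in = λ lt → inj₁ (hn _ _ (differ lt)) ; attained-out = λ lt → inj₁ (hn _ _ (differ lt ∘ sym)) }
      where
      differ : ∀ {i k} → π i < π k → i ≢ k
      differ lt refl = <-irrefl refl lt
      real : ∀ i j → Realised G i j (distance s′ i j)
      real i j with i Fin.≟ j
      ... | yes refl = subst (Realised G i i) (sym (hd i)) (realised-𝟘 G i)
      ... | no ne    = λ e → contradiction (trans (sym (hn i j ne)) e) λ ()
    finish : ∀ {δ} → Growing ω (Relaxing.realised Rx) n (λ i j k → Stepω i j k × π k < n) δ → GrownDistances ω δ
    finish S = record
      { diagonal = diagonal
      ; upper-in = λ i<k j<k j~k → upper-in ((i<k , j<k , j~k) , Fin.toℕ<n _)
      ; upper-out = λ i<k j<k j~k → upper-out ((i<k , j<k , j~k) , Fin.toℕ<n _)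
      ; attained-in = λ lt → relax (attained-in lt) ; attained-out = λ lt → relax (attained-out lt) } , Growing.realised S
      where
      open Growing S
      relax : ∀ {P : Set c} {A B : Fin n → Set} {f : Fin n → Weight} {x} → P ⊎ ∃[ j ] (A j × B j × f j ≡ x) →
              P ⊎ ∃[ j ] (A j × B j × f j ≤∞ x)
      relax (inj₁ h)               = inj₁ h
      relax (inj₂ (j , a , b , e)) = inj₂ (j , a , b , ≤∞-reflexive e)

  relaxed⇒pathConsistent : ∀ s → Relaxed G L d perfect s → NoNegativePair G →
                           PathConsistent U π π-injective clique (weights s)
  relaxed⇒pathConsistent s (_ , Rx) h = record
    { bypass = λ i<k j<k i~k j~k ne → Relaxing.bypass Rx (i<k , j<k , i~k , j~k , ne) ; nonneg = Relaxing.nonneg Rx h }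

  module _ (s₀ : Store W) {δ : Matrix n} (Rx : Relaxed G L d perfect s₀) (h : NoNegativePair G)
           (Gr : Grown U π π-injective clique (weights s₀) δ) where

    private
      -- The triangle inequality, followed by a bound for the arc: `δ` is at most `ω`, and DPC has
      -- only lowered the original weights.
      δ-step : ∀ {s i j a} → weight i j ≡ just a → δ s j ≤∞ δ s i ⊕ just a
      δ-step {s} {i} {j} e = ≤∞-trans (triangle U π π-injective clique PC Gr s i j) (⊕-monoʳ (δ s i)
        (≤∞-trans (δ≤ω U π π-injective clique PC Gr (arc⇒adj G L e)) (≤∞-trans (Relaxing.below (proj₂ Rx) i j) (≤∞-reflexive e))))
        where PC = relaxed⇒pathConsistent s₀ Rx h

    grown-¬negativeCycle : ¬ NegativeCycle G
    grown-¬negativeCycle = ¬negativeCycle G δ δ-step (Grown.diagonal Gr)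

    -- Stated for any realised `x` that is at most `δ i j`, it applies to both algorithms: to the
    -- entries of `δ` itself and to those obtained by the two sweeps.
    grown-isDistance : ∀ {i j} x → Realised G i j x → x ≤∞ δ i j → IsDistance G i j x
    grown-isDistance x f le = isDistance G x f λ p → ≤∞-trans le (δ≤pathWeight G δ δ-step (Grown.diagonal Gr) p)

  snowball-runs : ∀ {s} → HoldsOrderedGraph s → HoldsWeights G L s →
    Runs snowball s (dpc-bound G L d perfect + growTail-bound) (APSPSolution G) (NegativeCycle G)
  snowball-runs (hg , ho) hw = dpc-runs G L d perfect hg ho hw then λ {s₁} _ Rx →
    weaken ≤-refl (λ _ (Gr , real) h → grown-¬negativeCycle s₁ Rx h Gr , λ i j → grown-isDistance s₁ Rx h Gr _ (real i j) ≤∞-refl)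
      (growTail-runs {s = s₁} Rx)

-- Chleq–APSP

private
  sweepRelax : Cmd
  sweepRelax = D′ᵛ ⟦ ! xᵛ ⟧≔ D′ᵛ ⟦ ! xᵛ ⟧ ⊓ᵉ D′ᵛ ⟦ ! zᵛ ⟧ ⊞ w ⟦ ! zᵛ ⟧⟦ ! xᵛ ⟧

  sweepVisit : BExp → Cmd
  sweepVisit b = for pᵛ < deg [ ! zᵛ ] run ((xᵛ ≔ nbr [ ! zᵛ ][ ! pᵛ ]) ⨾ (when b then sweepRelax))

  copyRow chleqTail : Cmd
  copyRow   = for xᵛ < ! order run D ⟦ vert [ ! srcᵛ ] ⟧⟦ ! xᵛ ⟧≔ D′ᵛ ⟦ ! xᵛ ⟧
  chleqTail = for srcᵛ < ! order run (minPaths ⨾ copyRow)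

module _ {c ℓ₁ ℓ₂ : Level} {W : OrderedAbelianGroup c ℓ₁ ℓ₂} {n : ℕ}
         (G : WeightedDigraph W n) (L : AdjacencyLists (skeleton G))
         (d : Permutation′ n) (perfect : Perfect (skeleton G) d) where
  open Store
  open ExtendedWeights W
  open WeightedDigraph G
  open GraphInput {W = W} L

  private
    U = skeleton G
    π = position U d
    π-injective = position-injective U d

    clique : EarlierNeighboursAdjacent U d
    clique = perfect-elim U d perfect

    weights distance : Store W → Matrix n
    weights  = weightMatrix w
    distance = weightMatrix D

    row : Store W → Fin n → Weight
    row s v = wt s D′ᵛ (toℕ v) 0

    Ordered = HoldsOrderedGraph G L d perfect

    module _ (ω : Matrix n) (ω-realised : ∀ i j → Realised G i j (ω i j)) (a : Fin n) where

      -- `goal` collects the arcs already relaxed, and `β` is the row at the start of the sweep. It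
      -- shows that the source keeps an entry of at most zero and that the second sweep only lowers
      -- the result of the first.
      record Sweeping (goal : Fin n → Fin n → Set) (β ρ : Fin n → Weight) : Set (c ⊔ˡ ℓ₁ ⊔ˡ ℓ₂) where
        field
          realised : ∀ v → Realised G a v (ρ v)
          bound    : ∀ v → ρ v ≤∞ β v
          upper    : ∀ {i j} → goal i j → ρ j ≤∞ ρ i ⊕ ω i j

      Sweeping-map : ∀ {g g′ β ρ} → (∀ {i j} → g′ i j → g i j) → Sweeping g β ρ → Sweeping g′ β ρ
      Sweeping-map f S = record { realised = realised ; bound = bound ; upper = upper ∘ f }
        where open Sweeping S

      module _ {r : Level} {R : Set r} where

        -- Lowering the entry of `x` could spoil the bounds for arcs out of `x`, hence the premise
        -- that no arc in `goal` starts there. Sweeping in order of positions guarantees it.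
        sweepRelax-runs : ∀ {s x z β} {goal : Fin n → Fin n → Set} →
          nat s xᵛ 0 0 ≡ toℕ x → nat s zᵛ 0 0 ≡ toℕ z → (∀ i j → weights s i j ≡ ω i j) → z ≢ x →
          (∀ {i j} → goal i j → i ≢ x) → Sweeping goal β (row s) →
          Runs sweepRelax s 1 (λ s′ → Sweeping (λ i j → goal i j ⊎ (i ≡ z × j ≡ x)) β (row s′)) R
        sweepRelax-runs {s} {x} {z} {β} {goal} x≡ z≡ hω z≢x goal≢ S = lastW {i = toℕ x} {0} {u} x≡ refl
          (trans (value x≡ z≡) (cong (λ e → ρ x ⊓∞ (ρ z ⊕ e)) (hω z x)))
          record { realised = real ; bound = λ v → ≤∞-trans (decreasing v) (bound v)
                 ; upper = λ { (inj₁ g) → ≤∞-trans (decreasing _) (≤∞-trans (upper g)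
                                 (≤∞-reflexive (cong (_⊕ _) (sym (unchanged (goal≢ g))))))
                             ; (inj₂ (refl , refl)) → ≤∞-trans (≤∞-reflexive at-x) (≤∞-trans (⊓∞-≤ʳ (ρ x) (ρ z ⊕ ω z x))
                                 (≤∞-reflexive (cong (_⊕ ω z x) (sym (unchanged z≢x))))) } }
          where
          open Sweeping S
          ρ ρ′ : Fin n → Weight
          ρ = row s
          u = ρ x ⊓∞ (ρ z ⊕ ω z x)
          ρ′ v = write D′ᵛ (toℕ x) 0 u (wt s) D′ᵛ (toℕ v) 0
          value : ∀ {a b a′ b′} → a ≡ a′ → b ≡ b′ →
                  wt s D′ᵛ a 0 ⊓∞ (wt s D′ᵛ b 0 ⊕ wt s w b a) ≡ wt s D′ᵛ a′ 0 ⊓∞ (wt s D′ᵛ b′ 0 ⊕ wt s w b′ a′)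
          value refl refl = refl
          at-x : ρ′ x ≡ u
          at-x = write-same D′ᵛ (toℕ x) 0 u (wt s)
          unchanged : ∀ {v} → v ≢ x → ρ′ v ≡ ρ v
          unchanged ne = write-row D′ᵛ (toℕ x) 0 u (wt s) (ne ∘ sym ∘ Fin.toℕ-injective)
          decreasing : ∀ v → ρ′ v ≤∞ ρ v
          decreasing v with v Fin.≟ x
          ... | yes refl = ≤∞-trans (≤∞-reflexive at-x) (⊓∞-≤ˡ (ρ x) (ρ z ⊕ ω z x))
          ... | no ne    = ≤∞-reflexive (unchanged ne)
          real : ∀ v → Realised G a v (ρ′ v)
          real v with v Fin.≟ x
          ... | yes refl = subst (Realised G a x) (sym at-x) (realised-⊓ G (ρ x) (ρ z ⊕ ω z x) (realised x)
                             (realised-⊕ G (ρ z) (ω z x) (realised z) (ω-realised z x)))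
          ... | no ne    = subst (Realised G a v) (sym (unchanged ne)) (realised v)

        -- The sweep follows arcs in one direction Dir, which the test b decides.
        sweepVisit-runs : ∀ {b z β} (Dir : Fin n → Fin n → Set) (Done : Fin n → Set) {s} →
          (∀ {s x q} {Q : Store W → Set q} {p t} → nat s xᵛ 0 0 ≡ toℕ x → nat s kᵛ 0 0 ≡ π z → Ordered s →
             (Dir z x → Runs p s (suc t) Q R) → (¬ Dir z x → Q s) → Runs (when b then p) s (suc (suc t)) Q R) →
          (∀ {x} → Dir z x → z ≢ x × ¬ Done x) →
          nat s zᵛ 0 0 ≡ toℕ z → nat s kᵛ 0 0 ≡ π z → (∀ i j → weights s i j ≡ ω i j) → Ordered s →
          Sweeping (λ i j → Adj U i j × Dir i j × Done i) β (row s) →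
          Runs (sweepVisit b) s (suc (degree z * 4))
            (λ s′ → Sweeping (λ i j → Adj U i j × Dir i j × (Done i ⊎ i ≡ z)) β (row s′)) R
        sweepVisit-runs {b} {z} {β} Dir Done {s} branch fresh hz hk hω ho S = weaken ≤-refl
          (λ _ → Sweeping-map λ { (a , dir , inj₁ h) → a , dir , inj₁ h ; (a , dir , inj₂ refl) → a , dir , inj₂ (refl , Seen-all a) })
          (neighbours-rule z (λ p s′ → Sweeping (Goal p) β (row s′)) 2 refl refl refl (proj₁ ho)
            (λ ag _ → holdsGraph-agree ag refl refl refl (proj₁ ho)) hz
            (Sweeping-map (λ { (a , dir , inj₁ h) → a , dir , h ; (_ , _ , inj₂ (_ , h)) → ⊥-elim (Seen-zero h) }) S)
            λ p ag S′ → branch {x = neighbour z p} refl (trans (natᶠ ag kᵛ 0 0 refl) hk)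
              (holdsOrderedGraph-agree G L d perfect ag refl refl refl refl refl ho)
              (λ dir → weaken ≤-refl (λ _ → Sweeping-map (advance p))
                (sweepRelax-runs {x = neighbour z p} {z} {goal = Goal (toℕ p)} refl (trans (natᶠ ag zᵛ 0 0 refl) hz)
                  (λ i j → trans (wtᶠ ag w (toℕ i) (toℕ j) refl) (hω i j)) (proj₁ (fresh dir))
                  (λ { (_ , _ , inj₁ h) refl → proj₂ (fresh dir) h ; (_ , _ , inj₂ (refl , _)) e → proj₁ (fresh dir) e })
                  S′))
              (λ ¬dir → Sweeping-map (λ g → stay p ¬dir g) S′))
          where
          Goal : ℕ → Fin n → Fin n → Set
          Goal p i j = Adj U i j × Dir i j × (Done i ⊎ (i ≡ z × Seen z p j))
          advance : ∀ p {i j} → Goal (suc (toℕ p)) i j → Goal (toℕ p) i j ⊎ (i ≡ z × j ≡ neighbour z p)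
          advance p (a , dir , inj₁ h) = inj₁ (a , dir , inj₁ h)
          advance p (a , dir , inj₂ (e , h)) with Seen-suc p h
          ... | inj₁ h′ = inj₁ (a , dir , inj₂ (e , h′))
          ... | inj₂ e′ = inj₂ (e , sym e′)
          stay : ∀ p → ¬ Dir z (neighbour z p) → ∀ {i j} → Goal (suc (toℕ p)) i j → Goal (toℕ p) i j
          stay p ¬dir g@(_ , dir , _) with advance p g
          ... | inj₁ g′ = g′
          ... | inj₂ (refl , refl) = contradiction dir ¬dir

  minPaths-bound : ℕ
  minPaths-bound = suc (n * 2) + suc (suc (n * 4 + sum degree * 4) + suc (n * 3 + sum degree * 4))

  minPaths-runs : ∀ {r} {R : Set r} {ω δ} → (∀ i j → Realised G i j (ω i j)) → Grown U π π-injective clique ω δ →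
    ∀ {s} (σ : Fin n) → let a = d ⟨$⟩ˡ σ in
    nat s srcᵛ 0 0 ≡ toℕ σ → (∀ i j → weights s i j ≡ ω i j) → Ordered s →
    Runs minPaths s minPaths-bound (λ s′ → ∀ v → Realised G a v (row s′ v) × row s′ v ≤∞ δ a v) R
  minPaths-runs {R = R} {ω} {δ} ω-real Gr {s} σ hsrc hω ho =
    for-const n (λ x s → ∀ v → toℕ v < x → row s v ≡ nothing) 1 (proj₁ (proj₁ ho)) (λ _ ())
      (λ x {s′} _ h → lastW {i = toℕ x} {j = 0} {v = nothing} refl refl refl λ v lt → clear s′ x v h (m<1+n⇒m<n∨m≡n lt))
    then λ {s₁} ag₁ h₁ →
    let ho₁ = holdsOrderedGraph-agree G L d perfect ag₁ refl refl refl refl refl ho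
        hsrc₁ = trans (natᶠ ag₁ srcᵛ 0 0 refl) hsrc
        s₂ = writeW D′ᵛ (toℕ a) 0 𝟘 s₁
    in assignW {i = toℕ a} {j = 0} {v = 𝟘} (trans (cong (λ k → nat s₁ vert k 0) hsrc₁) (proj₂ (proj₂ ho₁) σ)) refl refl
    (within (s≤s (+-monoˡ-≤ (sum degree * 4) (*-monoˡ-≤ 4 (Fin.toℕ<n σ))))
      (for-sum (suc (toℕ σ)) (λ t s → Sweeping ω ω-real a (Down t) (row s₂) (row s)) degree vertex vertex-injective 3 4
        (cong suc hsrc₁) (initially s₁ h₁)
        λ t {s₃} ag S →
          let ho₃ = holdsOrderedGraph-agree G L d perfect ag refl refl refl refl refl ho₁
              k = Fin.fromℕ< (k<n t)
              k≡ = trans (cong (_∸ toℕ t) (trans (natᶠ ag srcᵛ 0 0 refl) hsrc₁)) (sym (Fin.toℕ-fromℕ< (k<n t)))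
          in assignN refl refl k≡ (assignN refl refl (proj₂ (proj₂ ho₃) k)
            (weaken ≤-refl (λ _ → Sweeping-map ω ω-real a λ (e , lt , h) → e , lt , finished t (m≤n⇒m<n∨m≡n h))
              (sweepVisit-runs ω ω-real a {b = pos [ ! xᵛ ] <ᵉ ! kᵛ} {z = vertex t} (λ i j → π j < π i) (λ i → toℕ σ < π i + toℕ t)
                (λ {s} {x} hx hk (_ , hp , _) f g → if-< (trans (cong (λ v → nat s pos v 0) hx) (hp x)) hk f (λ le → skips (g (≤⇒≯ le))))
                (λ {x} lt → (λ { refl → <-irrefl refl lt }) , λ h → <-asym lt (+-cancelʳ-< (toℕ t) (π (vertex t)) (π x) (subst (_< π x + toℕ t) (sym (z≡ t)) h)))
                refl (sym (π-vertex G L d perfect k))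
                (λ i j → trans (wtᶠ ag w (toℕ i) (toℕ j) refl) (trans (wtᶠ ag₁ w (toℕ i) (toℕ j) refl) (hω i j)))
                ho₃ S))))
    then λ {s₄} ag₄ S₄ →
    let ho₄ = holdsOrderedGraph-agree G L d perfect ag₄ refl refl refl refl refl ho₁
    in weaken ≤-refl (λ _ S v → Sweeping.realised S v
         , final≤δ U π π-injective clique Gr
             -- After `suc σ` rounds `Down` covers every downward arc. Those out of vertices after
             -- the source were covered at the outset, their tails having infinite entries.
             (λ {i} i~j j<i → Sweeping.upper S₄ (i~j , j<i , m≤n+m (suc (toℕ σ)) (π i)))
             (Sweeping.bound S) (λ i~j i<j → Sweeping.upper S (i~j , i<j , Fin.toℕ<n _)) a v
             (≤∞-trans (Sweeping.bound S₄ a) (≤∞-reflexive (write-same D′ᵛ (toℕ a) 0 𝟘 (wt s₁)))))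
      (for-sum n (λ k s → Sweeping ω ω-real a (Up k) (row s₄) (row s)) degree (d ⟨$⟩ˡ_) d⁻¹-injective 2 4 (proj₁ (proj₁ ho₄))
        record { realised = Sweeping.realised S₄ ; bound = λ _ → ≤∞-refl ; upper = λ () }
        λ k {s₅} ag S →
          let ho₅ = holdsOrderedGraph-agree G L d perfect ag refl refl refl refl refl ho₄
              πz = π-vertex G L d perfect k
          in assignN refl refl (proj₂ (proj₂ ho₅) k)
            (weaken ≤-refl (λ _ → Sweeping-map ω ω-real a λ (e , lt , h) → e , lt , reached πz (m<1+n⇒m<n∨m≡n h))
              (sweepVisit-runs ω ω-real a {b = ! kᵛ <ᵉ pos [ ! xᵛ ]} {z = d ⟨$⟩ˡ k} (λ i j → π i < π j) (λ i → π i < toℕ k)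
                (λ {s} {x} hx hk (_ , hp , _) f g → if-< hk (trans (cong (λ v → nat s pos v 0) hx) (hp x)) f (λ le → skips (g (≤⇒≯ le))))
                (λ lt → (λ { refl → <-irrefl refl lt }) , λ h → <-asym lt (subst (π _ <_) (sym πz) h))
                refl (sym πz)
                (λ i j → trans (wtᶠ ag w (toℕ i) (toℕ j) refl) (trans (wtᶠ ag₄ w (toℕ i) (toℕ j) refl)
                           (trans (wtᶠ ag₁ w (toℕ i) (toℕ j) refl) (hω i j))))
                ho₅ S))))
    where
    a = d ⟨$⟩ˡ σ
    Down Up : ℕ → Fin n → Fin n → Set
    Down t i j = Adj U i j × π j < π i × toℕ σ < π i + t
    Up k i j = Adj U i j × π i < π j × π i < k
    clear : ∀ s (x v : Fin n) → (∀ v → toℕ v < toℕ x → row s v ≡ nothing) → toℕ v < toℕ x ⊎ toℕ v ≡ toℕ x →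
            write D′ᵛ (toℕ x) 0 nothing (wt s) D′ᵛ (toℕ v) 0 ≡ nothing
    clear s x v h (inj₁ lt) = trans (write-row D′ᵛ (toℕ x) 0 nothing (wt s) (λ e → <-irrefl (sym e) lt)) (h v lt)
    clear s x v h (inj₂ eq) rewrite eq = write-same D′ᵛ (toℕ x) 0 nothing (wt s)
    k<n : ∀ (t : Fin (suc (toℕ σ))) → toℕ σ ∸ toℕ t < n
    k<n t = ≤-<-trans (m∸n≤m (toℕ σ) (toℕ t)) (Fin.toℕ<n σ)
    d⁻¹-injective : Injective _≡_ _≡_ (d ⟨$⟩ˡ_)
    d⁻¹-injective e = trans (sym (inverseʳ d)) (trans (cong (d ⟨$⟩ʳ_) e) (inverseʳ d))
    vertex : Fin (suc (toℕ σ)) → Fin n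
    vertex t = d ⟨$⟩ˡ Fin.fromℕ< (k<n t)
    z≡ : ∀ t → π (vertex t) + toℕ t ≡ toℕ σ
    z≡ t = trans (cong (_+ toℕ t) (trans (π-vertex G L d perfect _) (Fin.toℕ-fromℕ< (k<n t)))) (m∸n+n≡m (s≤s⁻¹ (Fin.toℕ<n t)))
    vertex-injective : Injective _≡_ _≡_ vertex
    vertex-injective {i} {j} e = Fin.toℕ-injective (+-cancelˡ-≡ (π (vertex i)) _ _
      (trans (z≡ i) (sym (trans (cong (λ v → π v + toℕ j) e) (z≡ j)))))
    finished : ∀ t {i} → suc (toℕ σ) < π i + suc (toℕ t) ⊎ suc (toℕ σ) ≡ π i + suc (toℕ t) →
               toℕ σ < π i + toℕ t ⊎ i ≡ vertex t
    finished t {i} (inj₁ lt) = inj₁ (s≤s⁻¹ (subst (suc (toℕ σ) <_) (+-suc (π i) (toℕ t)) lt))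
    finished t {i} (inj₂ eq) = inj₂ (π-injective (+-cancelʳ-≡ (toℕ t) _ _
      (trans (sym (suc-injective (trans eq (+-suc (π i) (toℕ t))))) (sym (z≡ t)))))
    reached : ∀ {k : Fin n} {i z} → π z ≡ toℕ k → π i < toℕ k ⊎ π i ≡ toℕ k → π i < toℕ k ⊎ i ≡ z
    reached e (inj₁ lt) = inj₁ lt
    reached e (inj₂ eq) = inj₂ (π-injective (trans eq (sym e)))
    initially : ∀ s → (∀ v → toℕ v < n → row s v ≡ nothing) → let s′ = writeW D′ᵛ (toℕ a) 0 𝟘 s in
                Sweeping ω ω-real a (Down 0) (row s′) (row s′)
    initially s h = record { realised = real ; bound = λ _ → ≤∞-refl
      ; upper = λ {i} {j} (_ , _ , lt) → ≤∞-trans ≤∞-top (≤∞-reflexive (sym (cong (_⊕ ω i j) (off λ { refl → early lt })))) }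
      where
      s′ = writeW D′ᵛ (toℕ a) 0 𝟘 s
      off : ∀ {v} → v ≢ a → row s′ v ≡ nothing
      off {v} ne = trans (write-row D′ᵛ (toℕ a) 0 𝟘 (wt s) (ne ∘ sym ∘ Fin.toℕ-injective)) (h v (Fin.toℕ<n v))
      early : ¬ toℕ σ < π a + 0
      early lt = <-irrefl (sym (trans (+-identityʳ (π a)) (π-vertex G L d perfect σ))) lt
      real : ∀ v → Realised G a v (row s′ v)
      real v with v Fin.≟ a
      ... | yes refl = subst (Realised G a a) (sym (write-same D′ᵛ (toℕ a) 0 𝟘 (wt s))) (realised-𝟘 G a)
      ... | no ne    = λ e → contradiction (trans (sym (off ne)) e) λ ()

  chleqTail-bound : ℕ
  chleqTail-bound = suc (n * suc (minPaths-bound + suc (n * 2)))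

  chleqTail-runs : ∀ {r} {R : Set r} {ω δ} → (∀ i j → Realised G i j (ω i j)) → Grown U π π-injective clique ω δ →
    ∀ {s} → (∀ i j → weights s i j ≡ ω i j) → Ordered s →
    Runs chleqTail s chleqTail-bound (λ s′ → ∀ i j → Realised G i j (distance s′ i j) × distance s′ i j ≤∞ δ i j) R
  chleqTail-runs {R = R} {ω} {δ} ω-real Gr {s} hω ho = weaken ≤-refl (λ _ h i j → h i j (Fin.toℕ<n _))
    (for-const n Rows (minPaths-bound + suc (n * 2)) (proj₁ (proj₁ ho)) (λ _ _ ())
      λ σ {s₁} ag h →
        let ho₁ = holdsOrderedGraph-agree G L d perfect ag refl refl refl refl refl ho
            a = d ⟨$⟩ˡ σ
        in minPaths-runs ω-real Gr σ refl (λ i j → trans (wtᶠ ag w (toℕ i) (toℕ j) refl) (hω i j)) ho₁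
           then λ {s₂} ag₂ h₂ →
           let ho₂ = holdsOrderedGraph-agree G L d perfect ag₂ refl refl refl refl refl ho₁
           in weaken ≤-refl (λ {s′} _ (h , h′) i j lt → cover s′ σ h h′ i j (m<1+n⇒m<n∨m≡n lt))
             (for-const n (λ x s → Rows (toℕ σ) s × (∀ j → toℕ j < x → Good s a j)) 1 (proj₁ (proj₁ ho₂))
               ((λ i j lt → subst (λ x → Realised G i j x × x ≤∞ δ i j) (sym (wtᶠ ag₂ D (toℕ i) (toℕ j) refl)) (h i j lt))
               , λ _ ())
               λ x {s₃} ag₃ (h₃ , h₃′) →
                 let ho₃ = holdsOrderedGraph-agree G L d perfect ag₃ refl refl refl refl refl ho₂
                     src≡ = trans (natᶠ ag₃ srcᵛ 0 0 refl) (natᶠ ag₂ srcᵛ 0 0 refl)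
                     new = subst (λ y → Realised G a x y × y ≤∞ δ a x) (sym (wtᶠ ag₃ D′ᵛ (toℕ x) 0 refl)) (h₂ x)
                 in lastW {i = toℕ a} {j = toℕ x} {v = row s₃ x}
                      (trans (cong (λ k → nat s₃ vert k 0) src≡) (proj₂ (proj₂ ho₃) σ)) refl refl
                      ((λ i j lt → put s₃ a x new i j (inj₁ (h₃ i j lt)))
                      , λ j lt → put s₃ a x new a j (fresh {s₃} h₃′ (m<1+n⇒m<n∨m≡n lt)))))
    where
    Good : Store W → Fin n → Fin n → Set (c ⊔ˡ ℓ₁ ⊔ˡ ℓ₂)
    Good s i j = Realised G i j (distance s i j) × distance s i j ≤∞ δ i j
    Rows : ℕ → Store W → Set (c ⊔ˡ ℓ₁ ⊔ˡ ℓ₂)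
    Rows k s = ∀ i j → π i < k → Good s i j
    cover : ∀ s σ → Rows (toℕ σ) s → (∀ j → toℕ j < n → Good s (d ⟨$⟩ˡ σ) j) →
            ∀ i j → π i < toℕ σ ⊎ π i ≡ toℕ σ → Good s i j
    cover s σ h h′ i j (inj₁ lt) = h i j lt
    cover s σ h h′ i j (inj₂ eq) with refl ← π-injective (trans eq (sym (π-vertex G L d perfect σ))) = h′ j (Fin.toℕ<n j)
    fresh : ∀ {s a} {x j : Fin n} → (∀ j → toℕ j < toℕ x → Good s a j) → toℕ j < toℕ x ⊎ toℕ j ≡ toℕ x →
            Good s a j ⊎ (a ≡ a × j ≡ x)
    fresh {j = j} h (inj₁ lt) = inj₁ (h j lt)
    fresh h (inj₂ eq) = inj₂ (refl , Fin.toℕ-injective eq)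
    put : ∀ s a x {v} → Realised G a x v × v ≤∞ δ a x → ∀ i j → Good s i j ⊎ (i ≡ a × j ≡ x) →
          Good (writeW D (toℕ a) (toℕ x) v s) i j
    put s a x {v} new i j h with write D (toℕ a) (toℕ x) v (wt s) D (toℕ i) (toℕ j)
                               | written D (toℕ a) (toℕ x) v (wt s) (toℕ i) (toℕ j) | h
    ... | _ | here e e′ | _ with refl ← Fin.toℕ-injective e | refl ← Fin.toℕ-injective e′ = new
    put s a x new i j h | _ | there _ | inj₁ g = g
    put s a x new i j h | _ | there (inj₁ ne) | inj₂ (refl , refl) = contradiction refl ne
    put s a x new i j h | _ | there (inj₂ ne) | inj₂ (refl , refl) = contradiction refl ne

  chleqAPSP-runs : ∀ {s} → HoldsOrderedGraph G L d perfect s → HoldsWeights G L s →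
    Runs chleqAPSP s (dpc-bound G L d perfect + chleqTail-bound) (APSPSolution G) (NegativeCycle G)
  chleqAPSP-runs (hg , ho) hw = dpc-runs G L d perfect hg ho hw then λ {s₁} _ Rx@((hg₁ , ho₁ , _) , R) →
    -- The reference matrix is taken from an imagined run of the growing phase of Snowball on the
    -- same store. With ⊥ for `R` that run cannot reject, so its final matrix exists.
    let δ , Gr = exists {s₁} (post (growTail-runs G L d perfect {R = ⊥} {s = s₁} Rx))
    in weaken ≤-refl (λ _ h nn → grown-¬negativeCycle G L d perfect s₁ Rx nn Gr
         , λ i j → solve s₁ Rx nn Gr (h i j))
       (chleqTail-runs (Relaxing.realised R) Gr {s₁} (λ _ _ → refl) (hg₁ , ho₁))
    where
    exists : ∀ {s o} → Post (λ s′ → GrownDistances G L d perfect (weights s) (distance s′)) ⊥ o →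
             ∃[ δ ] Grown U π π-injective clique (weights s) δ
    exists (accepted (Gr , _)) = _ , Gr
    solve : ∀ s (Rx : Relaxed G L d perfect s) (nn : NoNegativePair G) {δ} (Gr : Grown U π π-injective clique (weights s) δ) →
            ∀ {i j x} → Realised G i j x × x ≤∞ δ i j → IsDistance G i j x
    solve s Rx nn Gr (f , le) = grown-isDistance G L d perfect s Rx nn Gr _ f le

-- Maximum cardinality search

module _ {n : ℕ} (U : Graph n) where

  -- V v is 1 if v has been visited and 0 otherwise.
  visitedNeighbours : (Fin n → ℕ) → Fin n → ℕ
  visitedNeighbours V v = sum (λ x → if Graph.adj U v x then V x else 0)

  visitedNeighbours≤n : ∀ V v → (∀ x → V x ≤ 1) → visitedNeighbours V v ≤ n
  visitedNeighbours≤n V v h = ≤-trans (sum-bound 1 bound) (≤-reflexive (*-identityʳ n))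
    where
    bound : ∀ x → (if Graph.adj U v x then V x else 0) ≤ 1
    bound x with Graph.adj U v x
    ... | true  = h x
    ... | false = z≤n

  visitedNeighbours-update : ∀ {V V′ u} v → V u ≡ 0 → V′ u ≡ 1 → (∀ x → x ≢ u → V′ x ≡ V x) →
    visitedNeighbours V′ v ≡ [ Graph.adj U v u ]ᵇ + visitedNeighbours V v
  visitedNeighbours-update {V} {V′} {u} v Vu V′u same = begin
    sum f′                  ≡⟨ +-identityʳ _ ⟨
    sum f′ + 0              ≡⟨ cong (sum f′ +_) (zero-at (Graph.adj U v u)) ⟨
    sum f′ + f u            ≡⟨ sum-update {f = f′} {f} u (λ x ne → cong (if Graph.adj U v x then_else 0) (same x ne)) ⟩
    sum f + f′ u            ≡⟨ cong (sum f +_) (cong (if Graph.adj U v u then_else 0) V′u) ⟩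
    sum f + [ Graph.adj U v u ]ᵇ ≡⟨ +-comm (sum f) _ ⟩
    [ Graph.adj U v u ]ᵇ + sum f ∎
    where
    open ≡-Reasoning
    f f′ : Fin n → ℕ
    f x  = if Graph.adj U v x then V x else 0
    f′ x = if Graph.adj U v x then V′ x else 0
    zero-at : ∀ b → (if b then V u else 0) ≡ 0
    zero-at true  = Vu
    zero-at false = refl

  -- In `maximal` the vertex `c` may be unvisited: the choice of `b` is compared at once with
  -- everything that can come later, so numbering `c` creates no new obligation for it.
  record Numbering (V P : Fin n → ℕ) (vt : ℕ → ℕ) (N : ℕ) : Set where
    field
      binary  : ∀ v → V v ≤ 1
      size    : sum V ≡ N
      placed  : ∀ {v} → V v ≡ 1 → P v < N × vt (P v) ≡ toℕ v
      filled  : ∀ {i} → i < N → ∃[ v ] V v ≡ 1 × P v ≡ i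
      maximal : ∀ {a b c} → V a ≡ 1 → V b ≡ 1 → P a < P b → (V c ≡ 1 → P b < P c) → Adj U a c → ¬ Adj U a b →
                ∃[ d ] V d ≡ 1 × P d < P b × Adj U d b × ¬ Adj U d c

  -- The only new case of `maximal` is `b = u`. There `u` has at least as many visited neighbours as
  -- `c`, but `a` counts only for `c`; so some visited `d` counts only for `u`.
  number : ∀ {V V′ P P′ vt vt′ N u} → Numbering V P vt N → V u ≡ 0 →
    (∀ c → V c ≡ 0 → visitedNeighbours V c ≤ visitedNeighbours V u) →
    V′ u ≡ 1 → (∀ v → v ≢ u → V′ v ≡ V v) → P′ u ≡ N → (∀ v → v ≢ u → P′ v ≡ P v) →
    vt′ N ≡ toℕ u → (∀ {i} → i ≢ N → vt′ i ≡ vt i) → Numbering V′ P′ vt′ (suc N)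
  number {V} {V′} {P} {P′} {vt} {vt′} {N} {u} nb Vu best V′u V′≡ P′u P′≡ vt′N vt′≡ = record
    { binary = bin ; size = size′ ; placed = placed′ ; filled = filled′ ; maximal = maximal′ }
    where
    open Numbering nb
    old : ∀ {v} → V v ≡ 1 → v ≢ u
    old h refl with () ← trans (sym h) Vu
    old′ : ∀ {v} → v ≢ u → V′ v ≡ 1 → V v ≡ 1
    old′ ne h = trans (sym (V′≡ _ ne)) h
    keep : ∀ {v} → V v ≡ 1 → V′ v ≡ 1 × P′ v ≡ P v
    keep h = trans (V′≡ _ (old h)) h , P′≡ _ (old h)
    bin : ∀ v → V′ v ≤ 1
    bin v with v Fin.≟ u
    ... | yes refl = ≤-reflexive V′u
    ... | no ne    = ≤-trans (≤-reflexive (V′≡ v ne)) (binary v)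
    size′ : sum V′ ≡ suc N
    size′ = begin
      sum V′          ≡⟨ +-identityʳ _ ⟨
      sum V′ + 0      ≡⟨ cong (sum V′ +_) Vu ⟨
      sum V′ + V u    ≡⟨ sum-update {f = V′} {V} u V′≡ ⟩
      sum V + V′ u    ≡⟨ cong₂ _+_ size V′u ⟩
      N + 1           ≡⟨ +-comm N 1 ⟩
      suc N           ∎
      where open ≡-Reasoning
    placed′ : ∀ {v} → V′ v ≡ 1 → P′ v < suc N × vt′ (P′ v) ≡ toℕ v
    placed′ {v} h with v Fin.≟ u
    ... | yes refl = ≤-reflexive (cong suc P′u) , trans (cong vt′ P′u) vt′N
    ... | no ne with lt , e ← placed (old′ ne h) rewrite P′≡ v ne = m≤n⇒m≤1+n lt , trans (vt′≡ (<⇒≢ lt)) e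
    filled′ : ∀ {i} → i < suc N → ∃[ v ] V′ v ≡ 1 × P′ v ≡ i
    filled′ lt with m<1+n⇒m<n∨m≡n lt
    ... | inj₂ refl = u , V′u , P′u
    ... | inj₁ lt′ with v , h , e ← filled lt′ = v , proj₁ (keep h) , trans (proj₂ (keep h)) e
    maximal′ : ∀ {a b c} → V′ a ≡ 1 → V′ b ≡ 1 → P′ a < P′ b → (V′ c ≡ 1 → P′ b < P′ c) → Adj U a c → ¬ Adj U a b →
               ∃[ d ] V′ d ≡ 1 × P′ d < P′ b × Adj U d b × ¬ Adj U d c
    maximal′ {a} {b} {c} Va Vb a<b b<c a~c a≁b with a Fin.≟ u | b Fin.≟ u
    ... | yes refl | yes refl = contradiction a<b (<-irrefl refl)
    ... | yes refl | no b≢u = contradiction (subst (_< P′ b) P′u a<b)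
            (≤⇒≯ (≤-trans (≤-reflexive (P′≡ b b≢u)) (<⇒≤ (proj₁ (placed (old′ b≢u Vb))))))
    ... | no a≢u | no b≢u with d , Vd , d<b , d~b , d≁c ← maximal (old′ a≢u Va) (old′ b≢u Vb)
              (subst₂ _<_ (P′≡ a a≢u) (P′≡ b b≢u) a<b)
              (λ Vc → subst₂ _<_ (P′≡ b b≢u) (proj₂ (keep Vc)) (b<c (proj₁ (keep Vc)))) a~c a≁b =
      d , proj₁ (keep Vd) , subst₂ _<_ (sym (proj₂ (keep Vd))) (sym (P′≡ b b≢u)) d<b , d~b , d≁c
    ... | no a≢u | yes refl =
      exchange (sum-exceeds {f = λ x → if Graph.adj U c x then V x else 0} {λ x → if Graph.adj U u x then V x else 0} a
               (best c Vc) a-only)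
      where
      Vc : V c ≡ 0
      Vc with c Fin.≟ u
      ... | yes refl = contradiction (b<c V′u) (<-irrefl refl)
      ... | no c≢u with n≤1⇒n≡0∨n≡1 (binary c)
      ...   | inj₁ e = e
      ...   | inj₂ e = contradiction (subst₂ _<_ P′u (P′≡ c c≢u) (b<c (trans (V′≡ c c≢u) e)))
                         (≤⇒≯ (<⇒≤ (proj₁ (placed e))))
      a-only : (if Graph.adj U u a then V a else 0) < (if Graph.adj U c a then V a else 0)
      a-only with Graph.adj U u a in e | Graph.adj U c a in e′
      ... | true  | _     = contradiction (Adj-sym U (subst T (sym e) tt)) a≁b
      ... | false | true  = ≤-reflexive (sym (old′ a≢u Va))
      ... | false | false = contradiction (subst T e′ (Adj-sym U a~c)) id
      exchange : (∃[ d ] (if Graph.adj U c d then V d else 0) < (if Graph.adj U u d then V d else 0)) →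
              ∃[ d ] V′ d ≡ 1 × P′ d < P′ u × Adj U d u × ¬ Adj U d c
      exchange (d , lt) with Graph.adj U u d in e | Graph.adj U c d in e′
      ... | true  | true  = contradiction lt (<-irrefl refl)
      ... | false | true  = contradiction lt λ ()
      ... | false | false = contradiction lt λ ()
      ... | true  | false with n≤1⇒n≡0∨n≡1 (binary d)
      ...   | inj₁ Vd = contradiction (subst (0 <_) Vd lt) λ ()
      ...   | inj₂ Vd = d , proj₁ (keep Vd)
                      , subst₂ _<_ (sym (proj₂ (keep Vd))) (sym P′u) (proj₁ (placed Vd))
                      , Adj-sym U (subst T (sym e) tt) , λ a → subst T e′ (Adj-sym U a)

  complete-numbering : ∀ {V P vt N} → Numbering V P vt N → (∀ v → V v ≡ 1) →
    Σ[ d ∈ Permutation′ n ] (∀ v → P v ≡ toℕ (d ⟨$⟩ʳ v)) × (∀ k → vt (toℕ k) ≡ toℕ (d ⟨$⟩ˡ k)) × Maximal U (position U d)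
  complete-numbering {V} {P} {vt} {N} nb all =
    permutation f g f∘g g∘f , (λ v → sym (Fin.toℕ-fromℕ< (P<n v))) ,
    (λ k → trans (cong vt (sym (proj₂ (proj₂ (filled (k<N k)))))) (proj₂ (placed (all (g k))))) ,
    λ {a} {b} {c} a<b b<c a~c a≁b →
      let d , _ , d<b , d~b , d≁c = maximal (all a) (all b) (subst₂ _<_ (toP a) (toP b) a<b)
                                      (λ _ → subst₂ _<_ (toP b) (toP c) b<c) a~c a≁b
      in d , subst₂ _<_ (sym (toP d)) (sym (toP b)) d<b , d~b , d≁c
    where
    open Numbering nb
    N≡n : N ≡ n
    N≡n = trans (sym size) (trans (sum-cong-≗ all) (trans (sum-const n 1) (*-identityʳ n)))
    P<n : ∀ v → P v < n
    P<n v = subst (P v <_) N≡n (proj₁ (placed (all v)))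
    k<N : ∀ (k : Fin n) → toℕ k < N
    k<N k = subst (toℕ k <_) (sym N≡n) (Fin.toℕ<n k)
    f g : Fin n → Fin n
    f v = Fin.fromℕ< (P<n v)
    g k = proj₁ (filled (k<N k))
    toP : ∀ v → toℕ (f v) ≡ P v
    toP v = Fin.toℕ-fromℕ< (P<n v)
    f∘g : ∀ k → f (g k) ≡ k
    f∘g k = Fin.toℕ-injective (trans (toP (g k)) (proj₂ (proj₂ (filled (k<N k)))))
    g∘f : ∀ v → g (f v) ≡ v
    g∘f v = Fin.toℕ-injective (trans (sym (proj₂ (placed (all (g (f v))))))
      (trans (cong vt (trans (proj₂ (proj₂ (filled (k<N (f v))))) (toP v))) (proj₂ (placed (all v)))))

  -- Bucket j contains, in bk j 0, …, bk j (B j - 1), every unvisited vertex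
  -- whose number C v of visited neighbours is j, besides outdated entries.
  record Buckets (V C : Fin n → ℕ) (B : ℕ → ℕ) (bk : ℕ → ℕ → ℕ) (top : ℕ) : Set where
    field
      listed  : ∀ {v} → V v ≡ 0 → ∃[ i ] i < B (C v) × bk (C v) i ≡ toℕ v
      -- An inequality, because counts grow while old entries stay in place. It suffices for the top
      -- bucket, as no unvisited vertex has a count above `top`.
      entries : ∀ {j i} → i < B j → ∃[ v ] bk j i ≡ toℕ v × (V v ≡ 0 → j ≤ C v)
      empty   : ∀ {j} → top < j → B j ≡ 0

    count≤top : ∀ {v} → V v ≡ 0 → C v ≤ top
    count≤top {v} h with listed h
    ... | i , lt , _ = ≮⇒≥ λ top< → contradiction (subst (i <_) (empty top<) lt) λ ()

  Buckets-raise : ∀ {V C B bk top} → Buckets V C B bk top → Buckets V C B bk (suc top)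
  Buckets-raise b = record { listed = listed ; entries = entries ; empty = λ lt → empty (<-trans (n<1+n _) lt) }
    where open Buckets b

  Buckets-lower : ∀ {V C B bk top} → B top ≡ 0 → Buckets V C B bk top → Buckets V C B bk (top ∸ 1)
  Buckets-lower {B = B} {top = top} e b = record { listed = listed ; entries = entries ; empty = empty′ top e empty }
    where
    open Buckets b
    empty′ : ∀ t → B t ≡ 0 → (∀ {j} → t < j → B j ≡ 0) → ∀ {j} → t ∸ 1 < j → B j ≡ 0
    empty′ zero    e h lt = h lt
    empty′ (suc t) e h lt with m≤n⇒m<n∨m≡n lt
    ... | inj₁ lt′  = h lt′
    ... | inj₂ refl = e

  -- The entry removed may be the one that lists `u`, so `u` must not count as unvisited afterwards.
  pop : ∀ {V V′ C B B′ bk top b u} → Buckets V C B bk top → B top ≡ suc b → bk top b ≡ toℕ u →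
    B′ top ≡ b → (∀ {j} → j ≢ top → B′ j ≡ B j) → (∀ {v} → V′ v ≡ 0 → V v ≡ 0) → V′ u ≢ 0 →
    Buckets V′ C B′ bk top
  pop {V} {V′} {C} {B} {B′} {bk} {top} {b} {u} bs Btop bku B′top B′≡ V′⇒V V′u = record
    { listed = listed′ ; entries = entries′ ; empty = λ lt → trans (B′≡ (<⇒≢ lt ∘ sym)) (empty lt) }
    where
    open Buckets bs
    shrink : ∀ {j i} → i < B′ j → i < B j
    shrink {j} {i} lt with j ≟ top
    ... | yes refl = subst (i <_) (sym Btop) (m≤n⇒m≤1+n (subst (i <_) B′top lt))
    ... | no ne    = subst (i <_) (B′≡ ne) lt
    entries′ : ∀ {j i} → i < B′ j → ∃[ v ] bk j i ≡ toℕ v × (V′ v ≡ 0 → j ≤ C v)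
    entries′ lt with v , e , h ← entries (shrink lt) = v , e , h ∘ V′⇒V
    listed′ : ∀ {v} → V′ v ≡ 0 → ∃[ i ] i < B′ (C v) × bk (C v) i ≡ toℕ v
    listed′ {v} h with i , lt , e ← listed (V′⇒V h) with C v ≟ top
    ... | no ne = i , subst (i <_) (sym (B′≡ ne)) lt , e
    ... | yes refl with m<1+n⇒m<n∨m≡n (subst (i <_) Btop lt)
    ...   | inj₁ lt′  = i , subst (i <_) (sym B′top) lt′ , e
    ...   | inj₂ refl with refl ← Fin.toℕ-injective (trans (sym e) bku) = contradiction h V′u

  -- The former entry of `v` is left where it is; its bucket number merely falls below the new
  -- count.
  push : ∀ {V C C′ B B′ bk bk′ top v} → Buckets V C B bk top → let c = suc (C v) in c ≤ top →
    C′ v ≡ c → (∀ x → x ≢ v → C′ x ≡ C x) → bk′ c (B c) ≡ toℕ v →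
    (∀ {j i} → j ≢ c ⊎ i ≢ B c → bk′ j i ≡ bk j i) → B′ c ≡ suc (B c) → (∀ {j} → j ≢ c → B′ j ≡ B j) →
    Buckets V C′ B′ bk′ top
  push {V} {C} {C′} {B} {B′} {bk} {bk′} {top} {v} bs c≤top C′v C′≡ bk′c bk′≡ B′c B′≡ = record
    { listed = listed′ ; entries = entries′ ; empty = λ lt → trans (B′≡ λ { refl → <⇒≱ lt c≤top }) (empty lt) }
    where
    open Buckets bs
    c = suc (C v)
    grow : ∀ {j i} → i < B j → i < B′ j × bk′ j i ≡ bk j i
    grow {j} {i} lt with j ≟ c
    ... | yes refl = subst (i <_) (sym B′c) (m≤n⇒m≤1+n lt) , bk′≡ (inj₂ (<⇒≢ lt))
    ... | no ne    = subst (i <_) (sym (B′≡ ne)) lt , bk′≡ (inj₁ ne)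
    C≤C′ : ∀ x → C x ≤ C′ x
    C≤C′ x with x Fin.≟ v
    ... | yes refl = subst (C v ≤_) (sym C′v) (n≤1+n _)
    ... | no ne    = ≤-reflexive (sym (C′≡ x ne))
    listed′ : ∀ {x} → V x ≡ 0 → ∃[ i ] i < B′ (C′ x) × bk′ (C′ x) i ≡ toℕ x
    listed′ {x} h with x Fin.≟ v
    ... | yes refl rewrite C′v = B c , ≤-reflexive (sym B′c) , bk′c
    ... | no ne rewrite C′≡ x ne with i , lt , e ← listed h = i , proj₁ (grow lt) , trans (proj₂ (grow lt)) e
    entries′ : ∀ {j i} → i < B′ j → ∃[ x ] bk′ j i ≡ toℕ x × (V x ≡ 0 → j ≤ C′ x)
    entries′ {j} {i} lt with i <? B j
    ... | yes lt′ with x , e , h ← entries lt′ = x , trans (proj₂ (grow lt′)) e , λ V0 → ≤-trans (h V0) (C≤C′ x)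
    ... | no ≮ with j ≟ c
    ...   | no ne = contradiction (subst (i <_) (B′≡ ne) lt) ≮
    ...   | yes refl with refl ← ≤-antisym (s≤s⁻¹ (subst (i <_) B′c lt)) (≮⇒≥ ≮) = v , bk′c , λ _ → ≤-reflexive (sym C′v)

private
  pattern totᵛ = 20
  pattern bszᵛ = 21
  pattern bktᵛ = 22
  pattern cntᵛ = 23
  pattern visᵛ = 24
  pattern numᵛ = 25
  pattern topᵛ = 26
  pattern iᵛ = 27
  pattern uᵛ = 28
  pattern vᵛ = 29
  pattern jᵛ = 30
  pattern stepᵛ = 31

mcsInit mcsPush mcsVisit mcsStep mcs : Cmd
mcsInit = (for iᵛ < ! order run
             ( (bktᵛ [ num 0 ][ ! iᵛ ]≔ ! iᵛ) ⨾
               (totᵛ ≔ ! totᵛ ∔ (deg [ ! iᵛ ] ∔ num 2)))) ⨾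
          (bszᵛ [ num 0 ]≔ ! order)

mcsPush = when visᵛ [ ! vᵛ ] ≡ᵉ num 0 then
            ( (cntᵛ [ ! vᵛ ]≔ cntᵛ [ ! vᵛ ] ∔ num 1) ⨾
              (bktᵛ [ cntᵛ [ ! vᵛ ] ][ bszᵛ [ cntᵛ [ ! vᵛ ] ] ]≔ ! vᵛ) ⨾
              (bszᵛ [ cntᵛ [ ! vᵛ ] ]≔ bszᵛ [ cntᵛ [ ! vᵛ ] ] ∔ num 1))

mcsVisit = when visᵛ [ ! uᵛ ] ≡ᵉ num 0 then
             ( (visᵛ [ ! uᵛ ]≔ num 1) ⨾
               (pos [ ! uᵛ ]≔ ! numᵛ) ⨾
               (vert [ ! numᵛ ]≔ ! uᵛ) ⨾
               (numᵛ ≔ ! numᵛ ∔ num 1) ⨾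
               (for jᵛ < deg [ ! uᵛ ] run ((vᵛ ≔ nbr [ ! uᵛ ][ ! jᵛ ]) ⨾ mcsPush)) ⨾
               (topᵛ ≔ ! topᵛ ∔ num 1))

mcsStep = cond bszᵛ [ ! topᵛ ] ≡ᵉ num 0
          then (topᵛ ≔ ! topᵛ ∸ᵉ num 1)
          else ( (bszᵛ [ ! topᵛ ]≔ bszᵛ [ ! topᵛ ] ∸ᵉ num 1) ⨾
                 (uᵛ ≔ bktᵛ [ ! topᵛ ][ bszᵛ [ ! topᵛ ] ]) ⨾
                 mcsVisit)

-- Entries of a bucket that are outdated because the vertex has been visited
-- are discarded when they are popped. Every step pops an entry or lowers top,
-- and a visit of u pushes at most deg u entries and raises top by 1. Hence
-- n + Σ (deg u + 1) steps suffice.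
mcs = mcsInit ⨾ (for stepᵛ < ! totᵛ run mcsStep)

module _ {c ℓ₁ ℓ₂ : Level} {W : OrderedAbelianGroup c ℓ₁ ℓ₂} where
  open Store

  private
    iterate-amortised : ∀ {q} {x p} k i τ (I : ℕ → ℕ → Store W → Set q) {s} → I i τ s →
      (∀ {i τ s′} → I i τ s′ → ∃[ t ] Runs p (writeN x 0 0 i s′) t (I (suc i) (τ + suc t)) ⊥) →
      let o = iterate (λ i s′ → tick (exec p (writeN x 0 0 i s′))) k i s in
      ∃[ τ′ ] steps o + τ ≤ τ′ × Post (I (i + k) τ′) ⊥ (result o)
    iterate-amortised zero i τ I {s} init body =
      τ , ≤-refl , accepted (subst (λ i → I i τ s) (sym (+-identityʳ i)) init)
    iterate-amortised {x = x} {p} (suc k) i τ I {s} init body with t , r ← body init =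
      aux (exec p (writeN x 0 0 i s)) (time r) (post r)
      where
      F = λ i s′ → tick (exec p (writeN x 0 0 i s′))
      aux : ∀ o → steps o ≤ t → Post (I (suc i) (τ + suc t)) ⊥ (result o) →
            let o′ = continue (tick o) (iterate F k (suc i)) in
            ∃[ τ′ ] steps o′ + τ ≤ τ′ × Post (I (i + suc k) τ′) ⊥ (result o′)
      aux (just s₁ , t₁) t≤ (accepted h)
        with τ′ , le , po ← iterate-amortised {x = x} {p} k (suc i) (τ + suc t) I {s₁} h body =
        τ′ , ≤-trans (rearrange t₁ t (steps (iterate F k (suc i) s₁)) t≤) le
           , subst (λ j → Post (I j τ′) ⊥ (result (iterate F k (suc i) s₁))) (sym (+-suc i k)) po
        where
        eq : ∀ a b d → suc (a + b) + d ≡ b + (d + suc a)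
        eq = solve-∀
        rearrange : ∀ t₁ t b → t₁ ≤ t → suc (t₁ + b) + τ ≤ b + (τ + suc t)
        rearrange t₁ t b h = ≤-trans (≤-reflexive (eq t₁ b τ)) (+-monoʳ-≤ b (+-monoʳ-≤ τ (s≤s h)))

  -- The invariant also bounds the time τ used so far, so that the cost of an
  -- iteration may depend on the state.
  for-amortised : ∀ {q q′} {Q : Store W → Set q′} {x e p s} N b (I : ℕ → ℕ → Store W → Set q) →
    evalN e s ≡ N → I 0 0 s →
    (∀ {i τ s′} → I i τ s′ → ∃[ t ] Runs p (writeN x 0 0 i s′) t (I (suc i) (τ + suc t)) ⊥) →
    (∀ {τ s′} → I N τ s′ → τ ≤ b × Q s′) →
    Runs (for x < e run p) s (suc b) Q ⊥
  for-amortised {Q = Q} {x} {e} {p} {s} N b I refl init body finish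
    with τ , le , po ← iterate-amortised {x = x} {p} (evalN e s) 0 0 I init body =
      let t , po′ = aux po in runs (s≤s t) po′
    where
    o = iterate (λ i s′ → tick (exec p (writeN x 0 0 i s′))) (evalN e s) 0 s
    aux : Post (I N τ) ⊥ (result o) → steps o ≤ b × Post Q ⊥ (result o)
    aux po with result o | po
    ... | _ | accepted h = ≤-trans (≤-trans (≤-reflexive (sym (+-identityʳ _))) le) (proj₁ (finish h)) , accepted (proj₂ (finish h))

  module _ {n : ℕ} {U : Graph n} (L : AdjacencyLists U) where
    open GraphInput {W = W} L

    private
      -- Counts of unvisited vertices are at most `n`, and a push uses the bucket one above; hence
      -- buckets up to number `suc n`.
      total : (ℕ → ℕ) → ℕ
      total B = sum {2 + n} (B ∘ toℕ)

      total-suc : ∀ {B B′ j} → j < 2 + n → B′ j ≡ suc (B j) → (∀ {i} → i ≢ j → B′ i ≡ B i) → total B′ ≡ suc (total B)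
      total-suc {B} {B′} {j} lt e same = +-cancelʳ-≡ (B j) _ _ (begin
        total B′ + B j                ≡⟨ cong (λ k → total B′ + B k) toℕ-j ⟨
        total B′ + B (toℕ jᶠ)         ≡⟨ sum-update {f = B′ ∘ toℕ} {B ∘ toℕ} jᶠ
                                           (λ i ne → same λ e′ → ne (Fin.toℕ-injective (trans e′ (sym toℕ-j)))) ⟩
        total B + B′ (toℕ jᶠ)         ≡⟨ cong (λ k → total B + B′ k) toℕ-j ⟩
        total B + B′ j                ≡⟨ cong (total B +_) e ⟩
        total B + suc (B j)           ≡⟨ +-suc (total B) (B j) ⟩
        suc (total B) + B j           ∎)
        where
        open ≡-Reasoning
        jᶠ = Fin.fromℕ< lt
        toℕ-j = Fin.toℕ-fromℕ< lt

      cost : (Fin n → ℕ) → ℕ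
      cost V = sum (λ v → V v * suc (degree v))

      cost-visit : ∀ {V V′ : Fin n → ℕ} {u} → V u ≡ 0 → V′ u ≡ 1 → (∀ v → v ≢ u → V′ v ≡ V v) →
                   cost V′ ≡ cost V + suc (degree u)
      cost-visit {V} {V′} {u} Vu V′u same = begin
        cost V′                                ≡⟨ +-identityʳ _ ⟨
        cost V′ + 0 * suc (degree u)           ≡⟨ cong (λ x → cost V′ + x * suc (degree u)) Vu ⟨
        cost V′ + V u * suc (degree u)         ≡⟨ sum-update {f = λ v → V′ v * suc (degree v)} {λ v → V v * suc (degree v)} u
                                                    (λ v ne → cong (_* suc (degree v)) (same v ne)) ⟩
        cost V + V′ u * suc (degree u)         ≡⟨ cong (λ x → cost V + x * suc (degree u)) V′u ⟩
        cost V + 1 * suc (degree u)            ≡⟨ cong (cost V +_) (*-identityˡ _) ⟩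
        cost V + suc (degree u)                ∎
        where open ≡-Reasoning

      cost≤ : ∀ {V : Fin n → ℕ} → (∀ v → V v ≤ 1) → cost V ≤ n + sum degree
      cost≤ h = ≤-trans (sum-mono (λ v → ≤-trans (*-monoˡ-≤ (suc (degree v)) (h v)) (≤-reflexive (*-identityˡ _))))
        (≤-trans (≤-reflexive (∑-distrib-+ (λ _ → 1) degree)) (+-monoˡ-≤ (sum degree)
          (≤-reflexive (trans (sum-const n 1) (*-identityʳ n)))))

      cntOf : Store W → Fin n → ℕ
      cntOf s v = nat s cntᵛ (toℕ v) 0

      bszOf : Store W → ℕ → ℕ
      bszOf s j = nat s bszᵛ j 0

      topOf : Store W → ℕ
      topOf s = nat s topᵛ 0 0

      -- The part of the state that is constant while the neighbours of a
      -- vertex are counted is held by functions that do not mention the store.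
      record Frozen (V P : Fin n → ℕ) (vt : ℕ → ℕ) (N : ℕ) (s : Store W) : Set where
        field
          vis≡  : ∀ v → nat s visᵛ (toℕ v) 0 ≡ V v
          pos≡  : ∀ v → nat s pos (toℕ v) 0 ≡ P v
          vert≡ : ∀ i → nat s vert i 0 ≡ vt i
          num≡  : nat s numᵛ 0 0 ≡ N

      -- `k` counts steps and `τ` time. A step that visits nothing lowers the number of entries plus
      -- `top` by 1. A visit of `u` also adds at most `degree u` entries and raises `top`, paid for
      -- by the increase `suc (degree u)` of `cost`. The first alternative of `progress` covers the
      -- idle steps at the end.
      record Search (V P : Fin n → ℕ) (vt : ℕ → ℕ) (N : ℕ) (C : Fin n → ℕ) (B : ℕ → ℕ) (bk : ℕ → ℕ → ℕ)
                    (top k τ : ℕ) : Set where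
        field
          numbering : Numbering U V P vt N
          counts    : ∀ {v} → V v ≡ 0 → C v ≡ visitedNeighbours U V v
          buckets   : Buckets U V C B bk top
          top≤N     : top ≤ N
          progress  : (∀ v → V v ≡ 1) ⊎ k + total B + top ≤ n + cost V
          -- A step takes at most 11 units, and a visit another 6 for each neighbour.
          timely    : τ ≤ k * 11 + cost V * 6

      Inv : ℕ → ℕ → Store W → Set
      Inv k τ s = HoldsGraph s × Σ[ V ∈ (Fin n → ℕ) ] Σ[ P ∈ (Fin n → ℕ) ] Σ[ vt ∈ (ℕ → ℕ) ] ∃[ N ]
        Frozen V P vt N s × Search V P vt N (cntOf s) (bszOf s) (nat s bktᵛ) (topOf s) k τ

      later : ∀ {k τ t y} → t ≤ 10 → τ ≤ k * 11 + y → τ + suc t ≤ suc k * 11 + y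
      later {k} {τ} {t} {y} t≤ h = ≤-trans (+-mono-≤ h (s≤s t≤)) (≤-reflexive (eq (k * 11) y))
        where
        eq : ∀ a b → a + b + 11 ≡ 11 + a + b
        eq = solve-∀

      no-entries⇒visited : ∀ {V C B bk top} → (∀ v → V v ≤ 1) → Buckets U V C B bk top →
                           (∀ {v} → V v ≡ 0 → B (C v) ≡ 0) → ∀ v → V v ≡ 1
      no-entries⇒visited binary bs none v with n≤1⇒n≡0∨n≡1 (binary v)
      ... | inj₂ e = e
      ... | inj₁ e with i , lt , _ ← Buckets.listed bs e = contradiction (subst (i <_) (none e) lt) λ ()

      module _ {V P : Fin n → ℕ} {vt : ℕ → ℕ} {N : ℕ} {C : Fin n → ℕ} {B : ℕ → ℕ} {bk : ℕ → ℕ → ℕ}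
               {top k τ : ℕ} (S : Search V P vt N C B bk top k τ) where
        open Search S
        open Numbering numbering
        open Buckets buckets

        C≤n : ∀ {v} → V v ≡ 0 → C v ≤ n
        C≤n e = ≤-trans (≤-reflexive (counts e)) (visitedNeighbours≤n U V _ binary)

        N≤n : N ≤ n
        N≤n = subst (_≤ n) size (≤-trans (sum-bound 1 binary) (≤-reflexive (*-identityʳ n)))

        lower : B top ≡ 0 → Search V P vt N C B bk (top ∸ 1) (suc k) (τ + 3)
        lower e = record
          { numbering = numbering ; counts = counts ; buckets = Buckets-lower U e buckets
          ; top≤N = ≤-trans (m∸n≤m top 1) top≤N ; progress = next-progress progress ; timely = later {k} {t = 2} (s≤s (s≤s z≤n)) timely }
          where
          step-down : ∀ t → (∀ {j} → t < j → B j ≡ 0) → B t ≡ 0 → k + total B + t ≤ n + cost V →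
                      (∀ v → V v ≡ 1) ⊎ suc k + total B + (t ∸ 1) ≤ n + cost V
          -- Truncated subtraction cannot lower `top` any further, but then all buckets are empty
          -- and every vertex has been visited.
          step-down zero    h e le = inj₁ (no-entries⇒visited binary buckets λ {v} _ → none (C v))
            where
            none : ∀ j → B j ≡ 0
            none zero    = e
            none (suc j) = h z<s
          step-down (suc t) h e le = inj₂ (subst (_≤ n + cost V) (+-suc (k + total B) t) le)
          next-progress : (∀ v → V v ≡ 1) ⊎ k + total B + top ≤ n + cost V →
                          (∀ v → V v ≡ 1) ⊎ suc k + total B + (top ∸ 1) ≤ n + cost V
          next-progress (inj₁ h)  = inj₁ h
          next-progress (inj₂ le) = step-down top empty e le

        module _ {B′ : ℕ → ℕ} {b : ℕ} {u : Fin n} (Btop : B top ≡ suc b) (bku : bk top b ≡ toℕ u) (B′top : B′ top ≡ b)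
                 (B′≡ : ∀ {j} → j ≢ top → B′ j ≡ B j) where

          total-pop : total B ≡ suc (total B′)
          total-pop = total-suc {B′} {B} {top} (s≤s (m≤n⇒m≤1+n (≤-trans top≤N N≤n))) (trans Btop (cong suc (sym B′top))) (sym ∘ B′≡)

          discard : V u ≢ 0 → Search V P vt N C B′ bk top (suc k) (τ + 6)
          discard Vu = record
            { numbering = numbering ; counts = counts ; buckets = pop U buckets Btop bku B′top B′≡ id Vu ; top≤N = top≤N
            ; progress = next-progress progress ; timely = later {k} {t = 5} (s≤s (s≤s (s≤s (s≤s (s≤s z≤n))))) timely }
            where
            next-progress : (∀ v → V v ≡ 1) ⊎ k + total B + top ≤ n + cost V →
                            (∀ v → V v ≡ 1) ⊎ suc k + total B′ + top ≤ n + cost V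
            next-progress (inj₁ h)  = inj₁ h
            next-progress (inj₂ le) = inj₂ (subst (λ x → x + top ≤ n + cost V)
                                              (trans (cong (k +_) total-pop) (+-suc k (total B′))) le)

          module _ (Vu : V u ≡ 0) where

            C-maximal : ∀ x → V x ≡ 0 → visitedNeighbours U V x ≤ visitedNeighbours U V u
            C-maximal x Vx = subst₂ _≤_ (counts Vx) (counts Vu) (≤-trans (count≤top Vx) top≤Cu)
              where
              top≤Cu : top ≤ C u
              top≤Cu with v , e , h ← entries {top} {b} (≤-reflexive (sym Btop))
                with refl ← Fin.toℕ-injective (trans (sym e) bku) = h Vu

            visit : ∀ {V′ P′ vt′ C′ B″ bk′} → V′ u ≡ 1 → (∀ v → v ≢ u → V′ v ≡ V v) → P′ u ≡ N → (∀ v → v ≢ u → P′ v ≡ P v) →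
              vt′ N ≡ toℕ u → (∀ {i} → i ≢ N → vt′ i ≡ vt i) →
              (∀ v → V′ v ≡ 0 → (Seen u (degree u) v → C′ v ≡ suc (C v)) × (¬ Seen u (degree u) v → C′ v ≡ C v)) →
              Buckets U V′ C′ B″ bk′ (suc top) → total B″ ≤ total B′ + degree u →
              Search V′ P′ vt′ (suc N) C′ B″ bk′ (suc top) (suc k) (τ + suc (10 + degree u * 6))
            visit {V′} {P′} {vt′} {C′} {B″} V′u V′≡ P′u P′≡ vt′N vt′≡ C′≡ bs total≤ = record
              { numbering = number U numbering Vu C-maximal V′u V′≡ P′u P′≡ vt′N vt′≡ ; counts = counts′ ; buckets = bs
              ; top≤N = s≤s top≤N ; progress = next-progress progress ; timely = timely′ }
              where
              unvisited : ∀ {v} → V′ v ≡ 0 → V v ≡ 0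
              unvisited {v} h with v Fin.≟ u
              ... | yes refl = Vu
              ... | no ne    = trans (sym (V′≡ v ne)) h
              counts′ : ∀ {v} → V′ v ≡ 0 → C′ v ≡ visitedNeighbours U V′ v
              counts′ {v} h = trans (count (adj? U v u)) (sym (visitedNeighbours-update U v Vu V′u V′≡))
                where
                count : Dec (Adj U v u) → C′ v ≡ [ Graph.adj U v u ]ᵇ + visitedNeighbours U V v
                count (yes a) = trans (proj₁ (C′≡ v h) (Seen-all (Adj-sym U a)))
                  (cong₂ _+_ (sym (T⇒[]ᵇ≡1 a)) (counts (unvisited h)))
                count (no ¬a) = trans (proj₂ (C′≡ v h) (¬a ∘ Adj-sym U ∘ Seen-adj))
                  (cong₂ _+_ (sym (¬T⇒[]ᵇ≡0 (Graph.adj U v u) ¬a)) (counts (unvisited h)))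
                  where
                  ¬T⇒[]ᵇ≡0 : ∀ x → ¬ T x → [ x ]ᵇ ≡ 0
                  ¬T⇒[]ᵇ≡0 true  h = contradiction tt h
                  ¬T⇒[]ᵇ≡0 false h = refl
              cost≡ : cost V′ ≡ cost V + suc (degree u)
              cost≡ = cost-visit {V} {V′} Vu V′u V′≡
              next-progress : (∀ v → V v ≡ 1) ⊎ k + total B + top ≤ n + cost V →
                              (∀ v → V′ v ≡ 1) ⊎ suc k + total B″ + suc top ≤ n + cost V′
              next-progress (inj₁ h) with () ← trans (sym Vu) (h u)
              next-progress (inj₂ le) = inj₂ (begin
                suc k + total B″ + suc top               ≤⟨ +-monoˡ-≤ (suc top) (+-monoʳ-≤ (suc k) total≤) ⟩
                suc k + (total B′ + degree u) + suc top  ≡⟨ eq k (total B′) (degree u) top ⟩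
                k + suc (total B′) + top + suc (degree u) ≡⟨ cong (λ x → k + x + top + suc (degree u)) total-pop ⟨
                k + total B + top + suc (degree u)       ≤⟨ +-monoˡ-≤ (suc (degree u)) le ⟩
                n + cost V + suc (degree u)              ≡⟨ +-assoc n (cost V) _ ⟩
                n + (cost V + suc (degree u))            ≡⟨ cong (n +_) cost≡ ⟨
                n + cost V′                              ∎)
                where
                open ≤-Reasoning
                eq : ∀ a b d t → suc a + (b + d) + suc t ≡ a + suc b + t + suc d
                eq = solve-∀
              timely′ : τ + suc (10 + degree u * 6) ≤ suc k * 11 + cost V′ * 6
              timely′ = begin
                τ + suc (10 + degree u * 6)                       ≤⟨ +-monoˡ-≤ _ timely ⟩
                k * 11 + cost V * 6 + suc (10 + degree u * 6)     ≤⟨ m≤m+n _ 6 ⟩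
                k * 11 + cost V * 6 + suc (10 + degree u * 6) + 6 ≡⟨ eq k (cost V) (degree u) ⟩
                suc k * 11 + (cost V + suc (degree u)) * 6        ≡⟨ cong (λ x → suc k * 11 + x * 6) cost≡ ⟨
                suc k * 11 + cost V′ * 6                          ∎
                where
                open ≤-Reasoning
                eq : ∀ k x d → k * 11 + x * 6 + suc (10 + d * 6) + 6 ≡ suc k * 11 + (x + suc d) * 6
                eq = solve-∀

        -- After this many steps the budget of `progress` is spent and no entry is left, whereas an
        -- unvisited vertex would still be listed.
        finished : k ≡ sum degree + n * 2 → ∀ v → V v ≡ 1
        finished k≡ with progress
        ... | inj₁ h  = h
        ... | inj₂ le = no-entries⇒visited binary buckets λ {v} e → none (C v) (m≤n⇒m≤1+n (C≤n e))
          where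
          total≡0 : total B ≤ 0
          total≡0 = ≤-trans (m≤m+n (total B) top) (+-cancelˡ-≤ k _ _ (begin
            k + (total B + top)      ≡⟨ +-assoc k (total B) top ⟨
            k + total B + top        ≤⟨ le ⟩
            n + cost V               ≤⟨ +-monoʳ-≤ n (cost≤ binary) ⟩
            n + (n + sum degree)     ≡⟨ eq n (sum degree) ⟩
            sum degree + n * 2 + 0   ≡⟨ cong (_+ 0) k≡ ⟨
            k + 0                    ∎))
            where
            open ≤-Reasoning
            eq : ∀ a b → a + (a + b) ≡ b + a * 2 + 0
            eq = solve-∀
          none : ∀ j → j ≤ suc n → B j ≡ 0
          none j j≤ = n≤0⇒n≡0 (≤-trans (subst (λ i → B i ≤ total B) (Fin.toℕ-fromℕ< (s≤s j≤)) (sum-term (B ∘ toℕ) (Fin.fromℕ< (s≤s j≤)))) total≡0)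

      module _ {V₁ C₀ : Fin n → ℕ} {top b₀ : ℕ} {u : Fin n} (C₀≤n : ∀ {v} → V₁ v ≡ 0 → C₀ v ≤ n)
               (C₀≤top : ∀ {v} → V₁ v ≡ 0 → C₀ v ≤ top) where

        Pushed : ℕ → Store W → Set
        Pushed p s = (∀ v → V₁ v ≡ 0 → (Seen u p v → cntOf s v ≡ suc (C₀ v)) × (¬ Seen u p v → cntOf s v ≡ C₀ v)) ×
                     Buckets U V₁ (cntOf s) (bszOf s) (nat s bktᵛ) (suc top) × total (bszOf s) ≤ b₀ + p

        push-runs : ∀ {s} p → let v = neighbour u p in nat s vᵛ 0 0 ≡ toℕ v → nat s visᵛ (toℕ v) 0 ≡ V₁ v →
                    Pushed (toℕ p) s → Runs mcsPush s 4 (Pushed (suc (toℕ p))) ⊥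
        push-runs {s} p hv hvis (counts , bs , total≤) = if-≡ (trans (cong (λ v → nat s visᵛ v 0) hv) hvis) refl
          (λ V0 → assignN {i = toℕ v} {0} {cᵥ} hv refl (trans (+-comm _ 1) (cong (λ v → suc (nat s cntᵛ v 0)) hv))
            (assignN {i = cᵥ} {bszOf s cᵥ} {toℕ v} c≡ (cong (λ j → nat s bszᵛ j 0) c≡) hv
              (lastN {i = cᵥ} {0} {suc (bszOf s cᵥ)} c≡ refl (trans (+-comm _ 1) (cong (λ j → suc (nat s bszᵛ j 0)) c≡))
                (pushed V0))))
          (λ V≢0 → skips (((λ x V0 → (λ seen → proj₁ (counts x V0) (stay V≢0 V0 (Seen-suc p seen)))
                                   , (λ ¬seen → proj₂ (counts x V0) (¬seen ∘ Seen-step)))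
                          , bs , ≤-trans total≤ (+-monoʳ-≤ b₀ (n≤1+n _)))))
          where
          v = neighbour u p
          cᵥ = suc (cntOf s v)
          s₁ s₃ : Store W
          s₁ = writeN cntᵛ (toℕ v) 0 cᵥ s
          s₃ = writeN bszᵛ cᵥ 0 (suc (bszOf s cᵥ)) (writeN bktᵛ cᵥ (bszOf s cᵥ) (toℕ v) s₁)
          c≡ : nat s₁ cntᵛ (nat s₁ vᵛ 0 0) 0 ≡ cᵥ
          c≡ = trans (cong (λ x → nat s₁ cntᵛ x 0) hv) (write-same cntᵛ (toℕ v) 0 cᵥ (nat s))
          stay : V₁ v ≢ 0 → ∀ {x} → V₁ x ≡ 0 → Seen u (toℕ p) x ⊎ v ≡ x → Seen u (toℕ p) x
          stay V≢0 V0 (inj₁ h)    = h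
          stay V≢0 V0 (inj₂ refl) = contradiction V0 V≢0
          module _ (V0 : V₁ v ≡ 0) where
            cv≡ : cntOf s v ≡ C₀ v
            -- Each neighbour is listed once, so `v` has not been counted yet in this visit.
            cv≡ = proj₂ (counts v V0) (Seen-next p)
            cnt-same : cntOf s₃ v ≡ cᵥ
            cnt-same = write-same cntᵛ (toℕ v) 0 cᵥ (nat s)
            cnt-other : ∀ x → x ≢ v → cntOf s₃ x ≡ cntOf s x
            cnt-other x ne = write-row cntᵛ (toℕ v) 0 cᵥ (nat s) (ne ∘ sym ∘ Fin.toℕ-injective)
            bsz-same : bszOf s₃ cᵥ ≡ suc (bszOf s cᵥ)
            bsz-same = write-same bszᵛ cᵥ 0 (suc (bszOf s cᵥ)) (nat s)
            bsz-other : ∀ {j} → j ≢ cᵥ → bszOf s₃ j ≡ bszOf s j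
            bsz-other ne = write-row bszᵛ cᵥ 0 (suc (bszOf s cᵥ)) (nat s) (ne ∘ sym)
            bkt-other : ∀ {j i} → j ≢ cᵥ ⊎ i ≢ bszOf s cᵥ → nat s₃ bktᵛ j i ≡ nat s bktᵛ j i
            bkt-other (inj₁ ne) = write-row bktᵛ cᵥ (bszOf s cᵥ) (toℕ v) (nat s) (ne ∘ sym)
            bkt-other (inj₂ ne) = write-col bktᵛ cᵥ (bszOf s cᵥ) (toℕ v) (nat s) (ne ∘ sym)
            counts′ : ∀ x → V₁ x ≡ 0 → (Seen u (suc (toℕ p)) x → cntOf s₃ x ≡ suc (C₀ x)) ×
                                       (¬ Seen u (suc (toℕ p)) x → cntOf s₃ x ≡ C₀ x)
            counts′ x Vx with x Fin.≟ v
            ... | yes refl = (λ _ → trans cnt-same (cong suc cv≡)) , λ ¬seen → contradiction (Seen-here p) ¬seen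
            ... | no ne = (λ seen → trans (cnt-other x ne) (proj₁ (counts x Vx) (older (Seen-suc p seen))))
                        , λ ¬seen → trans (cnt-other x ne) (proj₂ (counts x Vx) (¬seen ∘ Seen-step))
              where
              older : Seen u (toℕ p) x ⊎ v ≡ x → Seen u (toℕ p) x
              older (inj₁ h) = h
              older (inj₂ e) = contradiction (sym e) ne
            pushed : Pushed (suc (toℕ p)) s₃
            pushed = counts′
              , push U bs (s≤s (≤-trans (≤-reflexive cv≡) (C₀≤top V0))) cnt-same cnt-other
                  (write-same bktᵛ cᵥ (bszOf s cᵥ) (toℕ v) (nat s)) bkt-other bsz-same bsz-other
              , (begin
                  total (bszOf s₃)     ≡⟨ total-suc {bszOf s} {bszOf s₃} {cᵥ} (s≤s (s≤s (≤-trans (≤-reflexive cv≡) (C₀≤n V0)))) bsz-same bsz-other ⟩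
                  suc (total (bszOf s)) ≤⟨ s≤s total≤ ⟩
                  suc (b₀ + toℕ p)     ≡⟨ +-suc b₀ (toℕ p) ⟨
                  b₀ + suc (toℕ p)     ∎)
              where open ≤-Reasoning

      mcsStep-runs : ∀ {k τ s} → Inv k τ s → ∃[ t ] Runs mcsStep (writeN stepᵛ 0 0 k s) t (Inv (suc k) (τ + suc t)) ⊥
      mcsStep-runs {k} {τ} {s} (hg , V , P , vt , N , F , S) = by-size (bszOf s top) refl
        where
        open Frozen F
        open Search S
        top = topOf s
        Result = ∃[ t ] Runs mcsStep (writeN stepᵛ 0 0 k s) t (Inv (suc k) (τ + suc t)) ⊥
        module _ {b : ℕ} {u : Fin n} (eq : bszOf s top ≡ suc b) (bku : nat s bktᵛ top b ≡ toℕ u) where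
          s₂ s₆ : Store W
          s₂ = writeN uᵛ 0 0 (toℕ u) (writeN bszᵛ top 0 b (writeN stepᵛ 0 0 k s))
          s₆ = writeN numᵛ 0 0 (suc N) (writeN vert N 0 (toℕ u) (writeN pos (toℕ u) 0 N (writeN visᵛ (toℕ u) 0 1 s₂)))
          bsz-same : bszOf s₂ top ≡ b
          bsz-same = write-same bszᵛ top 0 b (nat s)
          bsz-other : ∀ {j} → j ≢ top → bszOf s₂ j ≡ bszOf s j
          bsz-other ne = write-row bszᵛ top 0 b (nat s) (ne ∘ sym)
          popped : ∀ {t} {Q : Store W → Set} → Runs mcsVisit s₂ t Q ⊥ → Runs mcsStep (writeN stepᵛ 0 0 k s) (3 + t) Q ⊥
          popped r = if-≡ eq refl (λ ()) λ _ →
            assignN {i = top} {0} {b} refl refl (cong (_∸ 1) eq)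
              (assignN {i = 0} {0} {toℕ u} refl refl (trans (cong (nat s bktᵛ top) bsz-same) bku) r)
          stale : V u ≢ 0 → Result
          stale V≢0 = 5 , popped (if-≡ (vis≡ u) refl (λ e → contradiction e V≢0) λ _ →
            skips (hg , V , P , vt , N , record { vis≡ = vis≡ ; pos≡ = pos≡ ; vert≡ = vert≡ ; num≡ = num≡ }
                  , discard S eq bku bsz-same bsz-other V≢0))
          fresh : V u ≡ 0 → Result
          -- The 10 consists of 3 for popping, 1 for the test, 4 assignments, 1 for entering the
          -- loop and 1 for raising `top`.
          fresh V0 = 10 + degree u * 6 , within (≤-reflexive (cong (8 +_) (+-comm (suc (degree u * 6)) 1)))
            (popped (if-≡ (vis≡ u) refl
              (λ _ → assignN {i = toℕ u} {0} {1} refl refl refl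
                (assignN {i = toℕ u} {0} {N} refl refl num≡
                (assignN {i = N} {0} {toℕ u} num≡ refl refl
                (assignN {i = 0} {0} {suc N} refl refl (trans (+-comm _ 1) (cong suc num≡))
                (neighbours-rule u (Pushed C₀≤n C₀≤top) 4 refl refl refl hg (λ ag _ → holdsGraph-agree ag refl refl refl hg) refl
                  ((λ v _ → (⊥-elim ∘ Seen-zero) , λ _ → refl)
                  , Buckets-raise U (pop U buckets eq bku bsz-same bsz-other V₁⇒V (λ e → contradiction (trans (sym V₁u) e) λ ()))
                  , ≤-reflexive (sym (+-identityʳ _)))
                  (λ p ag J → push-runs C₀≤n C₀≤top p refl (natᶠ ag visᵛ (toℕ (neighbour u p)) 0 refl) J)
                then λ {s₇} ag (counts′ , bs′ , total≤) →
                  lastN {i = 0} {0} {suc top} refl refl (trans (+-comm _ 1) (cong suc (natᶠ ag topᵛ 0 0 refl)))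
                    ( holdsGraph-agree ag refl refl refl hg , V₁ , P₁ , vt₁ , suc N
                    , record { vis≡ = λ v → natᶠ ag visᵛ (toℕ v) 0 refl ; pos≡ = λ v → natᶠ ag pos (toℕ v) 0 refl
                             ; vert≡ = λ i → natᶠ ag vert i 0 refl ; num≡ = natᶠ ag numᵛ 0 0 refl }
                    , visit S eq bku bsz-same bsz-other V0 V₁u V₁≡
                        (write-same pos (toℕ u) 0 N (nat s))
                        (λ v ne → trans (write-row pos (toℕ u) 0 N (nat s) (ne ∘ sym ∘ Fin.toℕ-injective)) (pos≡ v))
                        (write-same vert N 0 (toℕ u) (nat s))
                        (λ {i} ne → trans (write-row vert N 0 (toℕ u) (nat s) (ne ∘ sym)) (vert≡ i))
                        counts′ bs′ total≤))))))
              (λ V≢0 → contradiction V0 V≢0)))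
            where
            V₁ P₁ : Fin n → ℕ
            V₁ v = nat s₆ visᵛ (toℕ v) 0
            P₁ v = nat s₆ pos (toℕ v) 0
            vt₁ : ℕ → ℕ
            vt₁ i = nat s₆ vert i 0
            V₁u : V₁ u ≡ 1
            V₁u = write-same visᵛ (toℕ u) 0 1 (nat s)
            V₁≡ : ∀ v → v ≢ u → V₁ v ≡ V v
            V₁≡ v ne = trans (write-row visᵛ (toℕ u) 0 1 (nat s) (ne ∘ sym ∘ Fin.toℕ-injective)) (vis≡ v)
            V₁⇒V : ∀ {v} → V₁ v ≡ 0 → V v ≡ 0
            V₁⇒V {v} h with v Fin.≟ u
            ... | yes refl = V0
            ... | no ne    = trans (sym (V₁≡ v ne)) h
            C₀≤n : ∀ {v} → V₁ v ≡ 0 → cntOf s v ≤ n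
            C₀≤n h = C≤n S (V₁⇒V h)
            C₀≤top : ∀ {v} → V₁ v ≡ 0 → cntOf s v ≤ top
            C₀≤top h = Buckets.count≤top buckets (V₁⇒V h)
        by-size : ∀ x → bszOf s top ≡ x → Result
        by-size zero eq = 2 , if-≡ eq refl (λ _ → lastN refl refl refl
          (hg , V , P , vt , N , record { vis≡ = vis≡ ; pos≡ = pos≡ ; vert≡ = vert≡ ; num≡ = num≡ } , lower S eq)) λ ne → contradiction refl ne
        by-size (suc b) eq with u , bku , _ ← Buckets.entries buckets {top} {b} (≤-reflexive (sym eq)) | V u ≟ 0
        ... | yes V0 = fresh eq bku V0
        ... | no V≢0 = stale eq bku V≢0

      -- Apart from the ordering that it outputs, the search works on names from 20 on, whereas
      -- `testEdges` writes below 20; so this survives a preceding test.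
      Fresh : Store W → Set
      Fresh s = ∀ a i j → nat s (20 + a) i j ≡ 0

      mcsInit-runs : ∀ {s} → HoldsGraph s → Fresh s →
        Runs mcsInit s (suc (n * 3) + 1) (λ s′ → Inv 0 0 s′ × nat s′ totᵛ 0 0 ≡ sum degree + n * 2) ⊥
      mcsInit-runs {s} hg fr =
        for-const n (λ i s → (∀ v → toℕ v < i → nat s bktᵛ 0 (toℕ v) ≡ toℕ v) × nat s totᵛ 0 0 ≡ partial i) 2
          (proj₁ hg) ((λ _ ()) , trans (fr 0 0 0) (sym partial-zero))
          (λ v {s₁} ag (hb , ht) →
            let hg₁ = holdsGraph-agree ag refl refl refl hg in
            assignN {i = 0} {toℕ v} {toℕ v} refl refl refl
              (lastN {i = 0} {0} {partial (suc (toℕ v))} refl refl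
                (trans (cong₂ (λ x y → x + (y + 2)) ht (proj₁ (proj₂ hg₁) v)) (sym (partial-suc v)))
                ((λ x lt → fill s₁ v x hb (m<1+n⇒m<n∨m≡n lt)) , refl)))
        then λ {s₁} ag (hb , ht) →
          let hg₁ = holdsGraph-agree ag refl refl refl hg in
          lastN {i = 0} {0} {n} refl refl (proj₁ hg₁)
            ((hg₁ , (λ _ → 0) , (λ v → nat s₁ pos (toℕ v) 0) , (λ i → nat s₁ vert i 0) , 0
             , record { vis≡ = λ v → trans (natᶠ ag visᵛ (toℕ v) 0 refl) (fr 4 (toℕ v) 0) ; pos≡ = λ _ → refl ; vert≡ = λ _ → refl
                      ; num≡ = trans (natᶠ ag numᵛ 0 0 refl) (fr 5 0 0) }
             , initially s₁ hb (λ j → trans (natᶠ ag bszᵛ j 0 refl) (fr 1 j 0)) (λ j → trans (natᶠ ag cntᵛ j 0 refl) (fr 3 j 0))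
                 (trans (natᶠ ag topᵛ 0 0 refl) (fr 6 0 0)))
            , trans ht partial-n)
        where
        -- The value of `tot` after `i` iterations, written as a sum over all vertices so that
        -- `sum-update` yields the next one.
        partial : ℕ → ℕ
        partial i = sum (λ v → if does (toℕ v <? i) then degree v + 2 else 0)
        partial-zero : partial 0 ≡ 0
        partial-zero = trans (sum-const n 0) (*-zeroʳ n)
        partial-suc : ∀ v → partial (suc (toℕ v)) ≡ partial (toℕ v) + (degree v + 2)
        partial-suc v = begin
          partial (suc (toℕ v))                ≡⟨ +-identityʳ _ ⟨
          partial (suc (toℕ v)) + 0            ≡⟨ cong (partial (suc (toℕ v)) +_) (cong (if_then degree v + 2 else 0) (dec-false (toℕ v <? toℕ v) (<-irrefl refl))) ⟨
          partial (suc (toℕ v)) + g v          ≡⟨ sum-update {f = f} {g} v same ⟩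
          partial (toℕ v) + f v                ≡⟨ cong (partial (toℕ v) +_) (cong (if_then degree v + 2 else 0) (dec-true (toℕ v <? suc (toℕ v)) ≤-refl)) ⟩
          partial (toℕ v) + (degree v + 2)     ∎
          where
          open ≡-Reasoning
          f g : Fin n → ℕ
          f x = if does (toℕ x <? suc (toℕ v)) then degree x + 2 else 0
          g x = if does (toℕ x <? toℕ v) then degree x + 2 else 0
          same : ∀ x → x ≢ v → f x ≡ g x
          same x ne with <-cmp (toℕ x) (toℕ v)
          ... | tri< lt _ _ = trans (cong (if_then degree x + 2 else 0) (dec-true (toℕ x <? suc (toℕ v)) (m≤n⇒m≤1+n lt)))
                                    (sym (cong (if_then degree x + 2 else 0) (dec-true (toℕ x <? toℕ v) lt)))
          ... | tri≈ _ e _  = contradiction (Fin.toℕ-injective e) ne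
          ... | tri> _ _ gt = trans (cong (if_then degree x + 2 else 0) (dec-false (toℕ x <? suc (toℕ v)) (<⇒≱ (s≤s gt))))
                                    (sym (cong (if_then degree x + 2 else 0) (dec-false (toℕ x <? toℕ v) (<-asym gt))))
        partial-n : partial n ≡ sum degree + n * 2
        partial-n = trans (sum-cong-≗ (λ v → cong (if_then degree v + 2 else 0) (dec-true (toℕ v <? n) (Fin.toℕ<n v))))
          (trans (∑-distrib-+ degree (λ _ → 2)) (cong (sum degree +_) (sum-const n 2)))
        fill : ∀ s (v x : Fin n) → (∀ x → toℕ x < toℕ v → nat s bktᵛ 0 (toℕ x) ≡ toℕ x) → toℕ x < toℕ v ⊎ toℕ x ≡ toℕ v →
               write bktᵛ 0 (toℕ v) (toℕ v) (nat s) bktᵛ 0 (toℕ x) ≡ toℕ x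
        fill s v x h (inj₁ lt) = trans (write-col bktᵛ 0 (toℕ v) (toℕ v) (nat s) (λ e → <-irrefl (sym e) lt)) (h x lt)
        fill s v x h (inj₂ e) rewrite e = write-same bktᵛ 0 (toℕ v) (toℕ v) (nat s)
        initially : ∀ s → (∀ v → toℕ v < n → nat s bktᵛ 0 (toℕ v) ≡ toℕ v) → (∀ j → nat s bszᵛ j 0 ≡ 0) →
          (∀ j → nat s cntᵛ j 0 ≡ 0) → topOf s ≡ 0 → ∀ {P vt} → let s′ = writeN bszᵛ 0 0 n s in
          Search (λ _ → 0) P vt 0 (cntOf s′) (bszOf s′) (nat s′ bktᵛ) (topOf s′) 0 0
        initially s hb hB hC ht = record
          { numbering = record { binary = λ _ → z≤n ; size = trans (sum-const n 0) (*-zeroʳ n) ; placed = λ () ; filled = λ () ; maximal = λ () }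
          ; counts = λ {v} _ → trans (hC (toℕ v)) (sym (trans (sum-cong-≗ (λ x → zero-if (Graph.adj U v x))) (trans (sum-const n 0) (*-zeroʳ n))))
          ; buckets = record
              { listed = λ {v} _ → toℕ v , subst (λ j → toℕ v < B j × nat s bktᵛ j (toℕ v) ≡ toℕ v) (sym (hC (toℕ v))) (Fin.toℕ<n v , hb v (Fin.toℕ<n v))
              ; entries = ent
              ; empty = λ { {suc j} _ → hB (suc j) ; {zero} lt → contradiction (subst (_< 0) ht lt) λ () } }
          ; top≤N = ≤-reflexive ht
          ; progress = inj₂ (≤-trans (≤-reflexive (trans (cong (total B +_) ht) (trans (+-identityʳ _) total≡n))) (m≤m+n n _))
          ; timely = z≤n }
          where
          B = bszOf (writeN bszᵛ 0 0 n s)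
          zero-if : ∀ b → (if b then 0 else 0) ≡ 0
          zero-if true  = refl
          zero-if false = refl
          total≡n : total B ≡ n
          total≡n = trans (cong (n +_) (trans (sum-cong-≗ {suc n} (λ j → hB (suc (toℕ j)))) (trans (sum-const (suc n) 0) (*-zeroʳ n)))) (+-identityʳ n)
          ent : ∀ {j i} → i < B j → ∃[ v ] nat s bktᵛ j i ≡ toℕ v × (0 ≡ 0 → j ≤ cntOf s v)
          ent {suc j} {i} lt = contradiction (subst (i <_) (hB (suc j)) lt) λ ()
          ent {zero} {i} lt = Fin.fromℕ< lt , trans (subst (λ i → nat s bktᵛ 0 i ≡ i) (Fin.toℕ-fromℕ< lt) (hb (Fin.fromℕ< lt) (Fin.toℕ<n _))) (sym (Fin.toℕ-fromℕ< lt)) , λ _ → z≤n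

    mcs-bound : ℕ
    mcs-bound = suc (n * 3) + 1 + suc ((sum degree + n * 2) * 11 + (n + sum degree) * 6)

    mcs-runs : ∀ {s} → HoldsGraph s → (∀ a i j → nat s (20 + a) i j ≡ 0) →
      Runs mcs s mcs-bound (λ s′ → HoldsGraph s′ × Σ[ d ∈ Permutation′ n ] HoldsOrdering d s′ × Maximal U (position U d)) ⊥
    mcs-runs {s} hg fr = mcsInit-runs hg fr then λ {s₁} _ (inv , ht) →
      for-amortised (sum degree + n * 2) _ Inv ht inv mcsStep-runs
        λ { {τ} {s′} (hg′ , V , P , vt , N , F , S) →
            let open Frozen F
                d , P≡ , vt≡ , max = complete-numbering U (Search.numbering S) (finished S refl)
            in ≤-trans (Search.timely S) (+-monoʳ-≤ ((sum degree + n * 2) * 11) (*-monoˡ-≤ 6 (cost≤ {V} (Numbering.binary (Search.numbering S)))))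
             , hg′ , d , ((λ v → trans (pos≡ v) (P≡ v)) , (λ k → trans (vert≡ (toℕ k)) (vt≡ k))) , max }

-- Recognition of chordal graphs

private
  pattern bestᵛ = 41
  pattern aᵛ = 42
  pattern bᵛ = 43

-- `best` holds a position plus 1, and 0 while no earlier neighbour is known. The strict comparison
-- in `testBest` leaves out the latest earlier neighbour itself and all neighbours after the vertex.
findBest testBest checkVertex check recognise : Cmd
findBest    = for iᵛ < deg [ ! bᵛ ] run
                ((aᵛ ≔ nbr [ ! bᵛ ][ ! iᵛ ]) ⨾
                 (when pos [ ! aᵛ ] <ᵉ pos [ ! bᵛ ] then
                   when ! bestᵛ <ᵉ pos [ ! aᵛ ] ∔ num 1 then bestᵛ ≔ pos [ ! aᵛ ] ∔ num 1))
testBest    = for iᵛ < deg [ ! bᵛ ] run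
                ((aᵛ ≔ nbr [ ! bᵛ ][ ! iᵛ ]) ⨾
                 (when pos [ ! aᵛ ] ∔ num 1 <ᵉ ! bestᵛ then
                   when edgeᵛ [ ! aᵛ ][ vert [ ! bestᵛ ∸ᵉ num 1 ] ] ≡ᵉ num 0 then reject))
checkVertex = (bestᵛ ≔ num 0) ⨾ findBest ⨾ testBest
check       = for bᵛ < ! order run checkVertex
recognise   = mcs ⨾ markEdges ⨾ check

module _ {n : ℕ} (U : Graph n) (d : Permutation′ n) where

  private π = position U d

  ParentAdjacent : Fin n → Set
  ParentAdjacent v = (∀ x → Adj U v x → ¬ π x < π v) ⊎
    ∃[ u ] Adj U v u × π u < π v × (∀ x → Adj U v x → π x < π v → π x ≤ π u × (x ≢ u → Adj U x u))

  -- Each earlier neighbour of `z` equals the latest one, `u`, or is adjacent to it. If neither of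
  -- two equals `u`, both are earlier neighbours of `u`, and induction on the position applies.
  parentAdjacent⇒perfect : (∀ v → ParentAdjacent v) → Perfect U d
  parentAdjacent⇒perfect parent = perfect-intro U d λ {x} {y} {z} x~z y~z x<z y<z →
    go (suc (π z)) ≤-refl x~z y~z x<z y<z
    where
    go : ∀ m {x y z} → π z < m → Adj U x z → Adj U y z → π x < π z → π y < π z → x ≢ y → Adj U x y
    go (suc m) {x} {y} {z} (s≤s z≤m) x~z y~z x<z y<z x≢y with parent z
    ... | inj₁ none = contradiction x<z (none x (Adj-sym U x~z))
    ... | inj₂ (u , z~u , u<z , h)
      with x≤u , x~u ← h x (Adj-sym U x~z) x<z | y≤u , y~u ← h y (Adj-sym U y~z) y<z
      with x Fin.≟ u | y Fin.≟ u
    ... | yes refl | _        = Adj-sym U (y~u (x≢y ∘ sym))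
    ... | no x≢u   | yes refl = x~u x≢u
    ... | no x≢u   | no y≢u   = go m (<-≤-trans u<z z≤m) (x~u x≢u) (y~u y≢u)
      (≤∧≢⇒< x≤u (x≢u ∘ position-injective U d)) (≤∧≢⇒< y≤u (y≢u ∘ position-injective U d)) x≢y

module _ {c ℓ₁ ℓ₂ : Level} {W : OrderedAbelianGroup c ℓ₁ ℓ₂} where
  open Store

  rejecting : ∀ {q r r′} {Q : Store W → Set q} {R : Set r} {R′ : Set r′} {p s b} →
              (R → R′) → Runs p s b Q R → Runs p s b Q R′
  rejecting {Q = Q} {R} {R′} f (runs t po) = runs t (aux po)
    where
    aux : ∀ {o} → Post Q R o → Post Q R′ o
    aux (accepted x) = accepted x
    aux (rejected x) = rejected (f x)

  module _ {n : ℕ} {U : Graph n} (L : AdjacencyLists U) where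
    open GraphInput {W = W} L

    module _ (d : Permutation′ n) where

      private
        π = position U d

        Latest : Fin n → ℕ → ℕ → Set
        Latest v i b = (∀ x → Seen v i x → π x < π v → π x < b) ×
                       (b ≡ 0 ⊎ ∃[ u ] Adj U v u × π u < π v × b ≡ suc (π u))

      findBest-runs : ∀ {r} {R : Set r} {s v} → HoldsGraph s → HoldsOrdering d s → nat s bᵛ 0 0 ≡ toℕ v → nat s bestᵛ 0 0 ≡ 0 →
        Runs findBest s (suc (degree v * 5)) (λ s′ → Latest v (degree v) (nat s′ bestᵛ 0 0)) R
      findBest-runs {s = s} {v} hg ho hv hb =
        neighbours-rule v (λ i s → Latest v i (nat s bestᵛ 0 0)) 3 refl refl refl hg
          (λ ag _ → holdsGraph-agree ag refl refl refl hg) hv ((λ _ h → ⊥-elim (Seen-zero h)) , inj₁ hb)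
          λ i {s₁} ag (h , h′) →
            let a = neighbour v i
                πa = trans (natᶠ ag pos (toℕ a) 0 refl) (proj₁ ho a)
                πv = trans (cong (λ v → nat s₁ pos v 0) (trans (natᶠ ag bᵛ 0 0 refl) hv)) (trans (natᶠ ag pos (toℕ v) 0 refl) (proj₁ ho v))
                πa+1 = trans (+-comm _ 1) (cong suc πa)
            in if-< πa πv
              (λ a<v → if-< refl πa+1
                (λ lt → lastN {i = 0} {0} {suc (π a)} refl refl πa+1
                  ((λ x seen x<v → raised i (h x) (m<1+n⇒m≤n lt) (Seen-suc i seen) x<v) , inj₂ (a , neighbour-adj v i , a<v , refl)))
                (λ ge → skips ((λ x seen x<v → kept i (h x) (λ _ → ge) (Seen-suc i seen) x<v) , h′)))
              (λ v≤a → skips ((λ x seen x<v → kept i (h x) (λ a<v → contradiction a<v (≤⇒≯ v≤a)) (Seen-suc i seen) x<v) , h′))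
        where
        raised : ∀ i {x b} → (Seen v (toℕ i) x → π x < π v → π x < b) → b ≤ π (neighbour v i) →
                 Seen v (toℕ i) x ⊎ neighbour v i ≡ x → π x < π v → π x < suc (π (neighbour v i))
        raised i h b≤ (inj₁ seen) x<v = m≤n⇒m≤1+n (<-≤-trans (h seen x<v) b≤)
        raised i h b≤ (inj₂ refl) x<v = ≤-refl
        kept : ∀ i {x b} → (Seen v (toℕ i) x → π x < π v → π x < b) →
               (π (neighbour v i) < π v → suc (π (neighbour v i)) ≤ b) →
               Seen v (toℕ i) x ⊎ neighbour v i ≡ x → π x < π v → π x < b
        kept i h le (inj₁ seen) x<v = h seen x<v
        kept i h le (inj₂ refl) x<v = le x<v

      ExactEdges : Store W → Set
      ExactEdges s = EdgesMarked L s × (∀ {u v} → ¬ Adj U u v → nat s edgeᵛ (toℕ u) (toℕ v) ≡ 0)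

      exactEdges-agree : ∀ {p s s′} → Agree p s s′ → modifiesN p edgeᵛ ≡ false → ExactEdges s → ExactEdges s′
      exactEdges-agree ag e (h , h′) = (λ {u} {v} a → trans (natᶠ ag edgeᵛ (toℕ u) (toℕ v) e) (h a))
                                     , λ {u} {v} a → trans (natᶠ ag edgeᵛ (toℕ u) (toℕ v) e) (h′ a)

      testBest-runs : ∀ {s v} → HoldsGraph s → HoldsOrdering d s → ExactEdges s → nat s bᵛ 0 0 ≡ toℕ v →
        Latest v (degree v) (nat s bestᵛ 0 0) →
        Runs testBest s (suc (degree v * 5)) (λ _ → ParentAdjacent U d v) (¬ Perfect U d)
      testBest-runs {s} {v} hg ho he hv (latest , top) = weaken ≤-refl (λ _ h → conclude top h)
        (neighbours-rule v (λ i _ → ∀ x → Seen v i x → suc (π x) < b → ∀ {u} → b ≡ suc (π u) → Adj U x u) 3 refl refl refl hg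
          (λ ag _ → holdsGraph-agree ag refl refl refl hg) hv (λ _ h → ⊥-elim (Seen-zero h))
          λ i {s₁} ag h →
            let a = neighbour v i
                πa = trans (natᶠ ag pos (toℕ a) 0 refl) (proj₁ ho a)
                b≡ = natᶠ ag bestᵛ 0 0 refl
            in if-< (trans (+-comm _ 1) (cong suc πa)) b≡
              (λ lt → test i ag h lt (parent top lt))
              (λ ge → skips λ x seen lt → extend′ i (λ lt′ → contradiction lt′ (≤⇒≯ ge)) (h x) (Seen-suc i seen) lt))
        where
        b = nat s bestᵛ 0 0
        Parent = ∃[ u ] Adj U v u × π u < π v × b ≡ suc (π u)
        parent : ∀ {x} → b ≡ 0 ⊎ Parent → x < b → Parent
        parent (inj₁ e) lt = contradiction (subst (_ <_) e lt) λ ()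
        parent (inj₂ h) lt = h
        extend′ : ∀ i {x} → (suc (π (neighbour v i)) < b → ∀ {u} → b ≡ suc (π u) → Adj U (neighbour v i) u) →
                  (Seen v (toℕ i) x → suc (π x) < b → ∀ {u} → b ≡ suc (π u) → Adj U x u) →
                  Seen v (toℕ i) x ⊎ neighbour v i ≡ x → suc (π x) < b → ∀ {u} → b ≡ suc (π u) → Adj U x u
        extend′ i new old (inj₁ seen) lt = old seen lt
        extend′ i new old (inj₂ refl) lt = new lt
        I : ℕ → Store W → Set
        I i _ = ∀ x → Seen v i x → suc (π x) < b → ∀ {u} → b ≡ suc (π u) → Adj U x u
        test : ∀ i {s₁} → Agree testBest s s₁ → I (toℕ i) s₁ → suc (π (neighbour v i)) < b → Parent →
          Runs (when edgeᵛ [ ! aᵛ ][ vert [ ! bestᵛ ∸ᵉ num 1 ] ] ≡ᵉ num 0 then reject)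
               (writeN aᵛ 0 0 (toℕ (neighbour v i)) (writeN iᵛ 0 0 (toℕ i) s₁)) 2 (I (suc (toℕ i))) (¬ Perfect U d)
        test i {s₁} ag h lt (u , v~u , u<v , bu) = if-≡ (cong (nat s₁ edgeᵛ (toℕ a)) u≡) refl
          -- A missing mark refutes perfectness, since `a` and `u` are distinct earlier neighbours
          -- of `v`.
          (λ e → rejects λ perfect → contradiction (trans (sym e) (proj₁ he₁ (perfect-elim U d perfect (Adj-sym U (neighbour-adj v i))
                   (Adj-sym U v~u) (<-trans a<u u<v) u<v λ { refl → <-irrefl refl a<u }))) λ ())
          (λ ne → skips λ x seen lt → extend′ i (λ _ {u′} e → subst (Adj U a) (position-injective U d (suc-injective (trans (sym bu) e))) (adjacent ne (adj? U a u))) (h x) (Seen-suc i seen) lt)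
          where
          a = neighbour v i
          he₁ = exactEdges-agree ag refl he
          a<u : π a < π u
          a<u = s≤s⁻¹ (subst (suc (π a) <_) bu lt)
          u≡ : nat s₁ vert (nat s₁ bestᵛ 0 0 ∸ 1) 0 ≡ toℕ u
          u≡ = trans (cong (λ k → nat s₁ vert (k ∸ 1) 0) (trans (natᶠ ag bestᵛ 0 0 refl) bu))
            (trans (natᶠ ag vert (π u) 0 refl) (trans (proj₂ ho (d ⟨$⟩ʳ u)) (cong toℕ (inverseˡ d))))
          adjacent : nat s₁ edgeᵛ (toℕ a) (toℕ u) ≢ 0 → Dec (Adj U a u) → Adj U a u
          adjacent ne (yes h) = h
          adjacent ne (no ¬h) = contradiction (proj₂ he₁ ¬h) ne
        conclude : b ≡ 0 ⊎ Parent → I (degree v) s → ParentAdjacent U d v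
        conclude (inj₁ e) h = inj₁ λ x v~x x<v → contradiction (subst (π x <_) e (latest x (Seen-all v~x) x<v)) λ ()
        conclude (inj₂ (u , v~u , u<v , bu)) h = inj₂ (u , v~u , u<v , λ x v~x x<v →
          let x≤u = s≤s⁻¹ (subst (π x <_) bu (latest x (Seen-all v~x) x<v)) in
          x≤u , λ ne → h x (Seen-all v~x) (subst (suc (π x) <_) (sym bu) (s≤s (≤∧≢⇒< x≤u (ne ∘ position-injective U d)))) bu)

      check-bound : ℕ
      check-bound = suc (n * 4 + sum degree * 10)

      check-runs : ∀ {s} → HoldsGraph s → HoldsOrdering d s → ExactEdges s →
                   Runs check s check-bound (λ _ → Perfect U d) (¬ Perfect U d)
      check-runs {s} hg ho he = weaken ≤-refl (λ _ h → parentAdjacent⇒perfect U d λ v → h v (Fin.toℕ<n v))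
        (for-sum n (λ i _ → ∀ v → toℕ v < i → ParentAdjacent U d v) degree id id 3 10 (proj₁ hg) (λ _ ())
          λ v {s₁} ag h →
            let hg₁ = holdsGraph-agree ag refl refl refl hg
                ho₁ = (λ v → trans (natᶠ ag pos (toℕ v) 0 refl) (proj₁ ho v)) , (λ k → trans (natᶠ ag vert (toℕ k) 0 refl) (proj₂ ho k))
                he₁ = exactEdges-agree ag refl he
            in within (≤-reflexive (eq (degree v))) (assignN {i = 0} {0} {0} refl refl refl
              (findBest-runs hg₁ ho₁ refl refl then λ {s₂} ag₂ latest →
               weaken ≤-refl (λ _ p v′ lt → extend′ v h p v′ (m<1+n⇒m<n∨m≡n lt))
                (testBest-runs (holdsGraph-agree ag₂ refl refl refl hg₁)
                  ((λ v → trans (natᶠ ag₂ pos (toℕ v) 0 refl) (proj₁ ho₁ v)) , (λ k → trans (natᶠ ag₂ vert (toℕ k) 0 refl) (proj₂ ho₁ k)))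
                  (exactEdges-agree ag₂ refl he₁) (natᶠ ag₂ bᵛ 0 0 refl) latest))))
        where
        eq : ∀ x → suc (suc (x * 5) + suc (x * 5)) ≡ 3 + x * 10
        eq = solve-∀
        extend′ : ∀ v → (∀ x → toℕ x < toℕ v → ParentAdjacent U d x) → ParentAdjacent U d v →
                  ∀ x → toℕ x < toℕ v ⊎ toℕ x ≡ toℕ v → ParentAdjacent U d x
        extend′ v h p x (inj₁ lt) = h x lt
        extend′ v h p x (inj₂ e) with refl ← Fin.toℕ-injective e = p

    recognise-bound : ℕ
    recognise-bound = mcs-bound {W = W} L + (markEdges-bound {W = W} L + suc (n * 4 + sum degree * 10))

    -- A rejection is conclusive because the search satisfies `Maximal` on every graph: if the graph
    -- were chordal, the ordering found would be perfect.
    recognise-runs : ∀ {s} → HoldsGraph s → (∀ a i j → nat s (20 + a) i j ≡ 0) → (∀ i j → nat s edgeᵛ i j ≡ 0) →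
                     Runs recognise s recognise-bound (λ _ → Chordal U) (¬ Chordal U)
    recognise-runs {s} hg fr edge≡0 = rejecting ⊥-elim (mcs-runs L hg fr) then λ {s₁} ag (hg₁ , d , ho₁ , max) →
      markEdges-runs L hg₁ then λ {s₂} ag₂ (marked , unmarked) →
      weaken ≤-refl (λ _ → perfect⇒chordal d) (rejecting (λ ¬p chordal → ¬p (maximal⇒perfect U d max chordal))
        (check-runs d (holdsGraph-agree ag₂ refl refl refl hg₁)
          ((λ v → trans (natᶠ ag₂ pos (toℕ v) 0 refl) (proj₁ ho₁ v)) , (λ k → trans (natᶠ ag₂ vert (toℕ k) 0 refl) (proj₂ ho₁ k)))
          (marked , λ {u} {v} ¬a → trans (unmarked ¬a) (trans (natᶠ ag edgeᵛ (toℕ u) (toℕ v) refl) (edge≡0 (toℕ u) (toℕ v))))))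

    runs⇒Is-just : ∀ {q r} {Q : Set q} {R : Set r} {p} {s : Store W} {b} → Runs p s b (λ _ → Q) R → ¬ (Q × R) →
                   (Is-just (result (exec p s)) → Q) × (Q → Is-just (result (exec p s)))
    runs⇒Is-just {Q = Q} {R} (runs _ po) excl = aux po
      where
      aux : ∀ {o} → Post (λ _ → Q) R o → (Is-just o → Q) × (Q → Is-just o)
      aux (accepted x) = (λ _ → x) , λ _ → just tt
      aux (rejected y) = (λ ()) , λ x → ⊥-elim (excl (x , y))

-- Time bounds

-- A record, so that k and X can be inferred.
record Bounded (X a k : ℕ) : Set where
  constructor bounded
  field bound : a ≤ k * X
open Bounded

module _ {X : ℕ} where

  bound-+ : ∀ {a b k l} → Bounded X a k → Bounded X b l → Bounded X (a + b) (k + l)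
  bound-+ {k = k} {l} (bounded h) (bounded h′) = bounded (≤-trans (+-mono-≤ h h′) (≤-reflexive (sym (*-distribʳ-+ X k l))))

  bound-suc : ∀ {a k} → 1 ≤ X → Bounded X a k → Bounded X (suc a) (suc k)
  bound-suc 1≤X (bounded h) = bounded (+-mono-≤ 1≤X h)

  bound-* : ∀ {a k} c → Bounded X a k → Bounded X (a * c) (k * c)
  bound-* {a} {k} c (bounded h) = bounded (≤-trans (*-monoˡ-≤ c h) (≤-reflexive (eq k X c)))
    where
    eq : ∀ k x c → k * x * c ≡ k * c * x
    eq = solve-∀

  bound-1 : 1 ≤ X → Bounded X 1 1
  bound-1 1≤X = bounded (≤-trans 1≤X (≤-reflexive (sym (*-identityˡ X))))

  -- For the concrete programs `k` is a closed expression, so the comparison is evaluated and `tt`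
  -- proves it; no constant has to be worked out by hand.
  enlarge : ∀ {a k} C → Bounded X a k → T (k ≤ᵇ C) → Bounded X a C
  enlarge {k = k} C (bounded h) le = bounded (≤-trans h (*-monoˡ-≤ X (≤ᵇ⇒≤ k C le)))

module _ {n : ℕ} {U : Graph n} (L : AdjacencyLists U) where
  open Neighbours L

  private
    m = effective-m U

  -- Both `suc m` and `suc (n * m)` have these properties, so the linear parts of a running time are
  -- estimated once for the two kinds of bound.
  record Dominates (X : ℕ) : Set where
    field
      1≤ : 1 ≤ X
      n≤ : Bounded X n 1
      S≤ : Bounded X (sum degree) 2

  n≤1+m : n ≤ suc m
  n≤1+m = ≤-trans (n≤suc[n∸1] n) (s≤s (m≤n⊔m (#edges U) (n ∸ 1)))
    where
    n≤suc[n∸1] : ∀ n → n ≤ suc (n ∸ 1)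
    n≤suc[n∸1] zero    = z≤n
    n≤suc[n∸1] (suc n) = ≤-refl

  S≤2m : sum degree ≤ 2 * m
  S≤2m = ≤-trans sum-degree (*-monoʳ-≤ 2 (m≤m⊔n (#edges U) (n ∸ 1)))

  m-dominates : Dominates (suc m)
  m-dominates = record
    { 1≤ = s≤s z≤n ; n≤ = bounded (≤-trans n≤1+m (≤-reflexive (sym (*-identityˡ (suc m)))))
    ; S≤ = bounded (≤-trans S≤2m (*-monoʳ-≤ 2 (n≤1+n m))) }

  -- With a single vertex `m` may be 0, which the successor absorbs; with two or more, `m` is at
  -- least 1.
  n≤1+nm : ∀ n → n ∸ 1 ≤ m → n ≤ suc (n * m)
  n≤1+nm zero          h = z≤n
  n≤1+nm (suc zero)    h = s≤s z≤n
  n≤1+nm (suc (suc n)) h = m≤n⇒m≤1+n (≤-trans (≤-reflexive (sym (*-identityʳ (suc (suc n)))))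
                             (*-monoʳ-≤ (suc (suc n)) (≤-trans (s≤s z≤n) h)))

  nm-dominates : Dominates (suc (n * m))
  nm-dominates = record
    { 1≤ = s≤s z≤n
    ; n≤ = bounded (≤-trans (n≤1+nm n (m≤n⊔m (#edges U) (n ∸ 1))) (≤-reflexive (sym (*-identityˡ (suc (n * m))))))
    ; S≤ = bounded S≤2nm }
    where
    empty : ∀ {n} (f : Fin n → ℕ) → n ≡ 0 → sum f ≡ 0
    empty f refl = refl
    S≤2nm : sum degree ≤ 2 * suc (n * m)
    S≤2nm with n ≟ 0
    ... | yes e = ≤-trans (≤-reflexive (empty degree e)) z≤n
    ... | no ne = ≤-trans S≤2m (*-monoʳ-≤ 2 (m≤n⇒m≤1+n (≤-trans (≤-reflexive (sym (*-identityˡ m)))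
                    (*-monoˡ-≤ m (n≢0⇒n>0 ne)))))

  -- The factor 2 arises because `n * suc m` is `n + n * m`, with both summands at most
  -- `suc (n * m)`.
  n*-bound : ∀ {a k} → Bounded (suc m) a k → Bounded (suc (n * m)) (n * a) (k * 2)
  n*-bound {a} {k} (bounded h) = bounded (begin
    n * a                         ≤⟨ *-monoʳ-≤ n h ⟩
    n * (k * suc m)               ≡⟨ eq n k m ⟩
    k * (n + n * m)               ≤⟨ *-monoʳ-≤ k (+-mono-≤ (n≤1+nm n (m≤n⊔m (#edges U) (n ∸ 1))) (n≤1+n (n * m))) ⟩
    k * (suc (n * m) + suc (n * m)) ≡⟨ eq′ k (suc (n * m)) ⟩
    k * 2 * suc (n * m)           ∎)
    where
    open ≤-Reasoning
    eq : ∀ n k m → n * (k * suc m) ≡ k * (n + n * m)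
    eq = solve-∀
    eq′ : ∀ k x → k * (x + x) ≡ k * 2 * x
    eq′ = solve-∀

  S*-bound : ∀ a b → Bounded (suc (n * m)) (sum degree * (a + n * b)) (2 * a + 2 * b * 2)
  S*-bound a b = bounded (≤-trans (≤-reflexive (eq (sum degree) a n b))
    (bound (bound-+ (bound-* a (Dominates.S≤ nm-dominates)) (n*-bound (bound-* b (Dominates.S≤ m-dominates))))))
    where
    eq : ∀ s a n b → s * (a + n * b) ≡ s * a + n * (s * b)
    eq = solve-∀

  module _ {c ℓ₁ ℓ₂ : Level} (W : OrderedAbelianGroup c ℓ₁ ℓ₂) where

    module _ {X : ℕ} (dom : Dominates X) where
      open Dominates dom

      mcs-time : Bounded X (mcs-bound {W = W} L) 100
      mcs-time = enlarge 100 (bound-+ (bound-+ (bound-suc 1≤ (bound-* 3 n≤)) (bound-1 1≤))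
        (bound-suc 1≤ (bound-+ (bound-* 11 (bound-+ S≤ (bound-* 2 n≤))) (bound-* 6 (bound-+ n≤ S≤))))) tt

      sweep-time : ∀ a b → Bounded X (suc (n * a + sum degree * b)) (suc (1 * a + 2 * b))
      sweep-time a b = bound-suc 1≤ (bound-+ (bound-* a n≤) (bound-* b S≤))

      recognise-time : Bounded X (recognise-bound {W = W} L) 200
      recognise-time = enlarge 200 (bound-+ mcs-time (bound-+ (sweep-time 2 2) (sweep-time 4 10))) tt

      minPaths-time : Bounded X (suc (n * 2) + suc (suc (n * 4 + sum degree * 4) + suc (n * 3 + sum degree * 4))) 100
      minPaths-time = enlarge 100 (bound-+ (bound-suc 1≤ (bound-* 2 n≤))
        (bound-suc 1≤ (bound-+ (sweep-time 4 4) (sweep-time 3 4)))) tt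

    module _ where
      open Dominates m-dominates using () renaming (1≤ to 1≤m; n≤ to n≤m)
      open Dominates nm-dominates

      clear-time : Bounded (suc (n * m)) (suc (n * suc (suc (n * 2)))) 20
      clear-time = enlarge 20 (bound-suc 1≤ (n*-bound (bound-suc 1≤m (bound-suc 1≤m (bound-* 2 n≤m))))) tt

      dpc-time : Bounded (suc (n * m)) (suc (n * suc (suc (n * 2))) + suc (n * 2 + sum degree * 2) + suc (n * 4 + sum degree * (4 + n * 10))) 200
      dpc-time = enlarge 200 (bound-+ (bound-+ clear-time (sweep-time nm-dominates 2 2))
        (bound-suc 1≤ (bound-+ (bound-* 4 n≤) (S*-bound 4 10)))) tt

      growTail-time : Bounded (suc (n * m)) (suc (n * suc (suc (n * 2))) + (suc (n * 2) + suc (n * 3 + sum degree * (4 + n * 4)))) 200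
      growTail-time = enlarge 200 (bound-+ clear-time (bound-+ (bound-suc 1≤ (bound-* 2 n≤))
        (bound-suc 1≤ (bound-+ (bound-* 3 n≤) (S*-bound 4 4))))) tt

      chleqTail-time : Bounded (suc (n * m))
        (suc (n * suc (suc (n * 2) + suc (suc (n * 4 + sum degree * 4) + suc (n * 3 + sum degree * 4)) + suc (n * 2)))) 300
      chleqTail-time = enlarge 300 (bound-suc 1≤ (n*-bound (bound-suc 1≤m (bound-+ (minPaths-time m-dominates)
        (bound-suc 1≤m (bound-* 2 n≤m)))))) tt

-- Correctness and running time

module _ {c ℓ₁ ℓ₂ : Level} {W : OrderedAbelianGroup c ℓ₁ ℓ₂} where
  open Store

  private
    Scratch : Store W → Set
    Scratch s = ∀ a i j → nat s (20 + a) i j ≡ 0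

  module _ {n : ℕ} (G : WeightedDigraph W n) (L : AdjacencyLists (skeleton G)) where
    open GraphInput {W = W} L

    private
      U = skeleton G
      X = suc (n * effective-m U)
      open Dominates (nm-dominates L)

    holdsWeights-agree : ∀ {p s s′} → Agree p s s′ → modifiesW p w ≡ false → HoldsWeights G L s → HoldsWeights G L s′
    holdsWeights-agree ag e h i j = trans (wtᶠ ag w (toℕ i) (toℕ j) e) (h i j)

    weightMemory-input : ∀ ν → HoldsWeights G L (store ν (weightMemory G))
    weightMemory-input ν = weightMemory-holds G

    solves : ∀ {o} → NoNegativePair G → Post (APSPSolution G) (NegativeCycle G) o → SolvesAPSP G o
    solves h (accepted sol) = distances (proj₁ (sol h)) (proj₂ (sol h))
    solves h (rejected neg) = inconsistent neg

    solves-tested : ∀ {o} → Post (λ s → NoNegativePair G × APSPSolution G s) (NegativeCycle G) o → SolvesAPSP G o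
    solves-tested (accepted (h , sol)) = solves h (accepted sol)
    solves-tested (rejected neg)       = inconsistent neg

    -- Since `Input` is stable under `testEdges`, one execution lemma serves the plain and the
    -- tested run. In the latter, the test supplies the `NoNegativePair` that `correct` takes as an
    -- assumption.
    computesAPSP : ∀ {pgm input b} (Input : Store W → Set c) → (∀ {s} → Input s → HoldsGraph s × HoldsWeights G L s) →
      (∀ {s s′} → Agree testEdges s s′ → Input s → Input s′) →
      (∀ {s} → Input s → Runs pgm s b (APSPSolution G) (NegativeCycle G)) → Bounded X b 900 → Input input →
      ComputesAPSP pgm G input (O[nm] 1000 U)
    computesAPSP {pgm} {input} {b} Input holds stable execution b≤ inp = record
      { time           = ≤-trans (time (execution inp)) (bound (enlarge 1000 b≤ tt))
      ; correct        = λ h → solves h (post (execution inp))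
      ; time-tested    = ≤-trans (time tested) (bound (enlarge 1000 (bound-+ (sweep-time L W (nm-dominates L) 2 4) b≤) tt))
      ; correct-tested = solves-tested (post tested)
      }
      where
      tested : Runs (testEdges ⨾ pgm) input (testEdges-bound G L + b) (λ s → NoNegativePair G × APSPSolution G s) (NegativeCycle G)
      tested = testEdges-runs G L (proj₁ (holds inp)) (proj₂ (holds inp))
        then λ ag h → weaken ≤-refl (λ _ sol → (λ {i} {j} {a} {b} → h {i} {j} {a} {b}) , sol) (execution (stable ag inp))

    module _ (d : Permutation′ n) (perfect : Perfect U d) where

      private
        Input : Store W → Set c
        Input s = HoldsOrderedGraph G L d perfect s × HoldsWeights G L s

        input : Input (store (orderedGraphMemory L d) (weightMemory G))
        input = orderedGraphMemory-holds {W = W} L d (weightMemory G) , weightMemory-input (orderedGraphMemory L d)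

        stable : ∀ {s s′} → Agree testEdges s s′ → Input s → Input s′
        stable ag (ho , hw) = holdsOrderedGraph-agree G L d perfect ag refl refl refl refl refl ho , holdsWeights-agree ag refl hw

      snowball-computes : ComputesAPSP snowball G (store (orderedGraphMemory L d) (weightMemory G)) (O[nm] 1000 U)
      snowball-computes = computesAPSP Input (λ ((hg , _) , hw) → hg , hw) stable
        (λ (ho , hw) → snowball-runs G L d perfect ho hw) (enlarge 900 (bound-+ (dpc-time L W) (growTail-time L W)) tt) input

      chleqAPSP-computes : ComputesAPSP chleqAPSP G (store (orderedGraphMemory L d) (weightMemory G)) (O[nm] 1000 U)
      chleqAPSP-computes = computesAPSP Input (λ ((hg , _) , hw) → hg , hw) stable
        (λ (ho , hw) → chleqAPSP-runs G L d perfect ho hw) (enlarge 900 (bound-+ (dpc-time L W) (chleqTail-time L W)) tt) input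

    module _ (chordal : Chordal U) where

      private
        Input : Store W → Set c
        Input s = HoldsGraph s × Scratch s × HoldsWeights G L s

        input : Input (store (graphMemory L) (weightMemory G))
        input = graphMemory-holds {W = W} L (weightMemory G) , (λ _ _ _ → refl) , weightMemory-input (graphMemory L)

        stable : ∀ {s s′} → Agree testEdges s s′ → Input s → Input s′
        stable ag (hg , fr , hw) = holdsGraph-agree ag refl refl refl hg , (λ a i j → trans (natᶠ ag (20 + a) i j refl) (fr a i j))
                                 , holdsWeights-agree ag refl hw

        -- The ordering is known only once the search has run, hence the premise for every perfect
        -- `d`, with a bound `b` that does not depend on it.
        ordered : ∀ {pgm b} → (∀ (d : Permutation′ n) perfect {s} → HoldsOrderedGraph G L d perfect s → HoldsWeights G L s →
                               Runs pgm s b (APSPSolution G) (NegativeCycle G)) →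
                  ∀ {s} → Input s → Runs (mcs ⨾ pgm) s (mcs-bound {W = W} L + b) (APSPSolution G) (NegativeCycle G)
        ordered execution (hg , fr , hw) = rejecting ⊥-elim (mcs-runs L hg fr) then λ ag (hg′ , d , ho , max) →
          execution d (maximal⇒perfect U d max (λ {ℓ} → chordal {ℓ})) (hg′ , ho) (holdsWeights-agree ag refl hw)

      mcs-snowball-computes : ComputesAPSP (mcs ⨾ snowball) G (store (graphMemory L) (weightMemory G)) (O[nm] 1000 U)
      mcs-snowball-computes = computesAPSP Input (λ (hg , _ , hw) → hg , hw) stable (ordered (snowball-runs G L))
        (enlarge 900 (bound-+ (mcs-time L W (nm-dominates L)) (bound-+ (dpc-time L W) (growTail-time L W))) tt) input

      mcs-chleqAPSP-computes : ComputesAPSP (mcs ⨾ chleqAPSP) G (store (graphMemory L) (weightMemory G)) (O[nm] 1000 U)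
      mcs-chleqAPSP-computes = computesAPSP Input (λ (hg , _ , hw) → hg , hw) stable (ordered (chleqAPSP-runs G L))
        (enlarge 900 (bound-+ (mcs-time L W (nm-dominates L)) (bound-+ (dpc-time L W) (chleqTail-time L W))) tt) input

  module _ {n : ℕ} {U : Graph n} (L : AdjacencyLists U) (ω : Memory (Weight∞ W)) where
    open GraphInput {W = W} L

    private
      input : Store W
      input = store (graphMemory L) ω

    recognise-decides : (Is-just (result (exec recognise input)) ⇔ Chordal U) × steps (exec recognise input) ≤ O[m] 1000 U
    recognise-decides = mk⇔ (λ i {ℓ} → proj₁ decides i {ℓ}) (proj₂ decides)
                      , ≤-trans (time execution) (bound (enlarge 1000 (recognise-time L W (m-dominates L)) tt))
      where
      execution = recognise-runs {W = W} L {s = input} (graphMemory-holds {W = W} L ω) (λ _ _ _ → refl) (λ _ _ → refl)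
      decides = runs⇒Is-just L execution λ (p , np) → np p

    mcs-finds : Chordal U → FoundPerfectOrdering U (result (exec mcs input)) × steps (exec mcs input) ≤ O[m] 1000 U
    mcs-finds chordal = finds (post execution) , ≤-trans (time execution) (bound (enlarge 1000 (mcs-time L W (m-dominates L)) tt))
      where
      execution = mcs-runs {W = W} L {s = input} (graphMemory-holds {W = W} L ω) (λ _ _ _ → refl)
      finds : ∀ {o} → Post (λ s′ → HoldsGraph s′ × Σ[ d ∈ Permutation′ n ] HoldsOrdering d s′ × Maximal U (position U d)) ⊥ o →
              FoundPerfectOrdering U o
      finds (accepted (_ , d , ho , max)) = found d (maximal⇒perfect U d max (λ {ℓ} → chordal {ℓ})) ho

  foundOrdering : ∀ {n} {U : Graph n} {o : Maybe (Store W)} → FoundPerfectOrdering U o → Σ[ d ∈ Permutation′ n ] Perfect U d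
  foundOrdering (found d perfect _) = d , perfect

mainTheorem4 : ∀ {c ℓ₁ ℓ₂ : Level} (W : OrderedAbelianGroup c ℓ₁ ℓ₂) →
    (Σ[ C ∈ ℕ ] (∀ {n} (G : WeightedDigraph W n) (L : AdjacencyLists (skeleton G)) (d : Permutation′ n) →
    Chordal (skeleton G) → Perfect (skeleton G) d →
    ComputesAPSP snowball G (store (orderedGraphMemory L d) (weightMemory G)) (O[nm] C (skeleton G)) ×
    ComputesAPSP chleqAPSP G (store (orderedGraphMemory L d) (weightMemory G)) (O[nm] C (skeleton G))))
    ×
    (Σ[ recognise ∈ Cmd ] Σ[ C ∈ ℕ ] (∀ {n} (U : Graph n) (L : AdjacencyLists U) (ω : Memory (Weight∞ W)) →
    (Is-just (result (exec recognise (store {W = W} (graphMemory L) ω))) ⇔ Chordal U) ×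
    steps (exec recognise (store {W = W} (graphMemory L) ω)) ≤ O[m] C U))
    ×
    (∀ {n} (U : Graph n) → Chordal U → Σ[ d ∈ Permutation′ n ] Perfect U d)
    ×
    (Σ[ findOrdering ∈ Cmd ] Σ[ C ∈ ℕ ]
    ((∀ {n} (U : Graph n) (L : AdjacencyLists U) (ω : Memory (Weight∞ W)) → Chordal U →
    FoundPerfectOrdering U (result (exec findOrdering (store {W = W} (graphMemory L) ω))) ×
    steps (exec findOrdering (store {W = W} (graphMemory L) ω)) ≤ O[m] C U)
    ×
    (∀ {n} (G : WeightedDigraph W n) (L : AdjacencyLists (skeleton G)) → Chordal (skeleton G) →
    ComputesAPSP (findOrdering ⨾ snowball) G (store (graphMemory L) (weightMemory G)) (O[nm] C (skeleton G)) ×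
    ComputesAPSP (findOrdering ⨾ chleqAPSP) G (store (graphMemory L) (weightMemory G)) (O[nm] C (skeleton G)))))
mainTheorem4 W =
    (1000 , λ G L d _ perfect → snowball-computes G L d perfect , chleqAPSP-computes G L d perfect)
  , (recognise , 1000 , λ U L ω → recognise-decides {W = W} L ω)
  -- Existence is extracted from a run of the search, on lists filtered from the adjacency relation
  -- and an arbitrary weight memory.
  , (λ U chordal → foundOrdering (proj₁ (mcs-finds {W = W} (adjacencyLists U) (λ _ _ _ → nothing) (λ {ℓ} → chordal {ℓ}))))
  , mcs , 1000 , (λ U L ω chordal → mcs-finds {W = W} L ω (λ {ℓ} → chordal {ℓ}))
  , λ G L chordal → mcs-snowball-computes G L (λ {ℓ} → chordal {ℓ}) , mcs-chleqAPSP-computes G L (λ {ℓ} → chordal {ℓ})
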